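{- Let $n$ be a positive integer with $n\equiv 3\pmod 4$. Then \[ \sum_{k=0}^{n-1}[6k+1]\frac{(q;q^2)_k^3(q;q^4)_k}{(q^2;q^2)_k(q^4;q^4)_k^3}q^{k^2+k} \equiv0\pmod{[n]\Phi_n(q)^3}. \]
   Context: For a complex number $x$ and integer $n\ge 0$, $(x;q)_n=\prod_{j=0}^{n-1}(1-xq^j)$ (with $(x;q)_0=1$). $[r]=(1-q^r)/(1-q)$ denotes the $q$-integer, and $\Phi_n(q)$ is the $n$-th cyclotomic polynomial in $q$. A congruence $A(q)\equiv B(q)\pmod{P(q)}$ between rational functions in $q$ whose denominators are coprime to the polynomial $P(q)$ means that $A(q)-B(q)$ is a rational function whose numerator is divisible by $P(q)$ and whose denominator is coprime to $P(q)$. -}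

module Defs where

open import Data.Nat as ℕ using (ℕ; zero; suc)
open import Data.Nat.Divisibility using (_∣?_)
open import Data.Integer as ℤ using (ℤ; +_; 0ℤ; 1ℤ)
open import Data.List using (List; []; _∷_; map; foldr; upTo; replicate; reverse; length; filter; _++_)
open import Data.Product using (_×_; _,_; proj₁; proj₂; ∃; Σ)
open import Relation.Binary.PropositionalEquality using (_≡_; _≢_)

-- Polynomials in q with integer coefficients, as coefficient lists
-- (lowest degree first).  Equality of polynomials is coefficientwise.

Poly : Set
Poly = List ℤ

coeff : Poly → ℕ → ℤ
coeff []       _       = 0ℤ
coeff (a ∷ p)  zero    = a
coeff (a ∷ p)  (suc i) = coeff p i

infix 4 _≈ₚ_
_≈ₚ_ : Poly → Poly → Set
p ≈ₚ r = ∀ i → coeff p i ≡ coeff r i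

infixl 6 _⊕_ _⊖_
infixl 7 _⊗_

_⊕_ : Poly → Poly → Poly
[]      ⊕ r       = r
(a ∷ p) ⊕ []      = a ∷ p
(a ∷ p) ⊕ (b ∷ r) = (a ℤ.+ b) ∷ (p ⊕ r)

negP : Poly → Poly
negP = map (λ x → ℤ.- x)

_⊖_ : Poly → Poly → Poly
p ⊖ r = p ⊕ negP r

scaleP : ℤ → Poly → Poly
scaleP c = map (c ℤ.*_)

_⊗_ : Poly → Poly → Poly
[]      ⊗ r = []
(a ∷ p) ⊗ r = scaleP a r ⊕ (0ℤ ∷ (p ⊗ r))

constP : ℤ → Poly
constP c = c ∷ []

oneP : Poly
oneP = constP 1ℤ

X^ : ℕ → Poly
X^ k = replicate k 0ℤ ++ (1ℤ ∷ [])

prodP : List Poly → Poly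
prodP = foldr _⊗_ oneP

_^ₚ_ : Poly → ℕ → Poly
p ^ₚ zero  = oneP
p ^ₚ suc k = p ⊗ (p ^ₚ k)

-- q-integer  [r] = (1 - q^r)/(1 - q) = 1 + q + ... + q^(r-1)

qint : ℕ → Poly
qint r = replicate r 1ℤ

poch : ℕ → ℕ → ℕ → Poly
poch a b k = prodP (map (λ j → oneP ⊖ X^ (a ℕ.+ b ℕ.* j)) (upTo k))

private
  dropZ : List ℤ → List ℤ
  dropZ []        = []
  dropZ (+ 0 ∷ xs) = dropZ xs
  dropZ (x ∷ xs)  = x ∷ xs

  subPre : List ℤ → List ℤ → List ℤ
  subPre (x ∷ xs) (y ∷ ys) = (x ℤ.- y) ∷ subPre xs ys
  subPre xs       []       = xs
  subPre []       ys       = map (λ x → ℤ.- x) ys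

  -- high-first long division by a monic divisor whose tail (below the
  -- leading 1) is bt; produces `fuel` quotient coefficients, high-first
  go : ℕ → List ℤ → List ℤ → List ℤ
  go zero    r        bt = []
  go (suc k) []       bt = 0ℤ ∷ go k [] bt
  go (suc k) (r ∷ rs) bt = r ∷ go k (subPre rs (map (r ℤ.*_) bt)) bt

divMonic : Poly → Poly → Poly
divMonic a b with dropZ (reverse a) | dropZ (reverse b)
... | ah | []      = []
... | ah | _ ∷ bt  = reverse (go (suc (length ah) ℕ.∸ length (1ℤ ∷ bt)) ah bt)

-- Cyclotomic polynomials, via the standard recursion
--   Φ_n(q) = (q^n - 1) / ∏_{d ∣ n, d < n} Φ_d(q).

cycTable : ℕ → List (ℕ × Poly)
cycTable zero    = []
cycTable (suc m) =
  cycTable m ++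
  ((suc m , divMonic (X^ (suc m) ⊖ oneP)
              (prodP (map proj₂ (filter (λ e → proj₁ e ∣? suc m) (cycTable m)))))
   ∷ [])

private
  lastP : List (ℕ × Poly) → Poly
  lastP []           = oneP
  lastP (e ∷ [])     = proj₂ e
  lastP (_ ∷ e ∷ es) = lastP (e ∷ es)

-- Φ_n(q) for n ≥ 1 (Φ_0 is set to 1 by convention; it is never used)
Φ : ℕ → Poly
Φ n = lastP (cycTable n)

RatFun : Set
RatFun = Poly × Poly

_⊕ᵣ_ : RatFun → RatFun → RatFun
(a , b) ⊕ᵣ (c , d) = (a ⊗ d ⊕ c ⊗ b , b ⊗ d)

zeroᵣ : RatFun
zeroᵣ = ([] , oneP)

sumᵣ : List RatFun → RatFun
sumᵣ = foldr _⊕ᵣ_ zeroᵣ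

-- Coprimality of polynomials in ℚ[q] (for integer polynomials):
-- U·B + V·P is a nonzero constant for some U, V ∈ ℤ[q].
CoprimeP : Poly → Poly → Set
CoprimeP B P = Σ ℤ λ c → c ≢ 0ℤ × ∃ λ U → ∃ λ V → U ⊗ B ⊕ V ⊗ P ≈ₚ constP c

-- Divisibility P ∣ A in ℚ[q] (for integer polynomials)
DividesP : Poly → Poly → Set
DividesP P A = Σ ℤ λ c → c ≢ 0ℤ × ∃ λ C → scaleP c A ≈ₚ P ⊗ C

CongZero : RatFun → Poly → Set
CongZero (A , B) P =
  ∃ λ A' → ∃ λ B' → A' ⊗ B ≈ₚ A ⊗ B' × CoprimeP B' P × DividesP P A'

term : ℕ → RatFun
term k =
  ( qint (6 ℕ.* k ℕ.+ 1) ⊗ (poch 1 2 k ^ₚ 3) ⊗ poch 1 4 k ⊗ X^ (k ℕ.* k ℕ.+ k)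
  , poch 2 2 k ⊗ (poch 4 4 k ^ₚ 3) )

S : ℕ → RatFun
S n = sumᵣ (map term (upTo n))

{-# OPTIONS --safe #-}

-- The terms are deformed by two parameters, w = u + 1/u and x, in the Gasper–Rahman manner: (q;q²)_k² becomes
-- (uq, q/u; q²)_k and (q;q⁴)_k becomes ∏ (x - q^{4j+1}).  The truncated sums N(w, x) satisfy a first-order recurrence
-- under x ↦ q⁴ x.  Modulo Φ_d, d odd, q has period d; iterating the recurrence through a period shows that N vanishes
-- to first order in w at (2, 1), even with x = 1 + δ, δ² = 0.  For d = n ≡ 3 (mod 4) the recurrence also gives
-- N(q^n + q^{-n}, 1) = 0 exactly and a product formula for N(w, q^{3n}), whose values at w = 2 and w = q^n + q^{-n} are
-- congruent modulo Φ_n⁴.  The remaining mixed difference of N is (1 - q^n)² (1 - q^{3n}) times a quantity that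
-- is ≡ 0 modulo Φ_n by the previous vanishing; hence N(2, 1) ≡ 0 modulo Φ_n⁴.  The parameters are homogenised by a
-- scale s (with s = q^n the value q^n + q^{-n} becomes 1 + q^{2n}), which avoids negative powers of q.
-- For a proper divisor d > 1 of n the sum splits into blocks of length d that are, modulo Φ_d, proportional to the
-- first one, which vanishes.  This needs the terms to be integral at all Φ_d with d odd; for (q;q⁴)_k / (q⁴;q⁴)_k it
-- follows from the q-Vandermonde sum, which expresses its self-convolution through (q²;q⁴)_k / (q⁴;q⁴)_k.
module Submission where

open import Defs
open import Algebra using (CommutativeRing)
import Algebra.Consequences.Setoid as Consequences
open import Algebra.Morphism.Structures using (IsRingHomomorphism)
open import Algebra.Solver.Ring.AlmostCommutativeRing using (fromCommutativeRing; _-Raw-AlmostCommutative⟶_)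
open import Data.Bool using (if_then_else_)
open import Data.Empty using (⊥-elim)
open import Data.Integer as ℤ using (ℤ; +_; -[1+_]; 0ℤ; 1ℤ)
import Data.Integer.Properties as ℤ
open import Data.List using (List; []; _∷_; map; _++_; reverse; length; replicate; foldl; filter; applyUpTo)
import Data.List.Properties as List
open import Data.List.Relation.Unary.All as All using (All)
import Data.List.Relation.Unary.All.Properties as All
open import Data.Maybe using (Maybe; just; nothing)
open import Data.Nat as ℕ using (ℕ; zero; suc; _≤_; _<_; _<?_; _%_; _/_; z≤n; s≤s)
open import Data.Nat.Coprimality using (Coprime; coprime-divisor)
open import Data.Nat.Divisibility as ℕ∣ using (_∣_; _∣?_; divides; ∣1⇒≡1; ∣m+n∣m⇒∣n; ∣-trans; m∣m*n; ∣n⇒∣m*n; ∣⇒≤)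
open import Data.Nat.DivMod using (m≡m%n+[m/n]*n)
open import Data.Nat.GCD as GCD using (gcd)
open import Data.Nat.Induction using (<-rec)
import Data.Nat.Properties as ℕ
open import Data.Nat.Tactic.RingSolver using (solve-∀)
open import Data.Product using (_×_; _,_; proj₁; proj₂; ∃; Σ)
open import Data.Sum using (_⊎_; inj₁; inj₂)
open import Function using (flip)
open import Level using (0ℓ)
open import Relation.Binary using (IsEquivalence; Setoid; tri<; tri≈; tri>)
open import Relation.Binary.PropositionalEquality as ≡ using (_≡_; _≢_)
open import Relation.Nullary using (¬_; Dec; yes; no; does; contradiction)

-- Two kinds of information must be combined: exact values of the sum at distinct points and
-- infinitesimal vanishing modulo Φ_n. Both come from one ring, with `η³ = h η²` and `δ² = g δ`.
-- Over `ℤ[q]`, setting `η` to `0` or `h` and `δ` to `0` or `g` gives honest values, whose mixed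
-- difference is exactly `h g` times a polynomial. Modulo `P`, which divides `h` and `g`, both
-- generators are nilpotent. The cubic relation is essential: a full period of the recurrence yields
-- only `N * η ≈ 0`, and `η` cannot be cancelled, so `η²` has to survive for the coefficient of `η`
-- in `N` to be seen. The special points are dictated by the steps `x ↦ q⁴ x`. At `x = q` all terms
-- but the first vanish, and `q^(3n)` is reachable from `q` because 3n ≡ 1 (mod 4). Starting at
-- `x = 1`, the recurrence meets the factor `f (q ^ n)` after (n + 1)/4 steps, and with `s = q ^ n`
-- this is zero at `w = 1 + s²`.

coprime-4 : ∀ r → Coprime (suc (2 ℕ.* r)) 4
coprime-4 r {d} (d∣n , d∣4) = ∣1⇒≡1 (∣m+n∣m⇒∣n (≡.subst (d ∣_) (ℕ.+-comm 1 (2 ℕ.* r)) d∣n) (∣-trans d∣2 (m∣m*n r)))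
  where
  d∣2 : d ∣ 2
  d∣2 = ∣m+n∣m⇒∣n {m = 2 ℕ.* (2 ℕ.* r)} (≡.subst (d ∣_) (ar r) (∣n⇒∣m*n 2 d∣n)) (≡.subst (d ∣_) (ar′ r) (∣n⇒∣m*n r d∣4))
    where
    ar : ∀ r → 2 ℕ.* suc (2 ℕ.* r) ≡ 2 ℕ.* (2 ℕ.* r) ℕ.+ 2
    ar = solve-∀
    ar′ : ∀ r → r ℕ.* 4 ≡ 2 ℕ.* (2 ℕ.* r)
    ar′ = solve-∀

-- As `n` is odd it would have to divide `suc i`, which is at most `2 r`. This keeps the
-- denominators with index below `n` coprime to Φ_n.
∤4+4i : ∀ r i → i < 2 ℕ.* r → ¬ (suc (2 ℕ.* r) ∣ 4 ℕ.+ 4 ℕ.* i)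
∤4+4i r i i<2r d = ℕ.<⇒≱ (s≤s i<2r) (∣⇒≤ (coprime-divisor (coprime-4 r) (≡.subst (suc (2 ℕ.* r) ∣_) (≡.sym (ℕ.*-suc 4 i)) d)))

∤2+2i : ∀ r i → i < 2 ℕ.* r → ¬ (suc (2 ℕ.* r) ∣ 2 ℕ.+ 2 ℕ.* i)
∤2+2i r i i<2r d = ∤4+4i r i i<2r (∣-trans d (divides 2 (ar i)))
  where
  ar : ∀ i → 4 ℕ.+ 4 ℕ.* i ≡ 2 ℕ.* (2 ℕ.+ 2 ℕ.* i)
  ar = solve-∀

∣3+4i-injective-≤ : ∀ r {i j} → let n = suc (2 ℕ.* r) in i ≤ j → j < n → n ∣ 3 ℕ.+ 4 ℕ.* i → n ∣ 3 ℕ.+ 4 ℕ.* j → i ≡ j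
∣3+4i-injective-≤ r {i} {j} i≤j j<n di dj with j ℕ.∸ i | ℕ.m+[n∸m]≡n i≤j
... | zero  | e = ≡.trans (≡.sym (ℕ.+-identityʳ i)) e
... | suc k | ≡.refl = ⊥-elim (ℕ.<⇒≱ (ℕ.≤-<-trans (ℕ.m≤n+m (suc k) i) j<n)
  (∣⇒≤ (coprime-divisor (coprime-4 r) (∣m+n∣m⇒∣n (≡.subst (suc (2 ℕ.* r) ∣_) (ar i k) dj) di))))
  where
  ar : ∀ i k → 3 ℕ.+ 4 ℕ.* (i ℕ.+ suc k) ≡ (3 ℕ.+ 4 ℕ.* i) ℕ.+ 4 ℕ.* suc k
  ar = solve-∀

-- Within one period of `x ↦ q⁴ x`, at most one factor `f (q ^ (3 + 4 i) * x)` can then fail to be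
-- regular; all the others may be cancelled.
∣3+4i-injective : ∀ r {i j} → let n = suc (2 ℕ.* r) in i < n → j < n → n ∣ 3 ℕ.+ 4 ℕ.* i → n ∣ 3 ℕ.+ 4 ℕ.* j → i ≡ j
∣3+4i-injective r {i} {j} i<n j<n di dj with ℕ.≤-total i j
... | inj₁ i≤j = ∣3+4i-injective-≤ r i≤j j<n di dj
... | inj₂ j≤i = ≡.sym (∣3+4i-injective-≤ r j≤i i<n dj di)

-- Commutative rings and the deformed sums

module Over (R : CommutativeRing 0ℓ 0ℓ) where
  open CommutativeRing R public hiding (zero)
  open import Algebra.Properties.Ring ring public
  open import Algebra.Properties.AbelianGroup +-abelianGroup using (⁻¹-∙-comm)
  open import Algebra.Properties.Semiring.Mult.TCOptimised semiring using (×-homo-+; ×1-homo-*; 1+×) renaming (_×_ to _·_)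
  open import Algebra.Properties.Semiring.Exp semiring public using (_^_; ^-congˡ; ^-homo-*; ^-assocʳ)
  open import Relation.Binary.Reasoning.Setoid setoid

  fromℤ : ℤ → Carrier
  fromℤ (+ n)    = n · 1#
  fromℤ -[1+ n ] = - (ℕ.suc n · 1#)

  fromℤ-⊖ : ∀ m n → fromℤ (m ℤ.⊖ n) ≈ m · 1# + - (n · 1#)
  fromℤ-⊖ zero zero = sym (-‿inverseʳ 0#)
  fromℤ-⊖ zero (suc n) = sym (+-identityˡ _)
  fromℤ-⊖ (suc m) zero = sym (trans (+-congˡ -0#≈0#) (+-identityʳ _))
  fromℤ-⊖ (suc m) (suc n) = begin
    fromℤ (suc m ℤ.⊖ suc n) ≡⟨ ≡.cong fromℤ (ℤ.[1+m]⊖[1+n]≡m⊖n m n) ⟩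
    fromℤ (m ℤ.⊖ n) ≈⟨ fromℤ-⊖ m n ⟩
    m · 1# + - (n · 1#) ≈⟨ +-congˡ (+-identityˡ _) ⟨
    m · 1# + (0# + - (n · 1#)) ≈⟨ +-congˡ (+-congʳ (-‿inverseʳ 1#)) ⟨
    m · 1# + ((1# + - 1#) + - (n · 1#)) ≈⟨ +-congˡ (+-assoc _ _ _) ⟩
    m · 1# + (1# + (- 1# + - (n · 1#))) ≈⟨ +-assoc _ _ _ ⟨
    (m · 1# + 1#) + (- 1# + - (n · 1#)) ≈⟨ +-cong (trans (+-comm _ _) (sym (1+× m 1#))) (trans (⁻¹-∙-comm _ _) (-‿cong (sym (1+× n 1#)))) ⟩
    suc m · 1# + - (suc n · 1#) ∎

  fromℤ-+ : ∀ i j → fromℤ (i ℤ.+ j) ≈ fromℤ i + fromℤ j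
  fromℤ-+ (+ m) (+ n) = ×-homo-+ 1# m n
  fromℤ-+ (+ m) -[1+ n ] = fromℤ-⊖ m (suc n)
  fromℤ-+ -[1+ m ] (+ n) = trans (fromℤ-⊖ n (suc m)) (+-comm _ _)
  fromℤ-+ -[1+ m ] -[1+ n ] = begin
    - (suc (suc (m ℕ.+ n)) · 1#) ≡⟨ ≡.cong (λ k → - (suc k · 1#)) (≡.sym (ℕ+suc m n)) ⟩
    - ((suc m ℕ.+ suc n) · 1#) ≈⟨ -‿cong (×-homo-+ 1# (suc m) (suc n)) ⟩
    - (suc m · 1# + suc n · 1#) ≈⟨ ⁻¹-∙-comm _ _ ⟨
    - (suc m · 1#) + - (suc n · 1#) ∎
    where ℕ+suc : ∀ m n → m ℕ.+ suc n ≡.≡ suc (m ℕ.+ n)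
          ℕ+suc zero n = ≡.refl
          ℕ+suc (suc m) n = ≡.cong suc (ℕ+suc m n)

  fromℤ-neg : ∀ i → fromℤ (ℤ.- i) ≈ - fromℤ i
  fromℤ-neg (+ zero) = sym -0#≈0#
  fromℤ-neg (+ suc n) = refl
  fromℤ-neg -[1+ n ] = sym (-‿involutive _)

  fromℤ-*⁺ : ∀ m j → fromℤ (+ m ℤ.* j) ≈ m · 1# * fromℤ j
  fromℤ-*⁺ m (+ n) = trans (reflexive (≡.cong fromℤ (≡.sym (ℤ.pos-* m n)))) (×1-homo-* m n)
  fromℤ-*⁺ m -[1+ n ] = begin
    fromℤ (+ m ℤ.* -[1+ n ]) ≡⟨ ≡.cong fromℤ (≡.sym (ℤ.neg-distribʳ-* (+ m) (+ suc n))) ⟩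
    fromℤ (ℤ.- (+ m ℤ.* + suc n)) ≈⟨ fromℤ-neg (+ m ℤ.* + suc n) ⟩
    - fromℤ (+ m ℤ.* + suc n) ≈⟨ -‿cong (fromℤ-*⁺ m (+ suc n)) ⟩
    - (m · 1# * suc n · 1#) ≈⟨ -‿distribʳ-* _ _ ⟩
    m · 1# * - (suc n · 1#) ∎

  fromℤ-* : ∀ i j → fromℤ (i ℤ.* j) ≈ fromℤ i * fromℤ j
  fromℤ-* (+ m) j = fromℤ-*⁺ m j
  fromℤ-* -[1+ m ] j = begin
    fromℤ (-[1+ m ] ℤ.* j) ≡⟨ ≡.cong fromℤ (≡.sym (ℤ.neg-distribˡ-* (+ suc m) j)) ⟩
    fromℤ (ℤ.- (+ suc m ℤ.* j)) ≈⟨ fromℤ-neg (+ suc m ℤ.* j) ⟩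
    - fromℤ (+ suc m ℤ.* j) ≈⟨ -‿cong (fromℤ-*⁺ (suc m) j) ⟩
    - (suc m · 1# * fromℤ j) ≈⟨ -‿distribˡ-* _ _ ⟩
    - (suc m · 1#) * fromℤ j ∎

  fromℤ-homo : CommutativeRing.rawRing ℤ.+-*-commutativeRing -Raw-AlmostCommutative⟶ fromCommutativeRing R
  fromℤ-homo = record
    { ⟦_⟧ = fromℤ ; +-homo = fromℤ-+ ; *-homo = fromℤ-* ; -‿homo = fromℤ-neg
    ; 0-homo = refl ; 1-homo = refl }

  fromℤ-≟ : ∀ i j → Maybe (fromℤ i ≈ fromℤ j)
  fromℤ-≟ i j with i ℤ.≟ j
  ... | yes p = just (reflexive (≡.cong fromℤ p))
  ... | no _  = nothing

  open import Algebra.Solver.Ring (CommutativeRing.rawRing ℤ.+-*-commutativeRing) (fromCommutativeRing R) fromℤ-homo fromℤ-≟ public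
    using (solve; _:=_; con; _:+_; _:*_; _:-_; :-_; _:^_)

  ∏ : ℕ → (ℕ → Carrier) → Carrier
  ∏ zero    F = 1#
  ∏ (suc n) F = ∏ n F * F n

  ∑ : ℕ → (ℕ → Carrier) → Carrier
  ∑ zero    F = 0#
  ∑ (suc n) F = ∑ n F + F n

  ∏-cong : ∀ n {F G} → (∀ i → i < n → F i ≈ G i) → ∏ n F ≈ ∏ n G
  ∏-cong zero    e = refl
  ∏-cong (suc n) e = *-cong (∏-cong n λ i i<n → e i (ℕ.m<n⇒m<1+n i<n)) (e n ℕ.≤-refl)

  ∑-cong : ∀ n {F G} → (∀ i → i < n → F i ≈ G i) → ∑ n F ≈ ∑ n G
  ∑-cong zero    e = refl
  ∑-cong (suc n) e = +-cong (∑-cong n λ i i<n → e i (ℕ.m<n⇒m<1+n i<n)) (e n ℕ.≤-refl)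

  *-interchange : ∀ a b c d → (a * b) * (c * d) ≈ (a * c) * (b * d)
  *-interchange = solve 4 (λ a b c d → (a :* b) :* (c :* d) := (a :* c) :* (b :* d)) refl

  ∏-* : ∀ n F G → ∏ n (λ i → F i * G i) ≈ ∏ n F * ∏ n G
  ∏-* zero    F G = sym (*-identityˡ 1#)
  ∏-* (suc n) F G = trans (*-congʳ (∏-* n F G)) (*-interchange _ _ _ _)

  ∏-+ : ∀ m n F → ∏ (m ℕ.+ n) F ≈ ∏ m F * ∏ n (λ i → F (m ℕ.+ i))
  ∏-+ m zero    F = trans (reflexive (≡.cong (λ k → ∏ k F) (ℕ.+-identityʳ m))) (sym (*-identityʳ _))
  ∏-+ m (suc n) F = begin
    ∏ (m ℕ.+ suc n) F ≡⟨ ≡.cong (λ k → ∏ k F) (ℕ.+-suc m n) ⟩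
    ∏ (m ℕ.+ n) F * F (m ℕ.+ n) ≈⟨ *-congʳ (∏-+ m n F) ⟩
    ∏ m F * ∏ n (λ i → F (m ℕ.+ i)) * F (m ℕ.+ n) ≈⟨ *-assoc _ _ _ ⟩
    ∏ m F * ∏ (suc n) (λ i → F (m ℕ.+ i)) ∎

  ∑-+ : ∀ m n F → ∑ (m ℕ.+ n) F ≈ ∑ m F + ∑ n (λ i → F (m ℕ.+ i))
  ∑-+ m zero    F = trans (reflexive (≡.cong (λ k → ∑ k F) (ℕ.+-identityʳ m))) (sym (+-identityʳ _))
  ∑-+ m (suc n) F = begin
    ∑ (m ℕ.+ suc n) F ≡⟨ ≡.cong (λ k → ∑ k F) (ℕ.+-suc m n) ⟩
    ∑ (m ℕ.+ n) F + F (m ℕ.+ n) ≈⟨ +-congʳ (∑-+ m n F) ⟩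
    ∑ m F + ∑ n (λ i → F (m ℕ.+ i)) + F (m ℕ.+ n) ≈⟨ +-assoc _ _ _ ⟩
    ∑ m F + ∑ (suc n) (λ i → F (m ℕ.+ i)) ∎

  *-distribˡ-∑ : ∀ a n F → a * ∑ n F ≈ ∑ n (λ i → a * F i)
  *-distribˡ-∑ a zero    F = zeroʳ a
  *-distribˡ-∑ a (suc n) F = trans (distribˡ _ _ _) (+-congʳ (*-distribˡ-∑ a n F))

  -- Cancelling non-zero-divisors replaces division. Modulo `P` the extensions by `η` and `δ`
  -- contain nilpotents, so being nonzero would not suffice.
  Regular : Carrier → Set
  Regular a = ∀ b → a * b ≈ 0# → b ≈ 0#

  Regular-resp : ∀ {a b} → a ≈ b → Regular a → Regular b
  Regular-resp a≈b r c bc≈0 = r c (trans (*-congʳ a≈b) bc≈0)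

  Regular-* : ∀ {a b} → Regular a → Regular b → Regular (a * b)
  Regular-* r t c e = t c (r _ (trans (sym (*-assoc _ _ _)) e))

  Regular-1 : Regular 1#
  Regular-1 b e = trans (sym (*-identityˡ b)) e

  Regular-^ : ∀ {a} n → Regular a → Regular (a ^ n)
  Regular-^ zero    r = Regular-1
  Regular-^ (suc n) r = Regular-* r (Regular-^ n r)

  Regular-∏ : ∀ n {F} → (∀ i → i < n → Regular (F i)) → Regular (∏ n F)
  Regular-∏ zero    r = Regular-1
  Regular-∏ (suc n) r = Regular-* (Regular-∏ n λ i i<n → r i (ℕ.m<n⇒m<1+n i<n)) (r n ℕ.≤-refl)

  Regular-cancel : ∀ {a b c} → Regular a → a * b ≈ a * c → b ≈ c
  Regular-cancel {a} {b} {c} r e = x-y≈0⇒x≈y (r (b - c) (begin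
    a * (b - c) ≈⟨ solve 3 (λ a b c → a :* (b :- c) := a :* b :- a :* c) refl a b c ⟩
    a * b - a * c ≈⟨ +-congʳ e ⟩
    a * c - a * c ≈⟨ -‿inverseʳ _ ⟩
    0# ∎))
    where
    x-y≈0⇒x≈y : ∀ {x y} → x - y ≈ 0# → x ≈ y
    x-y≈0⇒x≈y {x} {y} e = begin
      x ≈⟨ solve 2 (λ x y → x := (x :- y) :+ y) refl x y ⟩
      (x - y) + y ≈⟨ +-congʳ e ⟩
      0# + y ≈⟨ +-identityˡ y ⟩
      y ∎

  -- The cofactor is left abstract: all that matters is that it inherits regularity from the
  -- remaining factors, so that a single bad factor can be isolated.
  ∏-extract : ∀ {n i} F → i < n →
    Σ Carrier λ c → ∏ n F ≈ F i * c × ((∀ j → j < n → j ≢ i → Regular (F j)) → Regular c)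
  ∏-extract {suc n} {i} F i<1+n with ℕ.m≤n⇒m<n∨m≡n (ℕ.≤-pred i<1+n)
  ... | inj₁ i<n with ∏-extract F i<n
  ... | c , e , r = c * F n , trans (*-congʳ e) (*-assoc _ _ _)
      , λ t → Regular-* (r λ j j<n → t j (ℕ.m<n⇒m<1+n j<n)) (t n ℕ.≤-refl λ n≡i → ℕ.<-irrefl (≡.sym n≡i) i<n)
  ∏-extract {suc n} F i<1+n | inj₂ ≡.refl = ∏ n F , *-comm _ _
      , λ t → Regular-∏ n λ j j<n → t j (ℕ.m<n⇒m<1+n j<n) (ℕ.<⇒≢ j<n)

  ∏-zero : ∀ {n i} F → i < n → F i ≈ 0# → ∏ n F ≈ 0#
  ∏-zero F i<n e with ∏-extract F i<n
  ... | c , p , _ = trans p (trans (*-congʳ e) (zeroˡ c))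

  ^-linear : ∀ q a b m → q ^ (b ℕ.+ a ℕ.* m) ≈ q ^ b * (q ^ m) ^ a
  ^-linear q a b m = begin
    q ^ (b ℕ.+ a ℕ.* m) ≈⟨ ^-homo-* q b (a ℕ.* m) ⟩
    q ^ b * q ^ (a ℕ.* m) ≡⟨ ≡.cong (λ k → q ^ b * q ^ k) (ℕ.*-comm a m) ⟩
    q ^ b * q ^ (m ℕ.* a) ≈⟨ *-congˡ (^-assocʳ q m a) ⟨
    q ^ b * (q ^ m) ^ a ∎

  -- The products of `upper q` over those of `lower q` are the Pochhammer part of the terms, without
  -- `[6k+1]` and the power of `q`.
  upper lower : Carrier → ℕ → Carrier
  upper q i = (1# - q ^ (1 ℕ.+ 2 ℕ.* i)) ^ 3 * (1# - q ^ (1 ℕ.+ 4 ℕ.* i))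
  lower q i = (1# - q ^ (2 ℕ.+ 2 ℕ.* i)) * (1# - q ^ (4 ℕ.+ 4 ℕ.* i)) ^ 3

  module Series (q s w : Carrier) where

    -- With `w = s (u + 1/u)` this is `s (1 - u y) (1 - y/u)`, the deformation of `s (1 - y)²`.
    f : Carrier → Carrier
    f y = s - w * y + s * (y * y)

    g : Carrier → Carrier
    g y = (1# - y) * f y

    node : Carrier → ℕ → Carrier
    node x i = x - q ^ (1 ℕ.+ 4 ℕ.* i)

    gs : ℕ → Carrier
    gs i = g (q ^ (1 ℕ.+ 2 ℕ.* i))

    -- N x n is the sum over k < n of num x k / (den x 1 ⋯ den x k), over the common denominator den x 1 ⋯ den x (n - 1).
    -- For w = 2 s and x = 1 the k-th fraction is 1 - q times the k-th term of the theorem.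
    num : Carrier → ℕ → Carrier
    num x k = (1# - q ^ (1 ℕ.+ 6 ℕ.* k)) * q ^ (k ℕ.* k ℕ.+ k) * (∏ k gs * ∏ k (node x))

    den : Carrier → ℕ → Carrier
    den x k = g (q ^ (4 ℕ.* k)) * (1# - q ^ (2 ℕ.* k) * x)

    N : Carrier → ℕ → Carrier
    N x zero    = 0#
    N x (suc k) = N x k * den x k + num x k

    boundary : Carrier → ℕ → Carrier
    boundary x m = x * q ^ (suc m ℕ.* suc m ℕ.+ suc m) * (∏ (suc m) gs * ∏ m (node x))

    f-cong : ∀ {y z} → y ≈ z → f y ≈ f z
    f-cong e = +-cong (+-congˡ (-‿cong (*-congˡ e))) (*-congˡ (*-cong e e))

    g-cong : ∀ {y z} → y ≈ z → g y ≈ g z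
    g-cong e = *-cong (+-congˡ (-‿cong e)) (f-cong e)

    private
      minus-cong : ∀ {x y z} → y ≈ z → x - y ≈ x - z
      minus-cong e = +-congˡ (-‿cong e)

      -- Scaling `x` by `q ^ 4` shifts the index: `node (x * q ^ 4) (suc i)` is `q ^ 4 * node x i`,
      -- and only the node of index 0 is new.
      nodes-shift : ∀ m x → ∏ (suc m) (node (x * q ^ 4)) ≈ (x * q ^ 4 - q) * (q ^ m) ^ 4 * ∏ m (node x)
      nodes-shift zero x = solve 2 (λ x q → let one = con (+ 1) in one :* (x :* q :^ 4 :- q :^ 1) := (x :* q :^ 4 :- q) :* one :^ 4 :* one) refl x q
      nodes-shift (suc m) x = begin
        ∏ (suc m) (node (x * q ^ 4)) * node (x * q ^ 4) (suc m)
          ≈⟨ *-cong (nodes-shift m x) (minus-cong (^-linear q 4 1 (suc m))) ⟩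
        (x * q ^ 4 - q) * (q ^ m) ^ 4 * ∏ m (node x) * (x * q ^ 4 - q ^ 1 * (q * q ^ m) ^ 4)
          ≈⟨ solve 4 (λ x q v p → (x :* q :^ 4 :- q) :* v :^ 4 :* p :* (x :* q :^ 4 :- q :^ 1 :* (q :* v) :^ 4)
               := (x :* q :^ 4 :- q) :* (q :* v) :^ 4 :* (p :* (x :- q :^ 1 :* v :^ 4))) refl x q (q ^ m) (∏ m (node x)) ⟩
        (x * q ^ 4 - q) * (q * q ^ m) ^ 4 * (∏ m (node x) * (x - q ^ 1 * (q ^ m) ^ 4))
          ≈⟨ *-congˡ (*-congˡ (minus-cong (^-linear q 4 1 m))) ⟨
        (x * q ^ 4 - q) * (q ^ suc m) ^ 4 * ∏ (suc m) (node x) ∎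

      triangle-step : ∀ k → q ^ (suc k ℕ.* suc k ℕ.+ suc k) ≈ q ^ (k ℕ.* k ℕ.+ k) * (q ^ k) ^ 2 * q ^ 2
      triangle-step k = begin
        q ^ (suc k ℕ.* suc k ℕ.+ suc k) ≡⟨ ≡.cong (q ^_) (ar k) ⟩
        q ^ ((k ℕ.* k ℕ.+ k) ℕ.+ (2 ℕ.+ 2 ℕ.* k)) ≈⟨ ^-homo-* q (k ℕ.* k ℕ.+ k) (2 ℕ.+ 2 ℕ.* k) ⟩
        q ^ (k ℕ.* k ℕ.+ k) * q ^ (2 ℕ.+ 2 ℕ.* k) ≈⟨ *-congˡ (^-linear q 2 2 k) ⟩
        q ^ (k ℕ.* k ℕ.+ k) * (q ^ 2 * (q ^ k) ^ 2) ≈⟨ solve 3 (λ a b c → a :* (b :* c) := a :* c :* b) refl _ _ _ ⟩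
        q ^ (k ℕ.* k ℕ.+ k) * (q ^ k) ^ 2 * q ^ 2 ∎
        where
        ar : ∀ k → suc k ℕ.* suc k ℕ.+ suc k ≡ (k ℕ.* k ℕ.+ k) ℕ.+ (2 ℕ.+ 2 ℕ.* k)
        ar = solve-∀

      -- The inhomogeneous part of the inductive step of `recurrence`: the old boundary and the new
      -- term at `x * q ^ 4` balance the new term at `x` and the new boundary.
      key : ∀ m x → let M = suc m in
        boundary x m * den (x * q ^ 4) M + num (x * q ^ 4) M * f (q ^ 3 * x)
        ≈ s * num x M * ((1# - q ^ (2 ℕ.+ 2 ℕ.* M) * x) * (1# - q ^ (2 ℕ.+ 2 ℕ.* suc M) * x)) + boundary x M
      key m x = begin
        boundary x m * den (x * q ^ 4) M + num (x * q ^ 4) M * f (q ^ 3 * x)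
          ≈⟨ +-cong (*-congˡ (*-cong (g-cong (^-linear q 4 0 M)) (minus-cong (*-congʳ (^-linear q 2 0 M)))))
                    (*-congʳ (*-cong (*-congʳ (minus-cong (^-linear q 6 1 M))) (*-congˡ (nodes-shift m x)))) ⟩
        x * t * (G * X) * (g (1# * u ^ 4) * (1# - 1# * u ^ 2 * (x * q ^ 4)))
          + (1# - q ^ 1 * u ^ 6) * t * (G * ((x * q ^ 4 - q) * v ^ 4 * X)) * f (q ^ 3 * x)
          ≈⟨ solve 8 (λ q v x w s t G X → let u = q :* v ; one = con (+ 1)
                                              f′ = λ y → s :- w :* y :+ s :* (y :* y)
                                              g′ = λ y → (one :- y) :* f′ y in
               x :* t :* (G :* X) :* (g′ (one :* u :^ 4) :* (one :- one :* u :^ 2 :* (x :* q :^ 4)))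
               :+ (one :- q :^ 1 :* u :^ 6) :* t :* (G :* ((x :* q :^ 4 :- q) :* v :^ 4 :* X)) :* f′ (q :^ 3 :* x)
               := (t :* (G :* X)) :* (x :* (g′ (u :^ 4) :* (one :- u :^ 2 :* (x :* q :^ 4)))
               :+ (one :- q :* u :^ 6) :* ((x :* q :^ 4 :- q) :* v :^ 4) :* f′ (q :^ 3 :* x)))
               refl q v x w s t G X ⟩
        (t * (G * X)) * (x * (g (u ^ 4) * (1# - u ^ 2 * (x * q ^ 4))) + (1# - q * u ^ 6) * ((x * q ^ 4 - q) * v ^ 4) * f (q ^ 3 * x))
          -- The real content: with the common factor `t * (G * X)` taken out, a polynomial identity
          -- in `q`, `q ^ m`, `x`, `w` and `s` remains. The neighbouring solver calls only rearrange
          -- products.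
          ≈⟨ *-congˡ (solve 5 (λ q v x w s → let u = q :* v ; one = con (+ 1)
                                                 f′ = λ y → s :- w :* y :+ s :* (y :* y)
                                                 g′ = λ y → (one :- y) :* f′ y in
               x :* (g′ (u :^ 4) :* (one :- u :^ 2 :* (x :* q :^ 4)))
               :+ (one :- q :* u :^ 6) :* ((x :* q :^ 4 :- q) :* v :^ 4) :* f′ (q :^ 3 :* x)
               := s :* (one :- q :* u :^ 6) :* (x :- q :* v :^ 4) :* ((one :- q :^ 2 :* u :^ 2 :* x) :* (one :- q :^ 4 :* u :^ 2 :* x))
               :+ x :* u :^ 2 :* q :^ 2 :* g′ (q :* u :^ 2) :* (x :- q :* v :^ 4))
               refl q v x w s) ⟩
        (t * (G * X)) * (s * (1# - q * u ^ 6) * (x - q * v ^ 4) * ((1# - q ^ 2 * u ^ 2 * x) * (1# - q ^ 4 * u ^ 2 * x))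
          + x * u ^ 2 * q ^ 2 * g (q * u ^ 2) * (x - q * v ^ 4))
          ≈⟨ solve 8 (λ q v x w s t G X → let u = q :* v ; one = con (+ 1)
                                              f′ = λ y → s :- w :* y :+ s :* (y :* y)
                                              g′ = λ y → (one :- y) :* f′ y in
               (t :* (G :* X)) :* (s :* (one :- q :* u :^ 6) :* (x :- q :* v :^ 4) :* ((one :- q :^ 2 :* u :^ 2 :* x) :* (one :- q :^ 4 :* u :^ 2 :* x))
               :+ x :* u :^ 2 :* q :^ 2 :* g′ (q :* u :^ 2) :* (x :- q :* v :^ 4))
               := s :* ((one :- q :^ 1 :* u :^ 6) :* t :* (G :* (X :* (x :- q :^ 1 :* v :^ 4)))) :* ((one :- q :^ 2 :* u :^ 2 :* x) :* (one :- q :^ 2 :* (q :* u) :^ 2 :* x))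
               :+ x :* (t :* u :^ 2 :* q :^ 2) :* (G :* g′ (q :^ 1 :* u :^ 2) :* (X :* (x :- q :^ 1 :* v :^ 4))))
               refl q v x w s t G X ⟩
        s * ((1# - q ^ 1 * u ^ 6) * t * (G * (X * (x - q ^ 1 * v ^ 4)))) * ((1# - q ^ 2 * u ^ 2 * x) * (1# - q ^ 2 * (q ^ suc M) ^ 2 * x))
          + x * (t * u ^ 2 * q ^ 2) * (G * g (q ^ 1 * u ^ 2) * (X * (x - q ^ 1 * v ^ 4)))
          ≈⟨ +-cong
               (*-cong (*-congˡ (*-cong (*-congʳ (minus-cong (^-linear q 6 1 M))) (*-congˡ (*-congˡ (minus-cong (^-linear q 4 1 m))))))
                       (*-cong (minus-cong (*-congʳ (^-linear q 2 2 M))) (minus-cong (*-congʳ (^-linear q 2 2 (suc M))))))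
               (*-cong (*-congˡ (triangle-step M)) (*-cong (*-congˡ (g-cong (^-linear q 2 1 M))) (*-congˡ (minus-cong (^-linear q 4 1 m))))) ⟨
        s * num x M * ((1# - q ^ (2 ℕ.+ 2 ℕ.* M) * x) * (1# - q ^ (2 ℕ.+ 2 ℕ.* suc M) * x)) + boundary x M ∎
        where
        M = suc m
        v = q ^ m
        u = q ^ M
        t = q ^ (M ℕ.* M ℕ.+ M)
        G = ∏ M gs
        X = ∏ m (node x)

    N-1 : ∀ x → N x 1 ≈ 1# - q
    N-1 x = solve 2 (λ q d → let one = con (+ 1) in con (+ 0) :* d :+ (one :- q :^ 1) :* q :^ 0 :* (one :* one) := one :- q) refl q (den x 0)

    -- A Wilf–Zeilberger recurrence in x: boundary is the telescoped certificate, found by factoring the first few cases.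
    recurrence : ∀ m x → let M = suc m in
      N (x * q ^ 4) M * f (q ^ 3 * x)
      ≈ s * N x M * ((1# - q ^ (2 ℕ.* M) * x) * (1# - q ^ (2 ℕ.+ 2 ℕ.* M) * x)) + boundary x m
    recurrence zero x = begin
      N (x * q ^ 4) 1 * f (q ^ 3 * x) ≈⟨ *-congʳ (N-1 _) ⟩
      (1# - q) * f (q ^ 3 * x)
        ≈⟨ solve 4 (λ q x w s → let one = con (+ 1) ; f′ = λ y → s :- w :* y :+ s :* (y :* y) in
             (one :- q) :* f′ (q :^ 3 :* x) := s :* (one :- q) :* ((one :- q :^ 2 :* x) :* (one :- q :^ 4 :* x))
               :+ x :* q :^ 2 :* (one :* ((one :- q :^ 1) :* f′ (q :^ 1)) :* one)) refl q x w s ⟩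
      s * (1# - q) * ((1# - q ^ 2 * x) * (1# - q ^ 4 * x)) + boundary x 0 ≈⟨ +-congʳ (*-congʳ (*-congˡ (N-1 x))) ⟨
      s * N x 1 * ((1# - q ^ 2 * x) * (1# - q ^ 4 * x)) + boundary x 0 ∎
    recurrence (suc m) x = begin
      (A * (a * (1# - q ^ (2 ℕ.* M) * (x * q ^ 4))) + n′) * F
        ≈⟨ solve 4 (λ A d n F → (A :* d :+ n) :* F := (A :* F) :* d :+ n :* F) refl A (den (x * q ^ 4) M) n′ F ⟩
      (A * F) * den (x * q ^ 4) M + n′ * F
        ≈⟨ +-congʳ (*-congʳ (recurrence m x)) ⟩
      (s * B * (e₁ * e₂) + b) * den (x * q ^ 4) M + n′ * F
        ≈⟨ trans (+-congʳ (distribʳ _ _ _)) (trans (+-assoc _ _ _) (+-cong (*-congˡ (*-congˡ e₃-shift)) (key m x))) ⟩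
      s * B * (e₁ * e₂) * (a * e₃) + (s * n * (e₂ * e₃) + boundary x M)
        -- The denominators at `x` and at `x * q ^ 4` are `a * e₁` and `a * e₃`. So `e₁` is absorbed
        -- into the next `N x` and the pair `e₁ e₂` becomes `e₂ e₃`.
        ≈⟨ solve 8 (λ s B e₁ e₂ a e₃ n b → s :* B :* (e₁ :* e₂) :* (a :* e₃) :+ (s :* n :* (e₂ :* e₃) :+ b)
             := s :* (B :* (a :* e₁) :+ n) :* (e₂ :* e₃) :+ b) refl s B e₁ e₂ a e₃ n (boundary x M) ⟩
      s * (B * (a * e₁) + n) * (e₂ * e₃) + boundary x M
        ≈⟨ +-congʳ (*-congˡ (*-congʳ (minus-cong (*-congʳ (reflexive (≡.cong (q ^_) (double-suc M))))))) ⟩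
      s * (B * (a * e₁) + n) * ((1# - q ^ (2 ℕ.* suc M) * x) * e₃) + boundary x M ∎
      where
      M = suc m
      A = N (x * q ^ 4) M
      B = N x M
      F = f (q ^ 3 * x)
      a = g (q ^ (4 ℕ.* M))
      b = boundary x m
      n = num x M
      n′ = num (x * q ^ 4) M
      e₁ = 1# - q ^ (2 ℕ.* M) * x
      e₂ = 1# - q ^ (2 ℕ.+ 2 ℕ.* M) * x
      e₃ = 1# - q ^ (2 ℕ.+ 2 ℕ.* suc M) * x
      double-suc : ∀ k → 2 ℕ.+ 2 ℕ.* k ≡ 2 ℕ.* suc k
      double-suc k = ≡.sym (ℕ.*-suc 2 k)
      e₃-shift : 1# - q ^ (2 ℕ.* M) * (x * q ^ 4) ≈ e₃
      e₃-shift = minus-cong (begin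
        q ^ (2 ℕ.* M) * (x * q ^ 4) ≈⟨ solve 3 (λ a b c → a :* (b :* c) := c :* a :* b) refl _ x (q ^ 4) ⟩
        q ^ 4 * q ^ (2 ℕ.* M) * x ≈⟨ *-congʳ (^-homo-* q 4 (2 ℕ.* M)) ⟨
        q ^ (4 ℕ.+ 2 ℕ.* M) * x ≡⟨ ≡.cong (λ k → q ^ (2 ℕ.+ k) * x) (double-suc M) ⟩
        q ^ (2 ℕ.+ 2 ℕ.* suc M) * x ∎)

    N-cong : ∀ k {x y} → x ≈ y → N x k ≈ N y k
    N-cong zero    e = refl
    N-cong (suc k) e = +-cong (*-cong (N-cong k e) (*-congˡ (minus-cong (*-congˡ e))))
      (*-congˡ (*-congˡ (∏-cong k λ i _ → +-congʳ e)))

    -- Iterates `recurrence` where it is homogeneous. The boundary will vanish for three different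
    -- reasons: a factor `1 - q ^ n` that is zero in the quotient, a zero of `f` among the `gs`, or
    -- a node equal to zero.
    chain : ∀ m x t → let M = suc m in (∀ i → i < t → boundary (x * q ^ (4 ℕ.* i)) m ≈ 0#) →
      N (x * q ^ (4 ℕ.* t)) M * ∏ t (λ i → f (q ^ (3 ℕ.+ 4 ℕ.* i) * x))
      ≈ s ^ t * N x M * ∏ t (λ i → (1# - q ^ (2 ℕ.* M ℕ.+ 4 ℕ.* i) * x) * (1# - q ^ (2 ℕ.+ 2 ℕ.* M ℕ.+ 4 ℕ.* i) * x))
    chain m x zero    _ = trans (*-identityʳ _) (trans (N-cong (suc m) (*-identityʳ x)) (trans (sym (*-identityˡ _)) (sym (*-identityʳ _))))
    chain m x (suc t) b = begin
      N (x * q ^ (4 ℕ.* suc t)) M * (P * f (q ^ (3 ℕ.+ 4 ℕ.* t) * x))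
        ≈⟨ *-cong (N-cong M X-step) (*-congˡ (f-cong (shift 3))) ⟩
      N (X * q ^ 4) M * (P * f (q ^ 3 * X))
        ≈⟨ solve 3 (λ a b c → a :* (b :* c) := (a :* c) :* b) refl _ _ _ ⟩
      (N (X * q ^ 4) M * f (q ^ 3 * X)) * P
        ≈⟨ *-congʳ (trans (recurrence m X) (trans (+-congˡ (b t ℕ.≤-refl)) (+-identityʳ _))) ⟩
      s * N X M * e * P
        ≈⟨ solve 4 (λ s n e p → s :* n :* e :* p := s :* (n :* p) :* e) refl s _ e P ⟩
      s * (N X M * P) * e
        ≈⟨ *-cong (*-congˡ (chain m x t λ i i<t → b i (ℕ.m<n⇒m<1+n i<t)))
             (*-cong (minus-cong (sym (shift (2 ℕ.* M)))) (minus-cong (sym (shift (2 ℕ.+ 2 ℕ.* M))))) ⟩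
      s * (s ^ t * N x M * Q) * e′
        ≈⟨ solve 5 (λ s t n q e → s :* (t :* n :* q) :* e := s :* t :* n :* (q :* e)) refl s _ _ Q e′ ⟩
      s ^ suc t * N x M * (Q * e′) ∎
      where
      M = suc m
      X = x * q ^ (4 ℕ.* t)
      P = ∏ t (λ i → f (q ^ (3 ℕ.+ 4 ℕ.* i) * x))
      Q = ∏ t (λ i → (1# - q ^ (2 ℕ.* M ℕ.+ 4 ℕ.* i) * x) * (1# - q ^ (2 ℕ.+ 2 ℕ.* M ℕ.+ 4 ℕ.* i) * x))
      e = (1# - q ^ (2 ℕ.* M) * X) * (1# - q ^ (2 ℕ.+ 2 ℕ.* M) * X)
      e′ = (1# - q ^ (2 ℕ.* M ℕ.+ 4 ℕ.* t) * x) * (1# - q ^ (2 ℕ.+ 2 ℕ.* M ℕ.+ 4 ℕ.* t) * x)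
      shift : ∀ a → q ^ (a ℕ.+ 4 ℕ.* t) * x ≈ q ^ a * X
      shift a = trans (*-congʳ (^-homo-* q a (4 ℕ.* t))) (solve 3 (λ a b c → (a :* b) :* c := a :* (c :* b)) refl _ _ _)
      X-step : x * q ^ (4 ℕ.* suc t) ≈ X * q ^ 4
      X-step = begin
        x * q ^ (4 ℕ.* suc t) ≡⟨ ≡.cong (λ k → x * q ^ k) (≡.trans (ℕ.*-suc 4 t) (ℕ.+-comm 4 (4 ℕ.* t))) ⟩
        x * q ^ (4 ℕ.* t ℕ.+ 4) ≈⟨ *-congˡ (^-homo-* q (4 ℕ.* t) 4) ⟩
        x * (q ^ (4 ℕ.* t) * q ^ 4) ≈⟨ *-assoc _ _ _ ⟨
        X * q ^ 4 ∎

    module _ {x} (w≈2s : w ≈ s + s) (x≈1 : x ≈ 1#) where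

      f-square : ∀ y → f y ≈ s * (1# - y) ^ 2
      f-square y = trans (+-congʳ (minus-cong (*-congʳ w≈2s)))
        (solve 2 (λ s y → s :- (s :+ s) :* y :+ s :* (y :* y) := s :* (con (+ 1) :- y) :^ 2) refl s y)

      num-at-1 : ∀ k → num x k ≈ s ^ k * ((1# - q ^ (1 ℕ.+ 6 ℕ.* k)) * q ^ (k ℕ.* k ℕ.+ k) * ∏ k (upper q))
      num-at-1 k = trans (*-congˡ (lem k)) (solve 3 (λ a b c → a :* (b :* c) := b :* (a :* c)) refl _ _ _)
        where
        lem : ∀ k → ∏ k gs * ∏ k (node x) ≈ s ^ k * ∏ k (upper q)
        lem zero    = refl
        lem (suc k) = begin
          (∏ k gs * gs k) * (∏ k (node x) * node x k) ≈⟨ *-interchange _ _ _ _ ⟩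
          (∏ k gs * ∏ k (node x)) * (gs k * node x k) ≈⟨ *-cong (lem k) (*-cong (*-congˡ (f-square _)) (+-congʳ x≈1)) ⟩
          (s ^ k * ∏ k (upper q)) * ((1# - y) * (s * (1# - y) ^ 2) * (1# - z))
            ≈⟨ solve 5 (λ a b y s z → let one = con (+ 1) in a :* b :* ((one :- y) :* (s :* (one :- y) :^ 2) :* (one :- z))
                 := s :* a :* (b :* ((one :- y) :^ 3 :* (one :- z)))) refl (s ^ k) (∏ k (upper q)) y s z ⟩
          s ^ suc k * ∏ (suc k) (upper q) ∎
          where
          y = q ^ (1 ℕ.+ 2 ℕ.* k)
          z = q ^ (1 ℕ.+ 4 ℕ.* k)

      den-at-1 : ∀ k → den x (suc k) ≈ s * lower q k
      den-at-1 k = begin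
        (1# - q ^ (4 ℕ.* suc k)) * f (q ^ (4 ℕ.* suc k)) * (1# - q ^ (2 ℕ.* suc k) * x)
          ≡⟨ ≡.cong₂ (λ i j → (1# - q ^ i) * f (q ^ i) * (1# - q ^ j * x)) (ℕ.*-suc 4 k) (ℕ.*-suc 2 k) ⟩
        (1# - y) * f y * (1# - z * x) ≈⟨ *-cong (*-congˡ (f-square y)) (minus-cong (trans (*-congˡ x≈1) (*-identityʳ z))) ⟩
        (1# - y) * (s * (1# - y) ^ 2) * (1# - z)
          ≈⟨ solve 3 (λ y s z → let one = con (+ 1) in (one :- y) :* (s :* (one :- y) :^ 2) :* (one :- z)
               := s :* ((one :- z) :* (one :- y) :^ 3)) refl y s z ⟩
        s * lower q k ∎
        where
        y = q ^ (4 ℕ.+ 4 ℕ.* k)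
        z = q ^ (2 ℕ.+ 2 ℕ.* k)

      ∏-den-at-1 : ∀ k → ∏ k (λ i → den x (suc i)) ≈ s ^ k * ∏ k (lower q)
      ∏-den-at-1 zero    = sym (*-identityˡ _)
      ∏-den-at-1 (suc k) = trans (*-cong (∏-den-at-1 k) (den-at-1 k)) (solve 4 (λ a b s c → a :* b :* (s :* c) := s :* a :* (b :* c)) refl _ _ s _)

      -- The bridge from `N` to a sum of fractions `τ k / Ω`. Being free of division it also holds
      -- in quotient rings, where the first coefficient of a block can take the place of `Ω`.
      clear-denominators : ∀ m Ω τ →
        (∀ k → k < suc m → Ω * ((1# - q ^ (1 ℕ.+ 6 ℕ.* k)) * q ^ (k ℕ.* k ℕ.+ k) * ∏ k (upper q)) ≈ τ k * ∏ k (lower q)) →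
        Ω * N x (suc m) ≈ ∑ (suc m) τ * ∏ m (λ i → den x (suc i))
      clear-denominators m Ω τ h = go m ℕ.≤-refl
        where
        top : ∀ k → k < suc m → Ω * num x k ≈ τ k * ∏ k (λ i → den x (suc i))
        top k k≤m = begin
          Ω * num x k ≈⟨ *-congˡ (num-at-1 k) ⟩
          Ω * (s ^ k * _) ≈⟨ solve 3 (λ a b c → a :* (b :* c) := b :* (a :* c)) refl _ _ _ ⟩
          s ^ k * (Ω * _) ≈⟨ *-congˡ (h k k≤m) ⟩
          s ^ k * (τ k * ∏ k (lower q)) ≈⟨ solve 3 (λ a b c → b :* (a :* c) := a :* (b :* c)) refl _ _ _ ⟩
          τ k * (s ^ k * ∏ k (lower q)) ≈⟨ *-congˡ (∏-den-at-1 k) ⟨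
          τ k * ∏ k (λ i → den x (suc i)) ∎
        go : ∀ k → k < suc m → Ω * N x (suc k) ≈ ∑ (suc k) τ * ∏ k (λ i → den x (suc i))
        go zero p = begin
          Ω * (0# * den x 0 + num x 0) ≈⟨ *-congˡ (trans (+-congʳ (zeroˡ _)) (+-identityˡ _)) ⟩
          Ω * num x 0 ≈⟨ top 0 p ⟩
          τ 0 * 1# ≈⟨ *-congʳ (+-identityˡ _) ⟨
          (0# + τ 0) * 1# ∎
        go (suc k) p = begin
          Ω * (N x (suc k) * den x (suc k) + num x (suc k))
            ≈⟨ solve 4 (λ o n d m → o :* (n :* d :+ m) := (o :* n) :* d :+ o :* m) refl _ _ _ _ ⟩
          (Ω * N x (suc k)) * den x (suc k) + Ω * num x (suc k)
            ≈⟨ +-cong (*-congʳ (go k (ℕ.<-trans ℕ.≤-refl p))) (top (suc k) p) ⟩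
          ∑ (suc k) τ * P * den x (suc k) + τ (suc k) * (P * den x (suc k))
            ≈⟨ solve 4 (λ a p d t → a :* p :* d :+ t :* (p :* d) := (a :+ t) :* (p :* d)) refl _ _ _ _ ⟩
          ∑ (suc (suc k)) τ * ∏ (suc k) (λ i → den x (suc i)) ∎
          where P = ∏ k (λ i → den x (suc i))

    private
      periodic : ∀ {n} → q ^ n ≈ 1# → ∀ {k} → n ∣ k → q ^ k ≈ 1#
      periodic {n} e {k} (divides c ≡.refl) = begin
        q ^ (c ℕ.* n) ≡⟨ ≡.cong (q ^_) (ℕ.*-comm c n) ⟩
        q ^ (n ℕ.* c) ≈⟨ ^-assocʳ q n c ⟨
        (q ^ n) ^ c ≈⟨ ^-congˡ c e ⟩
        1# ^ c ≈⟨ one-^ c ⟩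
        1# ∎
        where
        one-^ : ∀ c → 1# ^ c ≈ 1#
        one-^ zero    = refl
        one-^ (suc c) = trans (*-identityˡ _) (one-^ c)

    -- Shifting x by q⁴ through a full period q ^ n = 1 returns to x.  The two products picked up on the way
    -- differ: one has the factor (1 - x)², the other is - η x times a regular element.
    vanishing : ∀ r {x η i₀} → let n = suc (2 ℕ.* r) in
      q ^ n ≈ 1# → w ≈ s + s + η → (1# - x) * (1# - x) ≈ 0# → Regular x →
      (∀ j → ¬ (n ∣ j) → Regular (f (q ^ j * x))) → i₀ < n → n ∣ 3 ℕ.+ 4 ℕ.* i₀ →
      N x n * η ≈ 0#
    vanishing r {x} {η} {i₀} qⁿ≈1 w≈ x² x-reg f-reg i₀<n n∣i₀ = x-reg _ (c-reg n∤ _ (begin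
      c * (x * (N x n * η)) ≈⟨ solve 4 (λ c x n e → c :* (x :* (n :* e)) := :- (n :* (:- (e :* x) :* c))) refl c x (N x n) η ⟩
      - (N x n * (- (η * x) * c)) ≈⟨ -‿cong (*-congˡ (*-congʳ fi₀)) ⟨
      - (N x n * (F i₀ * c)) ≈⟨ -‿cong (*-cong (N-cong n full) P≈) ⟨
      - (N (x * q ^ (4 ℕ.* n)) n * ∏ n F) ≈⟨ -‿cong (chain (2 ℕ.* r) x n λ i _ → boundary≈0 _) ⟩
      - (s ^ n * N x n * ∏ n (λ i → A i * B i)) ≈⟨ -‿cong (*-congˡ (trans (∏-* n A B) AB≈0)) ⟩
      - (s ^ n * N x n * 0#) ≈⟨ trans (-‿cong (zeroʳ _)) -0#≈0# ⟩
      0# ∎))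
      where
      n = suc (2 ℕ.* r)
      F = λ i → f (q ^ (3 ℕ.+ 4 ℕ.* i) * x)
      A = λ i → 1# - q ^ (2 ℕ.* n ℕ.+ 4 ℕ.* i) * x
      B = λ i → 1# - q ^ (2 ℕ.+ 2 ℕ.* n ℕ.+ 4 ℕ.* i) * x
      r<n : r < n
      r<n = s≤s (ℕ.m≤n*m r 2)
      extracted = ∏-extract F i₀<n
      c = proj₁ extracted
      P≈ = proj₁ (proj₂ extracted)
      c-reg = proj₂ (proj₂ extracted)
      full : x * q ^ (4 ℕ.* n) ≈ x
      full = trans (*-congˡ (periodic {n} qⁿ≈1 {4 ℕ.* n} (divides 4 ≡.refl))) (*-identityʳ x)
      q-absorb : ∀ {j} → n ∣ j → q ^ j * x ≈ x
      q-absorb d = trans (*-congʳ (periodic {n} qⁿ≈1 d)) (*-identityˡ x)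
      n∤ : ∀ j → j < n → j ≢ i₀ → Regular (F j)
      n∤ j j<n j≢i₀ = f-reg _ λ n∣j → j≢i₀ (∣3+4i-injective r j<n i₀<n n∣j n∣i₀)
      fi₀ : F i₀ ≈ - (η * x)
      fi₀ = begin
        f (q ^ (3 ℕ.+ 4 ℕ.* i₀) * x) ≈⟨ f-cong (q-absorb n∣i₀) ⟩
        s - w * x + s * (x * x) ≈⟨ +-congʳ (minus-cong (*-congʳ w≈)) ⟩
        s - (s + s + η) * x + s * (x * x)
          ≈⟨ solve 3 (λ s e x → let one = con (+ 1) in s :- (s :+ s :+ e) :* x :+ s :* (x :* x) := s :* ((one :- x) :* (one :- x)) :- e :* x) refl s η x ⟩
        s * ((1# - x) * (1# - x)) - η * x ≈⟨ +-congʳ (trans (*-congˡ x²) (zeroʳ s)) ⟩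
        0# - η * x ≈⟨ +-identityˡ _ ⟩
        - (η * x) ∎
      boundary≈0 : ∀ y → boundary y (2 ℕ.* r) ≈ 0#
      -- The middle factor `gs r` contains `1 - q ^ (1 + 2 r)`, which is `1 - q ^ n`.
      boundary≈0 y = trans (*-congˡ (trans (*-congʳ (∏-zero gs r<n (trans (*-congʳ (begin
        1# - q ^ n ≈⟨ minus-cong qⁿ≈1 ⟩
        1# - 1# ≈⟨ -‿inverseʳ 1# ⟩
        0# ∎)) (zeroˡ _)))) (zeroˡ _))) (zeroʳ _)
      AB≈0 : ∏ n A * ∏ n B ≈ 0#
      -- The exponent of `A 0` is `2 n` and that of `B r` is `2 + 2 n + 4 r = 4 n`, so both factors
      -- reduce to `1 - x`.
      AB≈0 with ∏-extract {n} {0} A (s≤s z≤n) | ∏-extract B r<n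
      ... | a , pa , _ | b , pb , _ = begin
        ∏ n A * ∏ n B ≈⟨ *-cong pa pb ⟩
        (A 0 * a) * (B r * b) ≈⟨ *-interchange _ _ _ _ ⟩
        (A 0 * B r) * (a * b) ≈⟨ *-congʳ (*-cong (minus-cong (q-absorb (divides 2 (ℕ.+-identityʳ _)))) (minus-cong (q-absorb (divides 4 (ar r))))) ⟩
        ((1# - x) * (1# - x)) * (a * b) ≈⟨ *-congʳ x² ⟩
        0# * (a * b) ≈⟨ zeroˡ _ ⟩
        0# ∎
        where
        ar : ∀ r → 2 ℕ.+ 2 ℕ.* suc (2 ℕ.* r) ℕ.+ 4 ℕ.* r ≡ 4 ℕ.* suc (2 ℕ.* r)
        ar = solve-∀

-- Quadratic and cubic ring extensions.

module _ {A : Set} {_≈_ : A → A → Set} {_+_ _*_ : A → A → A} { -_ : A → A} {0# 1# : A} where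

  makeCommutativeRing : IsEquivalence _≈_ →
    (∀ {a b c d} → a ≈ b → c ≈ d → (a + c) ≈ (b + d)) →
    (∀ {a b c d} → a ≈ b → c ≈ d → (a * c) ≈ (b * d)) →
    (∀ {a b} → a ≈ b → (- a) ≈ (- b)) →
    (∀ a b c → ((a + b) + c) ≈ (a + (b + c))) → (∀ a b → (a + b) ≈ (b + a)) →
    (∀ a → (0# + a) ≈ a) → (∀ a → ((- a) + a) ≈ 0#) →
    (∀ a b c → ((a * b) * c) ≈ (a * (b * c))) → (∀ a b → (a * b) ≈ (b * a)) →
    (∀ a → (1# * a) ≈ a) → (∀ a b c → (a * (b + c)) ≈ ((a * b) + (a * c))) →
    CommutativeRing 0ℓ 0ℓ
  makeCommutativeRing eq +-cong *-cong neg-cong +-assoc +-comm +-idˡ -invˡ *-assoc *-comm *-idˡ distribˡ = record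
    { Carrier = A ; _≈_ = _≈_ ; _+_ = _+_ ; _*_ = _*_ ; -_ = -_ ; 0# = 0# ; 1# = 1#
    ; isCommutativeRing = record
      { isRing = record
        { +-isAbelianGroup = record
          { isGroup = record
            { isMonoid = record
              { isSemigroup = record
                { isMagma = record { isEquivalence = eq ; ∙-cong = +-cong }
                ; assoc = +-assoc }
              ; identity = comm∧idˡ⇒id +-comm +-idˡ }
            ; inverse = comm∧invˡ⇒inv +-comm -invˡ
            ; ⁻¹-cong = neg-cong }
          ; comm = +-comm }
        ; *-cong = *-cong
        ; *-assoc = *-assoc
        ; *-identity = comm∧idˡ⇒id *-comm *-idˡ
        ; distrib = comm∧distrˡ⇒distr +-cong *-comm distribˡ }
      ; *-comm = *-comm } }
    where
    setoid : Setoid 0ℓ 0ℓ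
    setoid = record { isEquivalence = eq }
    open Consequences setoid

module Extensions (R : CommutativeRing 0ℓ 0ℓ) where
  open Over R

  infix 4 _≈²_ _≈³_

  record _≈²_ (x y : Carrier × Carrier) : Set where
    constructor _﹐_
    field
      coord₀ : proj₁ x ≈ proj₁ y
      coord₁ : proj₂ x ≈ proj₂ y

  record _≈³_ (x y : Carrier × Carrier × Carrier) : Set where
    constructor _﹐_﹐_
    field
      coord₀ : proj₁ x ≈ proj₁ y
      coord₁ : proj₁ (proj₂ x) ≈ proj₁ (proj₂ y)
      coord₂ : proj₂ (proj₂ x) ≈ proj₂ (proj₂ y)

  ≈²-isEquivalence : IsEquivalence _≈²_
  ≈²-isEquivalence = record
    { refl = refl ﹐ refl ; sym = λ (p ﹐ q) → sym p ﹐ sym q ; trans = λ (p ﹐ q) (p′ ﹐ q′) → trans p p′ ﹐ trans q q′ }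

  ≈³-isEquivalence : IsEquivalence _≈³_
  ≈³-isEquivalence = record
    { refl = refl ﹐ refl ﹐ refl ; sym = λ (p ﹐ q ﹐ r) → sym p ﹐ sym q ﹐ sym r
    ; trans = λ (p ﹐ q ﹐ r) (p′ ﹐ q′ ﹐ r′) → trans p p′ ﹐ trans q q′ ﹐ trans r r′ }

  opaque
    -- Sealed, so that solver and unifier see an abstract ring; the coordinates are unfolded only
    -- where an argument is about them.
    _+²_ : Carrier × Carrier → Carrier × Carrier → Carrier × Carrier
    (a , b) +² (a′ , b′) = a + a′ , b + b′

    mul² : Carrier → Carrier × Carrier → Carrier × Carrier → Carrier × Carrier
    mul² g (a , b) (a′ , b′) = a * a′ , a * b′ + b * a′ + g * (b * b′)

    neg² : Carrier × Carrier → Carrier × Carrier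
    neg² (a , b) = - a , - b

    _+³_ : Carrier × Carrier × Carrier → Carrier × Carrier × Carrier → Carrier × Carrier × Carrier
    (a , b , c) +³ (a′ , b′ , c′) = a + a′ , b + b′ , c + c′

    -- From `η³ = h η²` follows `η⁴ = h² η²`, hence the nested `h`.
    mul³ : Carrier → Carrier × Carrier × Carrier → Carrier × Carrier × Carrier → Carrier × Carrier × Carrier
    mul³ h (a , b , c) (a′ , b′ , c′) = a * a′ , a * b′ + b * a′ , a * c′ + b * b′ + c * a′ + h * (b * c′ + c * b′ + h * (c * c′))

    neg³ : Carrier × Carrier × Carrier → Carrier × Carrier × Carrier
    neg³ (a , b , c) = - a , - b , - c

    +²-cong : ∀ {a b c d} → a ≈² b → c ≈² d → a +² c ≈² b +² d
    +²-cong = λ (p ﹐ q) (p′ ﹐ q′) → +-cong p p′ ﹐ +-cong q q′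

    mul²-cong : ∀ g {a b c d} → a ≈² b → c ≈² d → mul² g a c ≈² mul² g b d
    mul²-cong = λ g (p ﹐ q) (p′ ﹐ q′) → *-cong p p′ ﹐ +-cong (+-cong (*-cong p q′) (*-cong q p′)) (*-congˡ (*-cong q q′))

    neg²-cong : ∀ {a b} → a ≈² b → neg² a ≈² neg² b
    neg²-cong = λ (p ﹐ q) → -‿cong p ﹐ -‿cong q

    +²-assoc : ∀ a b c → (a +² b) +² c ≈² a +² (b +² c)
    +²-assoc = λ _ _ _ → +-assoc _ _ _ ﹐ +-assoc _ _ _

    +²-comm : ∀ a b → a +² b ≈² b +² a
    +²-comm = λ _ _ → +-comm _ _ ﹐ +-comm _ _

    +²-identityˡ : ∀ a → (0# , 0#) +² a ≈² a
    +²-identityˡ = λ _ → +-identityˡ _ ﹐ +-identityˡ _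

    neg²-inverseˡ : ∀ a → neg² a +² a ≈² (0# , 0#)
    neg²-inverseˡ = λ _ → -‿inverseˡ _ ﹐ -‿inverseˡ _

    mul²-assoc : ∀ g a b c → mul² g (mul² g a b) c ≈² mul² g a (mul² g b c)
    mul²-assoc = λ g (a , b) (a′ , b′) (a″ , b″) → *-assoc _ _ _ ﹐
      solve 7 (λ g a b a′ b′ a″ b″ → (a :* a′) :* b″ :+ (a :* b′ :+ b :* a′ :+ g :* (b :* b′)) :* a″ :+ g :* ((a :* b′ :+ b :* a′ :+ g :* (b :* b′)) :* b″)
        := a :* (a′ :* b″ :+ b′ :* a″ :+ g :* (b′ :* b″)) :+ b :* (a′ :* a″) :+ g :* (b :* (a′ :* b″ :+ b′ :* a″ :+ g :* (b′ :* b″)))) refl g a b a′ b′ a″ b″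

    mul²-comm : ∀ g a b → mul² g a b ≈² mul² g b a
    mul²-comm = λ g (a , b) (a′ , b′) → *-comm _ _ ﹐
      solve 5 (λ g a b a′ b′ → a :* b′ :+ b :* a′ :+ g :* (b :* b′) := a′ :* b :+ b′ :* a :+ g :* (b′ :* b)) refl g a b a′ b′

    mul²-identityˡ : ∀ g a → mul² g (1# , 0#) a ≈² a
    mul²-identityˡ = λ g (a , b) → *-identityˡ _ ﹐
      solve 3 (λ g a b → con (+ 1) :* b :+ con (+ 0) :* a :+ g :* (con (+ 0) :* b) := b) refl g a b

    mul²-distribˡ : ∀ g a b c → mul² g a (b +² c) ≈² mul² g a b +² mul² g a c
    mul²-distribˡ = λ g (a , b) (a′ , b′) (a″ , b″) → distribˡ _ _ _ ﹐
      solve 7 (λ g a b a′ b′ a″ b″ → a :* (b′ :+ b″) :+ b :* (a′ :+ a″) :+ g :* (b :* (b′ :+ b″))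
        := (a :* b′ :+ b :* a′ :+ g :* (b :* b′)) :+ (a :* b″ :+ b :* a″ :+ g :* (b :* b″))) refl g a b a′ b′ a″ b″

    +³-cong : ∀ {a b c d} → a ≈³ b → c ≈³ d → a +³ c ≈³ b +³ d
    +³-cong = λ (p ﹐ q ﹐ r) (p′ ﹐ q′ ﹐ r′) → +-cong p p′ ﹐ +-cong q q′ ﹐ +-cong r r′

    mul³-cong : ∀ h {a b c d} → a ≈³ b → c ≈³ d → mul³ h a c ≈³ mul³ h b d
    mul³-cong = λ h (p ﹐ q ﹐ r) (p′ ﹐ q′ ﹐ r′) → *-cong p p′ ﹐ +-cong (*-cong p q′) (*-cong q p′) ﹐
      +-cong (+-cong (+-cong (*-cong p r′) (*-cong q q′)) (*-cong r p′))
             (*-congˡ (+-cong (+-cong (*-cong q r′) (*-cong r q′)) (*-congˡ (*-cong r r′))))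

    neg³-cong : ∀ {a b} → a ≈³ b → neg³ a ≈³ neg³ b
    neg³-cong = λ (p ﹐ q ﹐ r) → -‿cong p ﹐ -‿cong q ﹐ -‿cong r

    +³-assoc : ∀ a b c → (a +³ b) +³ c ≈³ a +³ (b +³ c)
    +³-assoc = λ _ _ _ → +-assoc _ _ _ ﹐ +-assoc _ _ _ ﹐ +-assoc _ _ _

    +³-comm : ∀ a b → a +³ b ≈³ b +³ a
    +³-comm = λ _ _ → +-comm _ _ ﹐ +-comm _ _ ﹐ +-comm _ _

    +³-identityˡ : ∀ a → (0# , 0# , 0#) +³ a ≈³ a
    +³-identityˡ = λ _ → +-identityˡ _ ﹐ +-identityˡ _ ﹐ +-identityˡ _

    neg³-inverseˡ : ∀ a → neg³ a +³ a ≈³ (0# , 0# , 0#)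
    neg³-inverseˡ = λ _ → -‿inverseˡ _ ﹐ -‿inverseˡ _ ﹐ -‿inverseˡ _

    mul³-assoc : ∀ h a b c → mul³ h (mul³ h a b) c ≈³ mul³ h a (mul³ h b c)
    mul³-assoc = λ h (a , b , c) (a′ , b′ , c′) (a″ , b″ , c″) → *-assoc _ _ _ ﹐
      solve 6 (λ a b a′ b′ a″ b″ → (a :* a′) :* b″ :+ (a :* b′ :+ b :* a′) :* a″ := a :* (a′ :* b″ :+ b′ :* a″) :+ b :* (a′ :* a″)) refl a b a′ b′ a″ b″ ﹐
      solve 10 (λ h a b c a′ b′ c′ a″ b″ c″ →
        let m₂ = λ a b a′ b′ → a :* b′ :+ b :* a′
            m₃ = λ a b c a′ b′ c′ → a :* c′ :+ b :* b′ :+ c :* a′ :+ h :* (b :* c′ :+ c :* b′ :+ h :* (c :* c′)) in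
        m₃ (a :* a′) (m₂ a b a′ b′) (m₃ a b c a′ b′ c′) a″ b″ c″ := m₃ a b c (a′ :* a″) (m₂ a′ b′ a″ b″) (m₃ a′ b′ c′ a″ b″ c″)) refl h a b c a′ b′ c′ a″ b″ c″

    mul³-comm : ∀ h a b → mul³ h a b ≈³ mul³ h b a
    mul³-comm = λ h (a , b , c) (a′ , b′ , c′) → *-comm _ _ ﹐
      solve 4 (λ a b a′ b′ → a :* b′ :+ b :* a′ := a′ :* b :+ b′ :* a) refl a b a′ b′ ﹐
      solve 7 (λ h a b c a′ b′ c′ →
        let m₃ = λ a b c a′ b′ c′ → a :* c′ :+ b :* b′ :+ c :* a′ :+ h :* (b :* c′ :+ c :* b′ :+ h :* (c :* c′)) in
        m₃ a b c a′ b′ c′ := m₃ a′ b′ c′ a b c) refl h a b c a′ b′ c′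

    mul³-identityˡ : ∀ h a → mul³ h (1# , 0# , 0#) a ≈³ a
    mul³-identityˡ = λ h (a , b , c) → *-identityˡ _ ﹐
      solve 2 (λ a b → con (+ 1) :* b :+ con (+ 0) :* a := b) refl a b ﹐
      solve 4 (λ h a b c → let o = con (+ 0) in con (+ 1) :* c :+ o :* b :+ o :* a :+ h :* (o :* c :+ o :* b :+ h :* (o :* c)) := c) refl h a b c

    mul³-distribˡ : ∀ h a b c → mul³ h a (b +³ c) ≈³ mul³ h a b +³ mul³ h a c
    mul³-distribˡ = λ h (a , b , c) (a′ , b′ , c′) (a″ , b″ , c″) → distribˡ _ _ _ ﹐
      solve 6 (λ a b a′ b′ a″ b″ → a :* (b′ :+ b″) :+ b :* (a′ :+ a″) := (a :* b′ :+ b :* a′) :+ (a :* b″ :+ b :* a″)) refl a b a′ b′ a″ b″ ﹐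
      solve 10 (λ h a b c a′ b′ c′ a″ b″ c″ →
        let m₃ = λ a b c a′ b′ c′ → a :* c′ :+ b :* b′ :+ c :* a′ :+ h :* (b :* c′ :+ c :* b′ :+ h :* (c :* c′)) in
        m₃ a b c (a′ :+ a″) (b′ :+ b″) (c′ :+ c″) := m₃ a b c a′ b′ c′ :+ m₃ a b c a″ b″ c″) refl h a b c a′ b′ c′ a″ b″ c″

  -- R[δ] / (δ² - g δ), with (a , b) standing for a + b δ.
  Quadratic : Carrier → CommutativeRing 0ℓ 0ℓ
  Quadratic g = makeCommutativeRing {_≈_ = _≈²_} {_+²_} {mul² g} {neg²} {0# , 0#} {1# , 0#} ≈²-isEquivalence
    +²-cong (mul²-cong g) neg²-cong +²-assoc +²-comm +²-identityˡ neg²-inverseˡ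
    (mul²-assoc g) (mul²-comm g) (mul²-identityˡ g) (mul²-distribˡ g)

  -- R[η] / (η³ - h η²), with (a , b , c) standing for a + b η + c η².
  Cubic : Carrier → CommutativeRing 0ℓ 0ℓ
  Cubic h = makeCommutativeRing {_≈_ = _≈³_} {_+³_} {mul³ h} {neg³} {0# , 0# , 0#} {1# , 0# , 0#} ≈³-isEquivalence
    +³-cong (mul³-cong h) neg³-cong +³-assoc +³-comm +³-identityˡ neg³-inverseˡ
    (mul³-assoc h) (mul³-comm h) (mul³-identityˡ h) (mul³-distribˡ h)

-- Ring homomorphisms and evaluation of the deformed sums.

module Homomorphic {R R′ : CommutativeRing 0ℓ 0ℓ} {φ : CommutativeRing.Carrier R → CommutativeRing.Carrier R′}
  (isHom : IsRingHomomorphism (CommutativeRing.rawRing R) (CommutativeRing.rawRing R′) φ) where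
  private
    module R = Over R
    module S = Over R′
  open IsRingHomomorphism isHom

  minus-homo : ∀ a b → φ (a R.- b) S.≈ φ a S.- φ b
  minus-homo a b = S.trans (+-homo a (R.- b)) (S.+-congˡ (-‿homo b))

  ^-homo : ∀ a n → φ (a R.^ n) S.≈ φ a S.^ n
  ^-homo a zero    = 1#-homo
  ^-homo a (suc n) = S.trans (*-homo a _) (S.*-congˡ (^-homo a n))

  ∏-homo : ∀ n {F G} → (∀ i → φ (F i) S.≈ G i) → φ (R.∏ n F) S.≈ S.∏ n G
  ∏-homo zero    e = 1#-homo
  ∏-homo (suc n) e = S.trans (*-homo _ _) (S.*-cong (∏-homo n e) (e n))

  module _ {q s w x q′ s′ w′ x′} (φq : φ q S.≈ q′) (φs : φ s S.≈ s′) (φw : φ w S.≈ w′) (φx : φ x S.≈ x′) where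
    private
      module A = R.Series q s w
      module B = S.Series q′ s′ w′

      _⟨-⟩_ : ∀ {a b a′ b′} → φ a S.≈ a′ → φ b S.≈ b′ → φ (a R.- b) S.≈ a′ S.- b′
      e ⟨-⟩ e′ = S.trans (minus-homo _ _) (S.+-cong e (S.-‿cong e′))

      _⟨+⟩_ : ∀ {a b a′ b′} → φ a S.≈ a′ → φ b S.≈ b′ → φ (a R.+ b) S.≈ a′ S.+ b′
      e ⟨+⟩ e′ = S.trans (+-homo _ _) (S.+-cong e e′)

      _⟨*⟩_ : ∀ {a b a′ b′} → φ a S.≈ a′ → φ b S.≈ b′ → φ (a R.* b) S.≈ a′ S.* b′
      e ⟨*⟩ e′ = S.trans (*-homo _ _) (S.*-cong e e′)

      pow : ∀ k → φ (q R.^ k) S.≈ q′ S.^ k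
      pow k = S.trans (^-homo q k) (S.^-congˡ k φq)

      g-homo : ∀ {y z} → φ y S.≈ z → φ (A.g y) S.≈ B.g z
      g-homo e = (1#-homo ⟨-⟩ e) ⟨*⟩ ((φs ⟨-⟩ (φw ⟨*⟩ e)) ⟨+⟩ (φs ⟨*⟩ (e ⟨*⟩ e)))

    -- `N` is a polynomial expression in `q`, `s`, `w` and `x`. This serves both to specialise `η`
    -- and `δ` and to reduce modulo `P`.
    N-homo : ∀ k → φ (A.N x k) S.≈ B.N x′ k
    N-homo zero    = 0#-homo
    N-homo (suc k) =
      (N-homo k ⟨*⟩ (g-homo (pow (4 ℕ.* k)) ⟨*⟩ (1#-homo ⟨-⟩ (pow (2 ℕ.* k) ⟨*⟩ φx)))) ⟨+⟩
      (((1#-homo ⟨-⟩ pow (1 ℕ.+ 6 ℕ.* k)) ⟨*⟩ pow (k ℕ.* k ℕ.+ k)) ⟨*⟩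
        (∏-homo k (λ i → g-homo (pow (1 ℕ.+ 2 ℕ.* i))) ⟨*⟩ ∏-homo k (λ i → φx ⟨-⟩ pow (1 ℕ.+ 4 ℕ.* i))))

module Evaluation (R : CommutativeRing 0ℓ 0ℓ) where
  open Over R
  open Extensions R public
  open import Relation.Binary.Reasoning.Setoid setoid

  mkHom : (T : CommutativeRing 0ℓ 0ℓ) →
    let open CommutativeRing T using () renaming (Carrier to A; _≈_ to _∼_; _+_ to _⊞_; _*_ to _⊠_; -_ to ⊟_; 0# to 𝟎; 1# to 𝟏) in
    (φ : A → Carrier) → (∀ {a b} → a ∼ b → φ a ≈ φ b) → (∀ a b → φ (a ⊞ b) ≈ φ a + φ b) → (∀ a b → φ (a ⊠ b) ≈ φ a * φ b) →
    (∀ a → φ (⊟ a) ≈ - φ a) → φ 𝟎 ≈ 0# → φ 𝟏 ≈ 1# →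
    IsRingHomomorphism (CommutativeRing.rawRing T) rawRing φ
  mkHom T φ c p m n z o = record
    { isSemiringHomomorphism = record
      { isNearSemiringHomomorphism = record
        { +-isMonoidHomomorphism = record
          { isMagmaHomomorphism = record { isRelHomomorphism = record { cong = c } ; homo = p }
          ; ε-homo = z }
        ; *-homo = m }
      ; 1#-homo = o }
    ; -‿homo = n }

  eval² : Carrier → Carrier × Carrier → Carrier
  eval² t (a , b) = a + b * t

  eval³ : Carrier → Carrier × Carrier × Carrier → Carrier
  eval³ t (a , b , c) = a + b * t + c * (t * t)

  module _ (h t : Carrier) (t²≈ht : t * t ≈ h * t) where
   opaque
    unfolding _+²_

    eval²-hom : IsRingHomomorphism (CommutativeRing.rawRing (Quadratic h)) rawRing (eval² t)
    eval²-hom = mkHom (Quadratic h) (eval² t) (λ (p ﹐ r) → +-cong p (*-congʳ r))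
      (λ (a , b) (c , d) → solve 5 (λ a b c d t → (a :+ c) :+ (b :+ d) :* t := (a :+ b :* t) :+ (c :+ d :* t)) refl a b c d t)
      (λ (a , b) (c , d) → begin
        a * c + (a * d + b * c + h * (b * d)) * t
          ≈⟨ solve 6 (λ a b c d h t → a :* c :+ (a :* d :+ b :* c :+ h :* (b :* d)) :* t := a :* c :+ (a :* d :+ b :* c) :* t :+ (b :* d) :* (h :* t)) refl a b c d h t ⟩
        a * c + (a * d + b * c) * t + (b * d) * (h * t) ≈⟨ +-congˡ (*-congˡ t²≈ht) ⟨
        a * c + (a * d + b * c) * t + (b * d) * (t * t)
          ≈⟨ solve 5 (λ a b c d t → a :* c :+ (a :* d :+ b :* c) :* t :+ (b :* d) :* (t :* t) := (a :+ b :* t) :* (c :+ d :* t)) refl a b c d t ⟩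
        (a + b * t) * (c + d * t) ∎)
      (λ (a , b) → solve 3 (λ a b t → :- a :+ (:- b) :* t := :- (a :+ b :* t)) refl a b t)
      (solve 1 (λ t → con (+ 0) :+ con (+ 0) :* t := con (+ 0)) refl t)
      (solve 1 (λ t → con (+ 1) :+ con (+ 0) :* t := con (+ 1)) refl t)

    -- Well defined since `t² = h t` implies `t³ = h t²`; the values `0` and `h` needed for `t`
    -- satisfy the stronger relation.
    eval³-hom : IsRingHomomorphism (CommutativeRing.rawRing (Cubic h)) rawRing (eval³ t)
    eval³-hom = mkHom (Cubic h) (eval³ t) (λ (p ﹐ r ﹐ u) → +-cong (+-cong p (*-congʳ r)) (*-congʳ u))
      (λ (a , b , e) (c , d , f) → solve 7 (λ a b e c d f t →
         (a :+ c) :+ (b :+ d) :* t :+ (e :+ f) :* (t :* t) := (a :+ b :* t :+ e :* (t :* t)) :+ (c :+ d :* t :+ f :* (t :* t))) refl a b e c d f t)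
      (λ (a , b , e) (c , d , f) → begin
        a * c + (a * d + b * c) * t + (a * f + b * d + e * c + h * (b * f + e * d + h * (e * f))) * (t * t)
          ≈⟨ solve 8 (λ a b e c d f h t →
               a :* c :+ (a :* d :+ b :* c) :* t :+ (a :* f :+ b :* d :+ e :* c :+ h :* (b :* f :+ e :* d :+ h :* (e :* f))) :* (t :* t)
               := a :* c :+ (a :* d :+ b :* c) :* t :+ (a :* f :+ b :* d :+ e :* c) :* (t :* t) :+ (b :* f :+ e :* d :+ h :* (e :* f)) :* t :* (h :* t))
               refl a b e c d f h t ⟩
        a * c + (a * d + b * c) * t + (a * f + b * d + e * c) * (t * t) + (b * f + e * d + h * (e * f)) * t * (h * t)
          ≈⟨ +-congˡ (*-congˡ t²≈ht) ⟨
        a * c + (a * d + b * c) * t + (a * f + b * d + e * c) * (t * t) + (b * f + e * d + h * (e * f)) * t * (t * t)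
          ≈⟨ solve 8 (λ a b e c d f h t →
               a :* c :+ (a :* d :+ b :* c) :* t :+ (a :* f :+ b :* d :+ e :* c) :* (t :* t) :+ (b :* f :+ e :* d :+ h :* (e :* f)) :* t :* (t :* t)
               := a :* c :+ (a :* d :+ b :* c) :* t :+ (a :* f :+ b :* d :+ e :* c) :* (t :* t) :+ (b :* f :+ e :* d) :* t :* (t :* t) :+ (e :* f :* (t :* t)) :* (h :* t))
               refl a b e c d f h t ⟩
        a * c + (a * d + b * c) * t + (a * f + b * d + e * c) * (t * t) + (b * f + e * d) * t * (t * t) + (e * f * (t * t)) * (h * t)
          ≈⟨ +-congˡ (*-congˡ t²≈ht) ⟨
        a * c + (a * d + b * c) * t + (a * f + b * d + e * c) * (t * t) + (b * f + e * d) * t * (t * t) + (e * f * (t * t)) * (t * t)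
          ≈⟨ solve 7 (λ a b e c d f t →
               a :* c :+ (a :* d :+ b :* c) :* t :+ (a :* f :+ b :* d :+ e :* c) :* (t :* t) :+ (b :* f :+ e :* d) :* t :* (t :* t) :+ (e :* f :* (t :* t)) :* (t :* t)
               := (a :+ b :* t :+ e :* (t :* t)) :* (c :+ d :* t :+ f :* (t :* t))) refl a b e c d f t ⟩
        (a + b * t + e * (t * t)) * (c + d * t + f * (t * t)) ∎)
      (λ (a , b , c) → solve 4 (λ a b c t → :- a :+ (:- b) :* t :+ (:- c) :* (t :* t) := :- (a :+ b :* t :+ c :* (t :* t))) refl a b c t)
      (solve 1 (λ t → con (+ 0) :+ con (+ 0) :* t :+ con (+ 0) :* (t :* t) := con (+ 0)) refl t)
      (solve 1 (λ t → con (+ 1) :+ con (+ 0) :* t :+ con (+ 0) :* (t :* t) := con (+ 1)) refl t)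

  module _ {h : Carrier} where
    private
      module Q = Over (Quadratic h)
      module C = Over (Cubic h)

    opaque
      unfolding _+²_

      ^-constant² : ∀ a n → ((a , 0#) Q.^ n) Q.≈ (a ^ n , 0#)
      ^-constant² a zero    = refl ﹐ refl
      ^-constant² a (suc n) = Q.trans (Q.*-congˡ (^-constant² a n))
        (refl ﹐ solve 3 (λ h a b → a :* con (+ 0) :+ con (+ 0) :* b :+ h :* (con (+ 0) :* con (+ 0)) := con (+ 0)) refl h a (a ^ n))

      ^-constant³ : ∀ a n → ((a , 0# , 0#) C.^ n) C.≈ (a ^ n , 0# , 0#)
      ^-constant³ a zero    = refl ﹐ refl ﹐ refl
      ^-constant³ a (suc n) = C.trans (C.*-congˡ (^-constant³ a n))
        (refl ﹐ solve 2 (λ a b → a :* con (+ 0) :+ con (+ 0) :* b := con (+ 0)) refl a (a ^ n)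
              ﹐ solve 3 (λ h a b → let o = con (+ 0) in a :* o :+ o :* o :+ o :* b :+ h :* (o :* o :+ o :* o :+ h :* (o :* o)) := o) refl h a (a ^ n))

      -- With `h ≈ 0#` the generator is nilpotent, so a regular constant coordinate suffices: the
      -- coordinates of the cofactor are killed one after the other, lowest first.
      regular² : h ≈ 0# → ∀ {a b} → Regular a → Q.Regular (a , b)
      regular² h≈0 {a} {b} a-reg (c , d) (e₁ ﹐ e₂) = c≈0 ﹐ a-reg d (begin
        a * d ≈⟨ solve 5 (λ a b c d h → a :* d := (a :* d :+ b :* c :+ h :* (b :* d)) :- b :* c :- h :* (b :* d)) refl a b c d h ⟩
        (a * d + b * c + h * (b * d)) - b * c - h * (b * d) ≈⟨ +-cong (+-cong e₂ (-‿cong (*-congˡ c≈0))) (-‿cong (*-congʳ h≈0)) ⟩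
        0# - b * 0# - 0# * (b * d) ≈⟨ solve 2 (λ b d → let o = con (+ 0) in o :- b :* o :- o :* (b :* d) := o) refl b d ⟩
        0# ∎)
        where
        c≈0 : c ≈ 0#
        c≈0 = a-reg c e₁

      regular³ : h ≈ 0# → ∀ {a b c} → Regular a → C.Regular (a , b , c)
      regular³ h≈0 {a} {b} {c} a-reg (x , y , z) (e₁ ﹐ e₂ ﹐ e₃) = x≈0 ﹐ y≈0 ﹐ a-reg z (begin
        a * z ≈⟨ solve 7 (λ a b c x y z r → a :* z := (a :* z :+ b :* y :+ c :* x :+ r) :- b :* y :- c :* x :- r) refl a b c x y z r ⟩
        (a * z + b * y + c * x + r) - b * y - c * x - r
          ≈⟨ +-cong (+-cong (+-cong e₃ (-‿cong (*-congˡ y≈0))) (-‿cong (*-congˡ x≈0))) (-‿cong (*-congʳ h≈0)) ⟩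
        0# - b * 0# - c * 0# - 0# * r′ ≈⟨ solve 3 (λ b c r → let o = con (+ 0) in o :- b :* o :- c :* o :- o :* r := o) refl b c r′ ⟩
        0# ∎)
        where
        r′ r : Carrier
        r′ = b * z + c * y + h * (c * z)
        r = h * r′
        x≈0 : x ≈ 0#
        x≈0 = a-reg x e₁
        y≈0 : y ≈ 0#
        y≈0 = a-reg y (begin
          a * y ≈⟨ solve 4 (λ a b x y → a :* y := (a :* y :+ b :* x) :- b :* x) refl a b x y ⟩
          (a * y + b * x) - b * x ≈⟨ +-cong e₂ (-‿cong (*-congˡ x≈0)) ⟩
          0# - b * 0# ≈⟨ solve 1 (λ b → con (+ 0) :- b :* con (+ 0) := con (+ 0)) refl b ⟩
          0# ∎)

-- The first-order deformation w = w₀ + η, x = x₀ + δ of the partial sums, with η³ = h η² and δ² = g δ: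
-- specialising η to 0 or h and δ to 0 or g recovers honest values.
module Deformation (R : CommutativeRing 0ℓ 0ℓ) (q s w₀ x₀ h g : CommutativeRing.Carrier R) where
  open Over R
  open Evaluation R
  R[δ] = Quadratic g
  module R[δ] = Over R[δ]
  module E[δ] = Evaluation R[δ]
  R[δ,η] = E[δ].Cubic (h , 0#)
  module R[δ,η] = Over R[δ,η]
  open import Relation.Binary.Reasoning.Setoid setoid

  constant : Carrier → R[δ,η].Carrier
  constant a = (a , 0#) , (0# , 0#) , (0# , 0#)

  w̃ x̃ η : R[δ,η].Carrier
  w̃ = (w₀ , 0#) , (1# , 0#) , (0# , 0#)
  x̃ = (x₀ , 1#) , (0# , 0#) , (0# , 0#)
  η = (0# , 0#) , (1# , 0#) , (0# , 0#)

  module Ñ = R[δ,η].Series (constant q) (constant s) w̃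

  Ñ : ℕ → R[δ,η].Carrier
  Ñ = Ñ.N x̃

  -- The first index is the exponent of `η`, the second that of `δ`.
  Ñ₀₀ Ñ₀₁ Ñ₁₀ Ñ₁₁ Ñ₂₀ Ñ₂₁ : ℕ → Carrier
  Ñ₀₀ n = proj₁ (proj₁ (Ñ n))
  Ñ₀₁ n = proj₂ (proj₁ (Ñ n))
  Ñ₁₀ n = proj₁ (proj₁ (proj₂ (Ñ n)))
  Ñ₁₁ n = proj₂ (proj₁ (proj₂ (Ñ n)))
  Ñ₂₀ n = proj₁ (proj₂ (proj₂ (Ñ n)))
  Ñ₂₁ n = proj₂ (proj₂ (proj₂ (Ñ n)))

  specialise : ∀ {t u} → t * t ≈ h * t → u * u ≈ g * u → ∀ n →
    Series.N q s (w₀ + t) (x₀ + u) n ≈ (Ñ₀₀ n + Ñ₀₁ n * u) + (Ñ₁₀ n + Ñ₁₁ n * u) * t + (Ñ₂₀ n + Ñ₂₁ n * u) * (t * t)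
  specialise {t} {u} t² u² n = begin
    Series.N q s (w₀ + t) (x₀ + u) n
      ≈⟨ Homomorphic.N-homo (eval²-hom g u u²) (constant² q) (constant² s)
           (trans (+-homo (w₀ , 0#) t̃) (+-cong (constant² w₀) (constant² t)))
           (solve 2 (λ x u → x :+ con (+ 1) :* u := x :+ u) refl x₀ u) n ⟨
    eval² u (R[δ].Series.N (q , 0#) (s , 0#) ((w₀ , 0#) R[δ].+ t̃) (x₀ , 1#) n)
      ≈⟨ IsRingHomomorphism.⟦⟧-cong (eval²-hom g u u²) (Homomorphic.N-homo (E[δ].eval³-hom (h , 0#) t̃ t̃²) (constant³ (q , 0#)) (constant³ (s , 0#))
           linear³ (constant³ (x₀ , 1#)) n) ⟨
    eval² u (E[δ].eval³ t̃ (Ñ n)) ≈⟨ trans (+-homo (proj₁ (Ñ n) R[δ].+ proj₁ (proj₂ (Ñ n)) R[δ].* t̃) _) (+-cong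
      (trans (+-homo (proj₁ (Ñ n)) _) (+-congˡ (trans (*-homo (proj₁ (proj₂ (Ñ n))) t̃) (*-congˡ (constant² t)))))
      (trans (*-homo (proj₂ (proj₂ (Ñ n))) _) (*-congˡ (trans (*-homo t̃ t̃) (*-cong (constant² t) (constant² t)))))) ⟩
    (Ñ₀₀ n + Ñ₀₁ n * u) + (Ñ₁₀ n + Ñ₁₁ n * u) * t + (Ñ₂₀ n + Ñ₂₁ n * u) * (t * t) ∎
    where
    open IsRingHomomorphism (eval²-hom g u u²) using (+-homo; *-homo)
    t̃ : R[δ].Carrier
    t̃ = t , 0#
    constant² : ∀ a → eval² u (a , 0#) ≈ a
    constant² a = solve 2 (λ a u → a :+ con (+ 0) :* u := a) refl a u
    opaque
      unfolding _+²_
      t̃² : t̃ R[δ].* t̃ R[δ].≈ (h , 0#) R[δ].* t̃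
      t̃² = t² ﹐ solve 3 (λ h t g → let o = con (+ 0) in t :* o :+ o :* t :+ g :* (o :* o) := h :* o :+ o :* t :+ g :* (o :* o)) refl h t g
    constant³ : ∀ a → E[δ].eval³ t̃ (a , (0# , 0#) , (0# , 0#)) R[δ].≈ a
    constant³ a = R[δ].solve 2 (λ a t → a R[δ].:+ R[δ].con (+ 0) R[δ].:* t R[δ].:+ R[δ].con (+ 0) R[δ].:* (t R[δ].:* t) R[δ].:= a) R[δ].refl a t̃
    linear³ : E[δ].eval³ t̃ w̃ R[δ].≈ (w₀ , 0#) R[δ].+ t̃
    linear³ = R[δ].solve 2 (λ a t → a R[δ].:+ R[δ].con (+ 1) R[δ].:* t R[δ].:+ R[δ].con (+ 0) R[δ].:* (t R[δ].:* t) R[δ].:= a R[δ].:+ t) R[δ].refl (w₀ , 0#) t̃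

  at-base : ∀ n → Series.N q s w₀ x₀ n ≈ Ñ₀₀ n
  at-base n = begin
    Series.N q s w₀ x₀ n
      ≈⟨ Homomorphic.N-homo {φ = λ a → a} (mkHom R (λ a → a) (λ e → e) (λ _ _ → refl) (λ _ _ → refl) (λ _ → refl) refl refl)
           refl refl (sym (+-identityʳ w₀)) (sym (+-identityʳ x₀)) n ⟩
    Series.N q s (w₀ + 0#) (x₀ + 0#) n ≈⟨ specialise (trans (zeroˡ 0#) (sym (zeroʳ h))) (trans (zeroˡ 0#) (sym (zeroʳ g))) n ⟩
    _ ≈⟨ solve 6 (λ a b c d e f → let o = con (+ 0) in (a :+ b :* o) :+ (c :+ d :* o) :* o :+ (e :+ f :* o) :* (o :* o) := a) refl
           (Ñ₀₀ n) (Ñ₀₁ n) (Ñ₁₀ n) (Ñ₁₁ n) (Ñ₂₀ n) (Ñ₂₁ n) ⟩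
    Ñ₀₀ n ∎

  -- Only monomials containing both `η` and `δ` survive a double difference, and these are divisible
  -- by `h g` after specialisation.
  mixed-difference : ∀ n →
    (Series.N q s (w₀ + h) (x₀ + g) n - Series.N q s (w₀ + h) (x₀ + 0#) n) - (Series.N q s (w₀ + 0#) (x₀ + g) n - Series.N q s (w₀ + 0#) (x₀ + 0#) n)
    ≈ h * g * (Ñ₁₁ n + h * Ñ₂₁ n)
  mixed-difference n = begin
    _ ≈⟨ +-cong (+-cong (specialise refl refl n) (-‿cong (specialise refl 0² n)))
                (-‿cong (+-cong (specialise 0² refl n) (-‿cong (specialise 0² 0² n)))) ⟩
    _ ≈⟨ solve 8 (λ a b c d e f h g → let o = con (+ 0)
                                          at = λ t u → (a :+ b :* u) :+ (c :+ d :* u) :* t :+ (e :+ f :* u) :* (t :* t) in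
             (at h g :- at h o) :- (at o g :- at o o) := h :* g :* (d :+ h :* f)) refl
             (Ñ₀₀ n) (Ñ₀₁ n) (Ñ₁₀ n) (Ñ₁₁ n) (Ñ₂₀ n) (Ñ₂₁ n) h g ⟩
    h * g * (Ñ₁₁ n + h * Ñ₂₁ n) ∎
    where
    0² : ∀ {a} → 0# * 0# ≈ a * 0#
    0² {a} = trans (zeroˡ 0#) (sym (zeroʳ a))

  module _ (r : ℕ) {i₀ : ℕ} (h≈0 : h ≈ 0#) (g≈0 : g ≈ 0#) (qⁿ≈1 : q ^ suc (2 ℕ.* r) ≈ 1#) (w₀≈2s : w₀ ≈ s + s) (x₀≈1 : x₀ ≈ 1#)
    (s-reg : Regular s) (1-q^-reg : ∀ j → ¬ (suc (2 ℕ.* r) ∣ j) → Regular (1# - q ^ j))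
    (i₀<n : i₀ < suc (2 ℕ.* r)) (n∣i₀ : suc (2 ℕ.* r) ∣ 3 ℕ.+ 4 ℕ.* i₀) where

    private
      n : ℕ
      n = suc (2 ℕ.* r)

      head : R[δ,η].Carrier → Carrier
      head a = proj₁ (proj₁ a)

      head-regular : ∀ a → Regular (head a) → R[δ,η].Regular a
      head-regular a reg = E[δ].regular³ (h≈0 ﹐ refl) (regular² g≈0 reg)

      constant-^ : (constant q R[δ,η].^ n) R[δ,η].≈ R[δ,η].1#
      constant-^ = R[δ,η].trans (E[δ].^-constant³ (q , 0#) n) (R[δ].trans (^-constant² q n) (qⁿ≈1 ﹐ refl) E[δ].﹐ R[δ].refl ﹐ R[δ].refl)

      opaque
        unfolding _+²_ E[δ]._+³_

        w̃≈ : w̃ R[δ,η].≈ constant s R[δ,η].+ constant s R[δ,η].+ η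
        w̃≈ = (trans w₀≈2s (sym (+-identityʳ _)) ﹐ z₃) E[δ].﹐ (sym (trans (+-congʳ (+-identityˡ _)) (+-identityˡ _)) ﹐ z₃) ﹐ (z₃ ﹐ z₃)
          where
          z₃ : 0# ≈ 0# + 0# + 0#
          z₃ = sym (trans (+-identityʳ _) (+-identityʳ _))

        1-x̃² : (R[δ,η].1# R[δ,η].- x̃) R[δ,η].* (R[δ,η].1# R[δ,η].- x̃) R[δ,η].≈ R[δ,η].0#
        1-x̃² = R[δ,η].trans (R[δ,η].*-cong 1-x̃≈ε 1-x̃≈ε) ε²≈0
          where
          ε₁ : R[δ].Carrier
          ε₁ = 0# , - 1#
          1-x̃≈ε : (R[δ,η].1# R[δ,η].- x̃) R[δ,η].≈ (ε₁ , (0# , 0#) , (0# , 0#))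
          1-x̃≈ε = (trans (+-congˡ (-‿cong x₀≈1)) (-‿inverseʳ 1#) ﹐ +-identityˡ _) E[δ].﹐ (-‿inverseʳ 0# ﹐ -‿inverseʳ 0#) ﹐ (-‿inverseʳ 0# ﹐ -‿inverseʳ 0#)
          ε²≈0 : (ε₁ , (0# , 0#) , (0# , 0#)) R[δ,η].* (ε₁ , (0# , 0#) , (0# , 0#)) R[δ,η].≈ R[δ,η].0#
          ε²≈0 = (zeroˡ 0# ﹐ trans (+-congˡ (trans (*-congʳ g≈0) (zeroˡ _))) (solve 0 (con (+ 0) :* (:- con (+ 1)) :+ (:- con (+ 1)) :* con (+ 0) :+ con (+ 0) := con (+ 0)) refl))
            E[δ].﹐ R[δ].solve 1 (λ e → e R[δ].:* R[δ].con (+ 0) R[δ].:+ R[δ].con (+ 0) R[δ].:* e R[δ].:= R[δ].con (+ 0)) R[δ].refl ε₁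
            ﹐ R[δ].solve 2 (λ e h → let o = R[δ].con (+ 0) in e R[δ].:* o R[δ].:+ o R[δ].:* o R[δ].:+ o R[δ].:* e R[δ].:+ h R[δ].:* (o R[δ].:* o R[δ].:+ o R[δ].:* o R[δ].:+ h R[δ].:* (o R[δ].:* o)) R[δ].:= o) R[δ].refl ε₁ (h , 0#)

        head-^ : ∀ a k → head (a R[δ,η].^ k) ≡ head a ^ k
        head-^ a zero    = ≡.refl
        head-^ a (suc k) = ≡.cong (head a *_) (head-^ a k)

        head-f : ∀ y → head (Ñ.f (y R[δ,η].* x̃)) ≡ s - w₀ * (head y * x₀) + s * ((head y * x₀) * (head y * x₀))
        head-f y = ≡.refl

        -- Multiplication by `η` moves the first two coordinates up by one, with a correction by `h`
        -- at the top that vanishes here. Since `η²` is independent of `1` and `η`, both can be read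
        -- off again.
        coordinates-of-*η : ∀ a → a R[δ,η].* η R[δ,η].≈ R[δ,η].0# → proj₁ (proj₁ a) ≈ 0# × proj₂ (proj₁ (proj₂ a)) ≈ 0#
        coordinates-of-*η (a , b , c) (_ E[δ].﹐ e₁ ﹐ e₂) =
          _≈²_.coord₀ (R[δ].trans (R[δ].solve 2 (λ a b → let o = R[δ].con (+ 0) ; i = R[δ].con (+ 1) in a R[δ].:= a R[δ].:* i R[δ].:+ b R[δ].:* o) R[δ].refl a b) e₁) ,
          _≈²_.coord₁ (R[δ].trans (R[δ].solve 4 (λ a b c h → let o = R[δ].con (+ 0) ; i = R[δ].con (+ 1) in
                b R[δ].:= (a R[δ].:* o R[δ].:+ b R[δ].:* i R[δ].:+ c R[δ].:* o R[δ].:+ h R[δ].:* (b R[δ].:* o R[δ].:+ c R[δ].:* i R[δ].:+ h R[δ].:* (c R[δ].:* o)))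
                  R[δ].:- h R[δ].:* c) R[δ].refl a b c h̃)
            (R[δ].trans (R[δ].+-cong e₂ (R[δ].-‿cong (R[δ].*-congʳ {c} (h≈0 ﹐ refl))))
              (R[δ].solve 1 (λ c → let o = R[δ].con (+ 0) in o R[δ].:- o R[δ].:* c R[δ].:= o) R[δ].refl c)))
          where
          h̃ : R[δ].Carrier
          h̃ = h , 0#

      f̃-regular : ∀ j → ¬ (n ∣ j) → R[δ,η].Regular (Ñ.f (constant q R[δ,η].^ j R[δ,η].* x̃))
      f̃-regular j n∤j = head-regular _ (Regular-resp (sym (begin
        head (Ñ.f (constant q R[δ,η].^ j R[δ,η].* x̃)) ≡⟨ head-f _ ⟩
        s - w₀ * (head (constant q R[δ,η].^ j) * x₀) + s * ((head (constant q R[δ,η].^ j) * x₀) * (head (constant q R[δ,η].^ j) * x₀))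
          ≡⟨ ≡.cong (λ y → s - w₀ * (y * x₀) + s * ((y * x₀) * (y * x₀))) (head-^ (constant q) j) ⟩
        s - w₀ * (q ^ j * x₀) + s * ((q ^ j * x₀) * (q ^ j * x₀))
          ≈⟨ +-cong (+-congˡ (-‿cong (*-cong w₀≈2s q^jx₀))) (*-congˡ (*-cong q^jx₀ q^jx₀)) ⟩
        s - (s + s) * q ^ j + s * (q ^ j * q ^ j)
          ≈⟨ solve 2 (λ s y → s :- (s :+ s) :* y :+ s :* (y :* y) := s :* ((con (+ 1) :- y) :* (con (+ 1) :- y))) refl s (q ^ j) ⟩
        s * ((1# - q ^ j) * (1# - q ^ j)) ∎)) (Regular-* s-reg (Regular-* (1-q^-reg j n∤j) (1-q^-reg j n∤j))))
        where
        q^jx₀ : q ^ j * x₀ ≈ q ^ j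
        q^jx₀ = trans (*-congˡ x₀≈1) (*-identityʳ _)

      Ñη≈0 : Ñ n R[δ,η].* η R[δ,η].≈ R[δ,η].0#
      Ñη≈0 = Ñ.vanishing r constant-^ w̃≈ 1-x̃² (head-regular x̃ (Regular-resp (sym x₀≈1) Regular-1)) f̃-regular i₀<n n∣i₀

    Ñ₀₀≈0 : Ñ₀₀ (suc (2 ℕ.* r)) ≈ 0#
    Ñ₀₀≈0 = proj₁ (coordinates-of-*η (Ñ n) Ñη≈0)

    Ñ₁₁≈0 : Ñ₁₁ (suc (2 ℕ.* r)) ≈ 0#
    Ñ₁₁≈0 = proj₂ (coordinates-of-*η (Ñ n) Ñη≈0)

-- The q-Vandermonde sum.

module Vandermonde (R : CommutativeRing 0ℓ 0ℓ) (p : CommutativeRing.Carrier R) where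
  open Over R
  open import Relation.Binary.Reasoning.Setoid setoid

  pochhammer : Carrier → ℕ → Carrier
  pochhammer x k = ∏ k λ j → 1# - x * p ^ j

  pochhammer-cong : ∀ {x y} k → x ≈ y → pochhammer x k ≈ pochhammer y k
  pochhammer-cong k e = ∏-cong k λ j _ → +-congˡ (-‿cong (*-congʳ e))

  -- The Gaussian binomial coefficient in base p, indexed by i and j instead of i + j and i.
  gauss : ℕ → ℕ → Carrier
  gauss zero    j       = 1#
  gauss (suc i) zero    = 1#
  gauss (suc i) (suc j) = gauss i (suc j) + p ^ suc i * gauss (suc i) j

  gauss-pochhammer : ∀ i j → gauss i j * (pochhammer p i * pochhammer p j) ≈ pochhammer p (i ℕ.+ j)
  gauss-pochhammer zero    j       = trans (*-identityˡ _) (*-identityˡ _)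
  gauss-pochhammer (suc i) zero    = trans (*-identityˡ _) (trans (*-identityʳ _) (reflexive (≡.cong (pochhammer p) (≡.sym (ℕ.+-identityʳ (suc i))))))
  gauss-pochhammer (suc i) (suc j) = begin
    (gauss i (suc j) + p ^ suc i * gauss (suc i) j) * ((A * (1# - p * p ^ i)) * (B * (1# - p * p ^ j)))
      ≈⟨ solve 7 (λ g h p u v A B → let one = con (+ 1) in (g :+ (p :* u) :* h) :* ((A :* (one :- p :* u)) :* (B :* (one :- p :* v)))
           := (one :- p :* u) :* (g :* (A :* (B :* (one :- p :* v)))) :+ p :* u :* (one :- p :* v) :* (h :* ((A :* (one :- p :* u)) :* B))) refl
           (gauss i (suc j)) (gauss (suc i) j) p (p ^ i) (p ^ j) A B ⟩
    (1# - p * p ^ i) * (gauss i (suc j) * (A * pochhammer p (suc j))) + p * p ^ i * (1# - p * p ^ j) * (gauss (suc i) j * (pochhammer p (suc i) * B))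
      ≈⟨ +-cong (*-congˡ (trans (gauss-pochhammer i (suc j)) (reflexive (≡.cong (pochhammer p) (ℕ.+-suc i j))))) (*-congˡ (gauss-pochhammer (suc i) j)) ⟩
    (1# - p * p ^ i) * C + p * p ^ i * (1# - p * p ^ j) * C
      ≈⟨ solve 4 (λ p u v C → let one = con (+ 1) in (one :- p :* u) :* C :+ p :* u :* (one :- p :* v) :* C := C :* (one :- p :* (u :* (p :* v)))) refl p (p ^ i) (p ^ j) C ⟩
    C * (1# - p * (p ^ i * p ^ suc j)) ≈⟨ *-congˡ (+-congˡ (-‿cong (*-congˡ (trans (sym (^-homo-* p i (suc j))) (reflexive (≡.cong (p ^_) (ℕ.+-suc i j))))))) ⟩
    pochhammer p (suc (suc i ℕ.+ j)) ≡⟨ ≡.cong (pochhammer p) (≡.sym (ℕ.+-suc (suc i) j)) ⟩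
    pochhammer p (suc i ℕ.+ suc j) ∎
    where
    A = pochhammer p i
    B = pochhammer p j
    C = pochhammer p (suc i ℕ.+ j)

  -- A sum along constant `i + j`, started at an arbitrary `i` so that partial diagonals are open to
  -- induction on `j`.
  diagonal : (ℕ → ℕ → Carrier) → ℕ → ℕ → Carrier
  diagonal F i zero    = F i zero
  diagonal F i (suc j) = F i (suc j) + diagonal F (suc i) j

  module _ (x y : Carrier) where

    summand : ℕ → ℕ → Carrier
    summand i j = gauss i j * (pochhammer x i * pochhammer y j * x ^ j)

    private
      right up : ℕ → ℕ → Carrier
      right i j = gauss i j * (pochhammer x (suc i) * pochhammer y j * x ^ j)
      up    i j = p ^ i * gauss i j * (pochhammer x i * pochhammer y (suc j) * x ^ suc j)

      -- From `1 - x y u v = (1 - x u) + x u (1 - y v)` with `u = p ^ i` and `v = p ^ j`: the first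
      -- part lengthens the Pochhammer product in `x`, the second the one in `y`.
      split : ∀ i j → summand i j * (1# - x * y * p ^ (i ℕ.+ j)) ≈ right i j + up i j
      split i j = trans (*-congˡ (+-congˡ (-‿cong (*-congˡ (^-homo-* p i j)))))
        (solve 8 (λ g X Y z x y u v → let one = con (+ 1) in
           g :* (X :* Y :* z) :* (one :- x :* y :* (u :* v)) := g :* ((X :* (one :- x :* u)) :* Y :* z) :+ u :* g :* (X :* (Y :* (one :- y :* v)) :* (x :* z))) refl
           (gauss i j) (pochhammer x i) (pochhammer y j) (x ^ j) x y (p ^ i) (p ^ j))

      diagonal-split : ∀ i j → diagonal summand i j * (1# - x * y * p ^ (i ℕ.+ j)) ≈ up i j + diagonal summand (suc i) j
      diagonal-split i zero    = trans (split i 0) (trans (+-comm _ _) (+-congˡ (corner i)))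
        where
        corner : ∀ i → right i 0 ≈ summand (suc i) 0
        corner zero    = refl
        corner (suc i) = refl
      diagonal-split i (suc j) = begin
        (summand i (suc j) + diagonal summand (suc i) j) * (1# - x * y * p ^ (i ℕ.+ suc j))
          ≈⟨ trans (distribʳ _ _ _) (+-cong (split i (suc j)) (trans (*-congˡ (reflexive (≡.cong (λ k → 1# - x * y * p ^ k) (ℕ.+-suc i j)))) (diagonal-split (suc i) j))) ⟩
        (right i (suc j) + up i (suc j)) + (up (suc i) j + diagonal summand (suc (suc i)) j)
          -- The Pascal rule defining `gauss` merges `right i (suc j)` and `up (suc i) j` into
          -- `summand (suc i) (suc j)`.
          ≈⟨ solve 8 (λ g h P X Y z u d → (g :* (X :* Y :* z) :+ u) :+ (P :* h :* (X :* Y :* z) :+ d) := u :+ ((g :+ P :* h) :* (X :* Y :* z) :+ d)) refl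
               (gauss i (suc j)) (gauss (suc i) j) (p ^ suc i) (pochhammer x (suc i)) (pochhammer y (suc j)) (x ^ suc j) (up i (suc j)) (diagonal summand (suc (suc i)) j) ⟩
        up i (suc j) + diagonal summand (suc i) (suc j) ∎

    vandermonde : ∀ k → diagonal summand 0 k ≈ pochhammer (x * y) k
    vandermonde zero    = solve 0 (con (+ 1) :* (con (+ 1) :* con (+ 1) :* con (+ 1)) := con (+ 1)) refl
    vandermonde (suc k) = begin
      summand 0 (suc k) + diagonal summand 1 k ≈⟨ +-congʳ (*-congʳ (sym (*-identityˡ 1#))) ⟩
      up 0 k + diagonal summand 1 k ≈⟨ diagonal-split 0 k ⟨
      diagonal summand 0 k * (1# - x * y * p ^ k) ≈⟨ *-congʳ (vandermonde k) ⟩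
      pochhammer (x * y) (suc k) ∎

-- The ring ℤ[q]

-- Wrapping _≈ₚ_ in a record lets the polynomials be inferred from an equation between them.
infix 4 _≃_
record _≃_ (p r : Poly) : Set where
  constructor ⌊_⌋
  field coeff≡ : p ≈ₚ r
open _≃_ using (coeff≡)

coeff-⊕ : ∀ p r i → coeff (p ⊕ r) i ≡ coeff p i ℤ.+ coeff r i
coeff-⊕ []      r       i       = ≡.sym (ℤ.+-identityˡ _)
coeff-⊕ (a ∷ p) []      i       = ≡.sym (ℤ.+-identityʳ _)
coeff-⊕ (a ∷ p) (b ∷ r) zero    = ≡.refl
coeff-⊕ (a ∷ p) (b ∷ r) (suc i) = coeff-⊕ p r i

coeff-negP : ∀ p i → coeff (negP p) i ≡ ℤ.- coeff p i
coeff-negP []      i       = ≡.refl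
coeff-negP (a ∷ p) zero    = ≡.refl
coeff-negP (a ∷ p) (suc i) = coeff-negP p i

coeff-scaleP : ∀ c p i → coeff (scaleP c p) i ≡ c ℤ.* coeff p i
coeff-scaleP c []      i       = ≡.sym (ℤ.*-zeroʳ c)
coeff-scaleP c (a ∷ p) zero    = ≡.refl
coeff-scaleP c (a ∷ p) (suc i) = coeff-scaleP c p i

≃-isEquivalence : IsEquivalence _≃_
≃-isEquivalence = record
  { refl = ⌊ (λ _ → ≡.refl) ⌋ ; sym = λ e → ⌊ (λ i → ≡.sym (coeff≡ e i)) ⌋
  ; trans = λ e f → ⌊ (λ i → ≡.trans (coeff≡ e i) (coeff≡ f i)) ⌋ }

≃-setoid : Setoid 0ℓ 0ℓ
≃-setoid = record { isEquivalence = ≃-isEquivalence }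

open IsEquivalence ≃-isEquivalence using () renaming (refl to ≃-refl; sym to ≃-sym; trans to ≃-trans)
open import Relation.Binary.Reasoning.Setoid ≃-setoid

⊕-cong : ∀ {p p′ r r′} → p ≃ p′ → r ≃ r′ → p ⊕ r ≃ p′ ⊕ r′
⊕-cong {p} {p′} {r} {r′} e f = ⌊ (λ i → ≡.trans (coeff-⊕ p r i)
  (≡.trans (≡.cong₂ ℤ._+_ (coeff≡ e i) (coeff≡ f i)) (≡.sym (coeff-⊕ p′ r′ i)))) ⌋

⊕-comm : ∀ p r → p ⊕ r ≃ r ⊕ p
⊕-comm p r = ⌊ (λ i → ≡.trans (coeff-⊕ p r i) (≡.trans (ℤ.+-comm (coeff p i) _) (≡.sym (coeff-⊕ r p i)))) ⌋

⊕-assoc : ∀ p r t → (p ⊕ r) ⊕ t ≃ p ⊕ (r ⊕ t)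
⊕-assoc p r t = ⌊ (λ i → ≡.trans (coeff-⊕ (p ⊕ r) t i) (≡.trans (≡.cong (ℤ._+ coeff t i) (coeff-⊕ p r i))
  (≡.trans (ℤ.+-assoc (coeff p i) _ _) (≡.trans (≡.cong (ℤ._+_ (coeff p i)) (≡.sym (coeff-⊕ r t i))) (≡.sym (coeff-⊕ p (r ⊕ t) i)))))) ⌋

negP-cong : ∀ {p r} → p ≃ r → negP p ≃ negP r
negP-cong {p} {r} e = ⌊ (λ i → ≡.trans (coeff-negP p i) (≡.trans (≡.cong ℤ.-_ (coeff≡ e i)) (≡.sym (coeff-negP r i)))) ⌋

negP-inverseˡ : ∀ p → negP p ⊕ p ≃ []
negP-inverseˡ p = ⌊ (λ i → ≡.trans (coeff-⊕ (negP p) p i) (≡.trans (≡.cong (ℤ._+ coeff p i) (coeff-negP p i)) (ℤ.+-inverseˡ (coeff p i)))) ⌋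

scaleP-cong : ∀ c {p r} → p ≃ r → scaleP c p ≃ scaleP c r
scaleP-cong c {p} {r} e = ⌊ (λ i → ≡.trans (coeff-scaleP c p i) (≡.trans (≡.cong (c ℤ.*_) (coeff≡ e i)) (≡.sym (coeff-scaleP c r i)))) ⌋

scaleP-⊕ : ∀ c p r → scaleP c (p ⊕ r) ≃ scaleP c p ⊕ scaleP c r
scaleP-⊕ c p r = ⌊ (λ i → ≡.trans (coeff-scaleP c (p ⊕ r) i) (≡.trans (≡.cong (c ℤ.*_) (coeff-⊕ p r i))
  (≡.trans (ℤ.*-distribˡ-+ c (coeff p i) _) (≡.trans (≡.sym (≡.cong₂ ℤ._+_ (coeff-scaleP c p i) (coeff-scaleP c r i)))
  (≡.sym (coeff-⊕ (scaleP c p) (scaleP c r) i)))))) ⌋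

scaleP-scaleP : ∀ c d p → scaleP c (scaleP d p) ≃ scaleP (c ℤ.* d) p
scaleP-scaleP c d p = ⌊ (λ i → ≡.trans (coeff-scaleP c (scaleP d p) i) (≡.trans (≡.cong (c ℤ.*_) (coeff-scaleP d p i))
  (≡.trans (≡.sym (ℤ.*-assoc c d _)) (≡.sym (coeff-scaleP (c ℤ.* d) p i))))) ⌋

shift-cong : ∀ {p r} → p ≃ r → 0ℤ ∷ p ≃ 0ℤ ∷ r
shift-cong e = ⌊ (λ { zero → ≡.refl ; (suc i) → coeff≡ e i }) ⌋

shift-⊕ : ∀ p r → 0ℤ ∷ (p ⊕ r) ≃ (0ℤ ∷ p) ⊕ (0ℤ ∷ r)
shift-⊕ p r = ⌊ (λ { zero → ≡.refl ; (suc i) → ≡.refl }) ⌋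

shift-[] : 0ℤ ∷ [] ≃ []
shift-[] = ⌊ (λ { zero → ≡.refl ; (suc i) → ≡.refl }) ⌋

scaleP-shift : ∀ c p → scaleP c (0ℤ ∷ p) ≃ 0ℤ ∷ scaleP c p
scaleP-shift c p = ⌊ (λ { zero → ℤ.*-zeroʳ c ; (suc i) → ≡.refl }) ⌋

scaleP-0 : ∀ p → scaleP 0ℤ p ≃ []
scaleP-0 p = ⌊ (λ i → ≡.trans (coeff-scaleP 0ℤ p i) (ℤ.*-zeroˡ (coeff p i))) ⌋

scaleP-1 : ∀ p → scaleP 1ℤ p ≃ p
scaleP-1 p = ⌊ (λ i → ≡.trans (coeff-scaleP 1ℤ p i) (ℤ.*-identityˡ _)) ⌋

⊕-identityʳ : ∀ p → p ⊕ [] ≃ p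
⊕-identityʳ p = ⊕-comm p []

⊕-interchange : ∀ a b c d → (a ⊕ b) ⊕ (c ⊕ d) ≃ (a ⊕ c) ⊕ (b ⊕ d)
⊕-interchange a b c d = begin
  (a ⊕ b) ⊕ (c ⊕ d) ≈⟨ ⊕-assoc a b (c ⊕ d) ⟩
  a ⊕ (b ⊕ (c ⊕ d)) ≈⟨ ⊕-cong {a} ≃-refl (⊕-assoc b c d) ⟨
  a ⊕ ((b ⊕ c) ⊕ d) ≈⟨ ⊕-cong {a} ≃-refl (⊕-cong {r = d} (⊕-comm b c) ≃-refl) ⟩
  a ⊕ ((c ⊕ b) ⊕ d) ≈⟨ ⊕-cong {a} ≃-refl (⊕-assoc c b d) ⟩
  a ⊕ (c ⊕ (b ⊕ d)) ≈⟨ ⊕-assoc a c (b ⊕ d) ⟨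
  (a ⊕ c) ⊕ (b ⊕ d) ∎

⊗-congʳ : ∀ p {r t} → r ≃ t → p ⊗ r ≃ p ⊗ t
⊗-congʳ []      e = ≃-refl
⊗-congʳ (a ∷ p) e = ⊕-cong (scaleP-cong a e) (shift-cong (⊗-congʳ p e))

⊗-zeroʳ : ∀ p → p ⊗ [] ≃ []
⊗-zeroʳ []      = ≃-refl
⊗-zeroʳ (a ∷ p) = ≃-trans (shift-cong (⊗-zeroʳ p)) shift-[]

⊗-∷ʳ : ∀ p b r → p ⊗ (b ∷ r) ≃ scaleP b p ⊕ (0ℤ ∷ p ⊗ r)
⊗-∷ʳ []      b r = ≃-sym shift-[]
⊗-∷ʳ (a ∷ p) b r = begin
  scaleP a (b ∷ r) ⊕ (0ℤ ∷ p ⊗ (b ∷ r)) ≈⟨ ⌊ (λ { zero → ≡.cong (ℤ._+ 0ℤ) (ℤ.*-comm a b) ; (suc i) → ≡.refl }) ⌋ ⟩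
  (b ℤ.* a ℤ.+ 0ℤ) ∷ (scaleP a r ⊕ p ⊗ (b ∷ r)) ≈⟨ ⌊ (λ { zero → ≡.refl ; (suc i) → coeff≡ tail i }) ⌋ ⟩
  (b ℤ.* a ℤ.+ 0ℤ) ∷ (scaleP b p ⊕ (scaleP a r ⊕ (0ℤ ∷ p ⊗ r))) ∎
  where
  tail : scaleP a r ⊕ p ⊗ (b ∷ r) ≃ scaleP b p ⊕ (scaleP a r ⊕ (0ℤ ∷ p ⊗ r))
  tail = begin
    scaleP a r ⊕ p ⊗ (b ∷ r) ≈⟨ ⊕-cong {scaleP a r} ≃-refl (⊗-∷ʳ p b r) ⟩
    scaleP a r ⊕ (scaleP b p ⊕ (0ℤ ∷ p ⊗ r)) ≈⟨ ⊕-assoc (scaleP a r) _ _ ⟨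
    (scaleP a r ⊕ scaleP b p) ⊕ (0ℤ ∷ p ⊗ r) ≈⟨ ⊕-cong {r = 0ℤ ∷ p ⊗ r} (⊕-comm (scaleP a r) _) ≃-refl ⟩
    (scaleP b p ⊕ scaleP a r) ⊕ (0ℤ ∷ p ⊗ r) ≈⟨ ⊕-assoc (scaleP b p) _ _ ⟩
    scaleP b p ⊕ (scaleP a r ⊕ (0ℤ ∷ p ⊗ r)) ∎

⊗-comm : ∀ p r → p ⊗ r ≃ r ⊗ p
⊗-comm []      r = ≃-sym (⊗-zeroʳ r)
⊗-comm (a ∷ p) r = ≃-trans (⊕-cong {scaleP a r} ≃-refl (shift-cong (⊗-comm p r))) (≃-sym (⊗-∷ʳ r a p))

⊗-cong : ∀ {p p′ r r′} → p ≃ p′ → r ≃ r′ → p ⊗ r ≃ p′ ⊗ r′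
⊗-cong {p} {p′} {r} {r′} e f = ≃-trans (⊗-congʳ p f) (≃-trans (⊗-comm p r′) (≃-trans (⊗-congʳ r′ e) (⊗-comm r′ p′)))

⊗-distribˡ : ∀ p r t → p ⊗ (r ⊕ t) ≃ (p ⊗ r) ⊕ (p ⊗ t)
⊗-distribˡ []      r t = ≃-refl
⊗-distribˡ (a ∷ p) r t = begin
  scaleP a (r ⊕ t) ⊕ (0ℤ ∷ p ⊗ (r ⊕ t)) ≈⟨ ⊕-cong (scaleP-⊕ a r t) (≃-trans (shift-cong (⊗-distribˡ p r t)) (shift-⊕ (p ⊗ r) (p ⊗ t))) ⟩
  (scaleP a r ⊕ scaleP a t) ⊕ ((0ℤ ∷ p ⊗ r) ⊕ (0ℤ ∷ p ⊗ t)) ≈⟨ ⊕-interchange (scaleP a r) _ _ _ ⟩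
  (scaleP a r ⊕ (0ℤ ∷ p ⊗ r)) ⊕ (scaleP a t ⊕ (0ℤ ∷ p ⊗ t)) ∎

scaleP-⊗ : ∀ c p r → scaleP c p ⊗ r ≃ scaleP c (p ⊗ r)
scaleP-⊗ c []      r = ≃-refl
scaleP-⊗ c (a ∷ p) r = begin
  scaleP (c ℤ.* a) r ⊕ (0ℤ ∷ scaleP c p ⊗ r) ≈⟨ ⊕-cong (≃-sym (scaleP-scaleP c a r)) (≃-trans (shift-cong (scaleP-⊗ c p r)) (≃-sym (scaleP-shift c _))) ⟩
  scaleP c (scaleP a r) ⊕ scaleP c (0ℤ ∷ p ⊗ r) ≈⟨ scaleP-⊕ c (scaleP a r) _ ⟨
  scaleP c (scaleP a r ⊕ (0ℤ ∷ p ⊗ r)) ∎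

shift-⊗ : ∀ p r → (0ℤ ∷ p) ⊗ r ≃ 0ℤ ∷ p ⊗ r
shift-⊗ p r = ⊕-cong {r = 0ℤ ∷ p ⊗ r} (scaleP-0 r) ≃-refl

⊗-assoc : ∀ p r t → (p ⊗ r) ⊗ t ≃ p ⊗ (r ⊗ t)
⊗-assoc []      r t = ≃-refl
⊗-assoc (a ∷ p) r t = begin
  (scaleP a r ⊕ (0ℤ ∷ p ⊗ r)) ⊗ t ≈⟨ ⊗-comm (scaleP a r ⊕ (0ℤ ∷ p ⊗ r)) t ⟩
  t ⊗ (scaleP a r ⊕ (0ℤ ∷ p ⊗ r)) ≈⟨ ⊗-distribˡ t (scaleP a r) _ ⟩
  t ⊗ scaleP a r ⊕ t ⊗ (0ℤ ∷ p ⊗ r) ≈⟨ ⊕-cong (⊗-comm t (scaleP a r)) (⊗-comm t (0ℤ ∷ p ⊗ r)) ⟩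
  scaleP a r ⊗ t ⊕ (0ℤ ∷ p ⊗ r) ⊗ t ≈⟨ ⊕-cong (scaleP-⊗ a r t) (≃-trans (shift-⊗ (p ⊗ r) t) (shift-cong (⊗-assoc p r t))) ⟩
  scaleP a (r ⊗ t) ⊕ (0ℤ ∷ p ⊗ (r ⊗ t)) ∎

constP-⊗ : ∀ c p → constP c ⊗ p ≃ scaleP c p
constP-⊗ c p = ≃-trans (⊕-cong {scaleP c p} ≃-refl shift-[]) (⊕-identityʳ _)

-- Opaque copies of the operations: the solver and unification then treat polynomials as elements of an abstract ring.
infixl 6 _+ₚ_
infixl 7 _*ₚ_
opaque
  _+ₚ_ _*ₚ_ : Poly → Poly → Poly
  _+ₚ_ = _⊕_
  _*ₚ_ = _⊗_

  -ₚ_ : Poly → Poly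
  -ₚ_ = negP

  0ₚ 1ₚ q : Poly
  0ₚ = []
  1ₚ = oneP
  q  = 0ℤ ∷ 1ℤ ∷ []

  +ₚ-cong : ∀ {a b c d} → a ≃ b → c ≃ d → a +ₚ c ≃ b +ₚ d
  +ₚ-cong = ⊕-cong

  *ₚ-cong : ∀ {a b c d} → a ≃ b → c ≃ d → a *ₚ c ≃ b *ₚ d
  *ₚ-cong = ⊗-cong

  -ₚ-cong : ∀ {a b} → a ≃ b → -ₚ a ≃ -ₚ b
  -ₚ-cong = negP-cong

  +ₚ-assoc : ∀ a b c → (a +ₚ b) +ₚ c ≃ a +ₚ (b +ₚ c)
  +ₚ-assoc = ⊕-assoc

  +ₚ-comm : ∀ a b → a +ₚ b ≃ b +ₚ a
  +ₚ-comm = ⊕-comm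

  +ₚ-identityˡ : ∀ a → 0ₚ +ₚ a ≃ a
  +ₚ-identityˡ _ = ≃-refl

  -ₚ-inverseˡ : ∀ a → (-ₚ a) +ₚ a ≃ 0ₚ
  -ₚ-inverseˡ = negP-inverseˡ

  *ₚ-assoc : ∀ a b c → (a *ₚ b) *ₚ c ≃ a *ₚ (b *ₚ c)
  *ₚ-assoc = ⊗-assoc

  *ₚ-comm : ∀ a b → a *ₚ b ≃ b *ₚ a
  *ₚ-comm = ⊗-comm

  *ₚ-identityˡ : ∀ a → 1ₚ *ₚ a ≃ a
  *ₚ-identityˡ p = ≃-trans (constP-⊗ 1ℤ p) (scaleP-1 p)

  *ₚ-distribˡ-+ₚ : ∀ a b c → a *ₚ (b +ₚ c) ≃ a *ₚ b +ₚ a *ₚ c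
  *ₚ-distribˡ-+ₚ = ⊗-distribˡ

ℤ[q] : CommutativeRing 0ℓ 0ℓ
ℤ[q] = makeCommutativeRing {_≈_ = _≃_} {_+ₚ_} {_*ₚ_} { -ₚ_} {0ₚ} {1ₚ} ≃-isEquivalence +ₚ-cong *ₚ-cong -ₚ-cong
  +ₚ-assoc +ₚ-comm +ₚ-identityˡ -ₚ-inverseˡ *ₚ-assoc *ₚ-comm *ₚ-identityˡ *ₚ-distribˡ-+ₚ

module ℤq = Over ℤ[q]
open ℤq using (_≈_; _*_; _+_; _-_; -_; 1#; 0#; _^_; Regular; ∏; ∑; upper; lower; solve; con; _:=_; _:*_; _:+_; _:-_; :-_; _:^_;
  *-cong; *-congˡ; *-congʳ; +-cong; +-congˡ; +-congʳ; -‿cong; *-assoc; *-comm; *-identityˡ; *-identityʳ; +-assoc; +-comm; +-identityˡ; +-identityʳ; -‿inverseˡ; -‿inverseʳ; zeroˡ; zeroʳ; distribˡ; reflexive; -0#≈0#; *-interchange; ^-homo-*; ^-assocʳ; ^-congˡ; ∏-cong; ∏-*; ∏-+; ∏-extract; ∏-zero; Regular-*; Regular-^; Regular-∏; Regular-resp; Regular-cancel)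

opaque
  unfolding _+ₚ_

  +≡⊕ : ∀ p r → p + r ≡ p ⊕ r
  +≡⊕ p r = ≡.refl

  -≡⊖ : ∀ p r → p - r ≡ p ⊖ r
  -≡⊖ p r = ≡.refl

  *≡⊗ : ∀ p r → p * r ≡ p ⊗ r
  *≡⊗ p r = ≡.refl

  0≡[] : 0# ≡ []
  0≡[] = ≡.refl

  1≡oneP : 1# ≡ oneP
  1≡oneP = ≡.refl

  scaleP≈* : ∀ c p → scaleP c p ≈ constP c * p
  scaleP≈* c p = ≃-sym (constP-⊗ c p)

  q-* : ∀ p → q * p ≈ 0ℤ ∷ p
  q-* p = ≃-trans (shift-⊗ oneP p) (shift-cong (≃-trans (constP-⊗ 1ℤ p) (scaleP-1 p)))

  X^≈q^ : ∀ k → X^ k ≈ q ^ k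
  X^≈q^ zero    = ≃-refl
  X^≈q^ (suc k) = ≃-trans (shift-cong (X^≈q^ k)) (≃-sym (q-* (q ^ k)))

  qint-suc : ∀ k → qint (suc k) ≈ 1# + q * qint k
  qint-suc k = ≃-trans ⌊ (λ { zero → ≡.refl ; (suc i) → ≡.refl }) ⌋ (⊕-cong {1#} ≃-refl (≃-sym (q-* (qint k))))

  qint-0 : qint 0 ≈ 0#
  qint-0 = ≃-refl

  constP-* : ∀ a b → constP a * constP b ≈ constP (a ℤ.* b)
  constP-* a b = ≃-trans (constP-⊗ a (constP b)) ≃-refl

  constP-1 : constP 1ℤ ≈ 1#
  constP-1 = ≃-refl

  coeff-0 : ∀ i → coeff 0# i ≡ 0ℤ
  coeff-0 _ = ≡.refl

qint-geometric : ∀ k → (1# - q) * qint k ≈ 1# - q ^ k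
qint-geometric zero    = begin
  (1# - q) * qint 0 ≈⟨ *-congˡ qint-0 ⟩
  (1# - q) * 0# ≈⟨ solve 1 (λ q → (con (+ 1) :- q) :* con (+ 0) := con (+ 1) :- con (+ 1)) ≃-refl q ⟩
  1# - 1# ∎
qint-geometric (suc k) = begin
  (1# - q) * qint (suc k) ≈⟨ *-congˡ (qint-suc k) ⟩
  (1# - q) * (1# + q * qint k) ≈⟨ solve 2 (λ q a → let one = con (+ 1) in (one :- q) :* (one :+ q :* a) := one :- q :+ q :* ((one :- q) :* a)) ≃-refl q (qint k) ⟩
  1# - q + q * ((1# - q) * qint k) ≈⟨ +-congˡ (*-congˡ (qint-geometric k)) ⟩
  1# - q + q * (1# - q ^ k) ≈⟨ solve 2 (λ q a → let one = con (+ 1) in one :- q :+ q :* (one :- a) := one :- q :* a) ≃-refl q (q ^ k) ⟩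
  1# - q ^ suc k ∎

coeff-q^-* : ∀ {i k} p → i < k → coeff (q ^ k * p) i ≡ 0ℤ
coeff-q^-* {i} {suc k} p i<k with coeff≡ (≃-trans (*-assoc q (q ^ k) p) (q-* (q ^ k * p))) i
coeff-q^-* {zero}  {suc k} p i<k | e = e
coeff-q^-* {suc i} {suc k} p i<k | e = ≡.trans e (coeff-q^-* p (ℕ.≤-pred i<k))

regular-q : Regular q
regular-q b e = ⌊ (λ i → ≡.trans (coeff≡ (≃-trans (≃-sym (q-* b)) e) (suc i)) (≡.trans (coeff-0 (suc i)) (≡.sym (coeff-0 i)))) ⌋

-- If the product is zero then `b = q c b`, hence `b = q ^ k c ^ k b` for every `k`, and each
-- coefficient of `b` is zero.
regular-1-q* : ∀ c → Regular (1# - q * c)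
regular-1-q* c b e = ⌊ (λ i → ≡.trans (coeff≡ (iterate (suc i)) i) (≡.trans (coeff-q^-* _ (ℕ.≤-refl {suc i})) (≡.sym (coeff-0 i)))) ⌋
  where
  step : b ≈ q * (c * b)
  step = begin
    b ≈⟨ solve 3 (λ q c b → b := (con (+ 1) :- q :* c) :* b :+ q :* (c :* b)) ≃-refl q c b ⟩
    (1# - q * c) * b + q * (c * b) ≈⟨ +-congʳ e ⟩
    0# + q * (c * b) ≈⟨ +-identityˡ (q * (c * b)) ⟩
    q * (c * b) ∎
  iterate : ∀ k → b ≈ q ^ k * (c ^ k * b)
  iterate zero    = ≃-sym (≃-trans (*-identityˡ (1# * b)) (*-identityˡ b))
  iterate (suc k) = begin
    b ≈⟨ iterate k ⟩
    q ^ k * (c ^ k * b) ≈⟨ *-congˡ (*-congˡ step) ⟩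
    q ^ k * (c ^ k * (q * (c * b))) ≈⟨ solve 5 (λ u v q c b → u :* (v :* (q :* (c :* b))) := (q :* u) :* ((c :* v) :* b)) ≃-refl (q ^ k) (c ^ k) q c b ⟩
    q ^ suc k * (c ^ suc k * b) ∎

regular-1-q^ : ∀ k → Regular (1# - q ^ suc k)
regular-1-q^ k = regular-1-q* (q ^ k)

regular-constP : ∀ {c} → c ≢ 0ℤ → Regular (constP c)
regular-constP {c} c≢0 b e = ⌊ (λ i → ≡.trans (go i) (≡.sym (coeff-0 i))) ⌋
  where
  go : ∀ i → coeff b i ≡ 0ℤ
  go i with ℤ.i*j≡0⇒i≡0∨j≡0 c (≡.trans (≡.sym (≡.trans (coeff≡ (≃-sym (scaleP≈* c b)) i) (coeff-scaleP c b i))) (≡.trans (coeff≡ e i) (coeff-0 i)))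
  ... | inj₁ c≡0 = contradiction c≡0 c≢0
  ... | inj₂ b≡0 = b≡0

-- Divisibility and coprimality

≢0-* : ∀ {a b} → a ≢ 0ℤ → b ≢ 0ℤ → a ℤ.* b ≢ 0ℤ
≢0-* {a} a≢0 b≢0 e with ℤ.i*j≡0⇒i≡0∨j≡0 a e
... | inj₁ a≡0 = a≢0 a≡0
... | inj₂ b≡0 = b≢0 b≡0

infix 4 _∣ᵖ_
-- Divisibility in ℚ[q].
record _∣ᵖ_ (P A : Poly) : Set where
  constructor divides
  field
    {scalar}  : ℤ
    scalar≢0  : scalar ≢ 0ℤ
    quotient  : Poly
    equation  : constP scalar * A ≈ P * quotient

record Coprimeᵖ (B P : Poly) : Set where
  constructor bezout
  field
    {scalar}  : ℤ
    scalar≢0  : scalar ≢ 0ℤ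
    left      : Poly
    right     : Poly
    identity  : left * B + right * P ≈ constP scalar

1≢0 : 1ℤ ≢ 0ℤ
1≢0 ()

∣ᵖ-multiple : ∀ {P A} C → A ≈ P * C → P ∣ᵖ A
∣ᵖ-multiple C e = divides 1≢0 C (≃-trans (*-congʳ constP-1) (≃-trans (*-identityˡ _) e))

∣ᵖ-refl : ∀ {P} → P ∣ᵖ P
∣ᵖ-refl {P} = ∣ᵖ-multiple 1# (≃-sym (*-identityʳ P))

∣ᵖ-0 : ∀ {P} → P ∣ᵖ 0#
∣ᵖ-0 {P} = ∣ᵖ-multiple 0# (≃-sym (zeroʳ P))

∣ᵖ-resp : ∀ {P A B} → A ≈ B → P ∣ᵖ A → P ∣ᵖ B
∣ᵖ-resp e (divides n C p) = divides n C (≃-trans (*-congˡ (≃-sym e)) p)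

∣ᵖ-respˡ : ∀ {P Q A} → P ≈ Q → P ∣ᵖ A → Q ∣ᵖ A
∣ᵖ-respˡ e (divides n C p) = divides n C (≃-trans p (*-congʳ e))

∣ᵖ-*ʳ : ∀ {P A} B → P ∣ᵖ A → P ∣ᵖ A * B
∣ᵖ-*ʳ B (divides {c} n C p) = divides n (C * B) (≃-trans (≃-sym (*-assoc (constP c) _ B)) (≃-trans (*-congʳ p) (*-assoc _ C B)))

∣ᵖ-*ˡ : ∀ {P A} B → P ∣ᵖ A → P ∣ᵖ B * A
∣ᵖ-*ˡ B d = ∣ᵖ-resp (*-comm _ B) (∣ᵖ-*ʳ B d)

∣ᵖ-neg : ∀ {P A} → P ∣ᵖ A → P ∣ᵖ - A
∣ᵖ-neg {P} {A} d = ∣ᵖ-resp (solve 1 (λ a → (:- con (+ 1)) :* a := :- a) ≃-refl A) (∣ᵖ-*ˡ (- 1#) d)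

∣ᵖ-+ : ∀ {P A B} → P ∣ᵖ A → P ∣ᵖ B → P ∣ᵖ A + B
∣ᵖ-+ {P} {A} {B} (divides {c} n C p) (divides {d} m D r) = divides (≢0-* n m) (constP d * C + constP c * D) (begin
  constP (c ℤ.* d) * (A + B) ≈⟨ *-congʳ (constP-* c d) ⟨
  constP c * constP d * (A + B) ≈⟨ solve 4 (λ c d a b → c :* d :* (a :+ b) := d :* (c :* a) :+ c :* (d :* b)) ≃-refl (constP c) (constP d) A B ⟩
  constP d * (constP c * A) + constP c * (constP d * B) ≈⟨ +-cong (*-congˡ p) (*-congˡ r) ⟩
  constP d * (P * C) + constP c * (P * D) ≈⟨ solve 5 (λ c d p x y → d :* (p :* x) :+ c :* (p :* y) := p :* (d :* x :+ c :* y)) ≃-refl (constP c) (constP d) P C D ⟩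
  P * (constP d * C + constP c * D) ∎)

∣ᵖ-* : ∀ {P Q A B} → P ∣ᵖ A → Q ∣ᵖ B → P * Q ∣ᵖ A * B
∣ᵖ-* {P} {Q} {A} {B} (divides {c} n C p) (divides {d} m D r) = divides (≢0-* n m) (C * D) (begin
  constP (c ℤ.* d) * (A * B) ≈⟨ *-congʳ (constP-* c d) ⟨
  constP c * constP d * (A * B) ≈⟨ *-interchange _ _ A B ⟩
  (constP c * A) * (constP d * B) ≈⟨ *-cong p r ⟩
  (P * C) * (Q * D) ≈⟨ *-interchange P C Q D ⟩
  (P * Q) * (C * D) ∎)

∣ᵖ-trans : ∀ {P Q A} → P ∣ᵖ Q → Q ∣ᵖ A → P ∣ᵖ A
∣ᵖ-trans {P} {Q} {A} (divides {c} n C p) (divides {d} m D r) = divides (≢0-* n m) (C * D) (begin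
  constP (c ℤ.* d) * A ≈⟨ *-congʳ (constP-* c d) ⟨
  constP c * constP d * A ≈⟨ *-assoc _ _ A ⟩
  constP c * (constP d * A) ≈⟨ *-congˡ r ⟩
  constP c * (Q * D) ≈⟨ *-assoc _ Q D ⟨
  constP c * Q * D ≈⟨ *-congʳ p ⟩
  P * C * D ≈⟨ *-assoc P C D ⟩
  P * (C * D) ∎)

Coprimeᵖ-sym : ∀ {B P} → Coprimeᵖ B P → Coprimeᵖ P B
Coprimeᵖ-sym (bezout n U V e) = bezout n V U (≃-trans (+-comm _ _) e)

Coprimeᵖ-resp : ∀ {A B P} → A ≈ B → Coprimeᵖ A P → Coprimeᵖ B P
Coprimeᵖ-resp p (bezout n U V e) = bezout n U V (≃-trans (+-congʳ (*-congˡ (≃-sym p))) e)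

Coprimeᵖ-1 : ∀ {P} → Coprimeᵖ 1# P
Coprimeᵖ-1 {P} = bezout 1≢0 1# 0# (≃-trans (solve 1 (λ p → con (+ 1) :* con (+ 1) :+ con (+ 0) :* p := con (+ 1)) ≃-refl P) (≃-sym constP-1))

Coprimeᵖ-* : ∀ {A B P} → Coprimeᵖ A P → Coprimeᵖ B P → Coprimeᵖ (A * B) P
Coprimeᵖ-* {A} {B} {P} (bezout {c} n U V e) (bezout {d} m X Y f) = bezout (≢0-* n m) (U * X) (U * A * Y + V * (X * B + Y * P)) (begin
  U * X * (A * B) + (U * A * Y + V * (X * B + Y * P)) * P
    ≈⟨ solve 7 (λ a b p u v x y → u :* x :* (a :* b) :+ (u :* a :* y :+ v :* (x :* b :+ y :* p)) :* p := (u :* a :+ v :* p) :* (x :* b :+ y :* p)) ≃-refl A B P U V X Y ⟩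
  (U * A + V * P) * (X * B + Y * P) ≈⟨ *-cong e f ⟩
  constP c * constP d ≈⟨ constP-* c d ⟩
  constP (c ℤ.* d) ∎)

Coprimeᵖ-*ʳ : ∀ {B P Q} → Coprimeᵖ B P → Coprimeᵖ B Q → Coprimeᵖ B (P * Q)
Coprimeᵖ-*ʳ c d = Coprimeᵖ-sym (Coprimeᵖ-* (Coprimeᵖ-sym c) (Coprimeᵖ-sym d))

Coprimeᵖ-^ : ∀ {B P} n → Coprimeᵖ B P → Coprimeᵖ (B ^ n) P
Coprimeᵖ-^ zero    c = Coprimeᵖ-1
Coprimeᵖ-^ (suc n) c = Coprimeᵖ-* c (Coprimeᵖ-^ n c)

Coprimeᵖ-∏ : ∀ n {F P} → (∀ i → i < n → Coprimeᵖ (F i) P) → Coprimeᵖ (ℤq.∏ n F) P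
Coprimeᵖ-∏ zero    c = Coprimeᵖ-1
Coprimeᵖ-∏ (suc n) c = Coprimeᵖ-* (Coprimeᵖ-∏ n λ i i<n → c i (ℕ.m<n⇒m<1+n i<n)) (c n ℕ.≤-refl)

∣ᵖ-coprime : ∀ {P Q B} → P ∣ᵖ Q → Coprimeᵖ B Q → Coprimeᵖ B P
∣ᵖ-coprime {P} {Q} {B} (divides {d} n C p) (bezout {c} m U V e) = bezout (≢0-* n m) (constP d * U) (C * V) (begin
  constP d * U * B + C * V * P ≈⟨ solve 6 (λ d u b c v p → d :* u :* b :+ c :* v :* p := d :* u :* b :+ v :* (p :* c)) ≃-refl (constP d) U B C V P ⟩
  constP d * U * B + V * (P * C) ≈⟨ +-congˡ (*-congˡ p) ⟨
  constP d * U * B + V * (constP d * Q) ≈⟨ solve 5 (λ d u b v q → d :* u :* b :+ v :* (d :* q) := d :* (u :* b :+ v :* q)) ≃-refl (constP d) U B V Q ⟩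
  constP d * (U * B + V * Q) ≈⟨ *-congˡ e ⟩
  constP d * constP c ≈⟨ constP-* d c ⟩
  constP (d ℤ.* c) ∎)

-- Euclid's lemma: the Bézout identity times `A` expresses a nonzero constant multiple of `A`
-- through multiples of `P`.
coprime-∣ᵖ : ∀ {B P A} → Coprimeᵖ B P → P ∣ᵖ B * A → P ∣ᵖ A
coprime-∣ᵖ {B} {P} {A} (bezout {c} m U V e) (divides {d} n C p) = divides (≢0-* n m) (U * C + constP d * V * A) (begin
  constP (d ℤ.* c) * A ≈⟨ *-congʳ (constP-* d c) ⟨
  constP d * constP c * A ≈⟨ *-congʳ (*-congˡ e) ⟨
  constP d * (U * B + V * P) * A ≈⟨ solve 6 (λ d u b v p a → d :* (u :* b :+ v :* p) :* a := u :* (d :* (b :* a)) :+ p :* (d :* v :* a)) ≃-refl (constP d) U B V P A ⟩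
  U * (constP d * (B * A)) + P * (constP d * V * A) ≈⟨ +-congʳ (*-congˡ p) ⟩
  U * (P * C) + P * (constP d * V * A) ≈⟨ solve 4 (λ u p c x → u :* (p :* c) :+ p :* x := p :* (u :* c :+ x)) ≃-refl U P C (constP d * V * A) ⟩
  P * (U * C + constP d * V * A) ∎)

coprime-product-∣ᵖ : ∀ {P Q A} → Coprimeᵖ P Q → P ∣ᵖ A → Q ∣ᵖ A → P * Q ∣ᵖ A
coprime-product-∣ᵖ {P} {Q} {A} (bezout {c} m U V e) p∣A q∣A =
  divides-scaled (∣ᵖ-resp (begin
    U * P * A + V * Q * A ≈⟨ solve 5 (λ u p v q a → u :* p :* a :+ v :* q :* a := (u :* p :+ v :* q) :* a) ≃-refl U P V Q A ⟩
    (U * P + V * Q) * A ≈⟨ *-congʳ e ⟩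
    constP c * A ∎)
    (∣ᵖ-+ (∣ᵖ-resp (≃-sym (*-assoc U P A)) (∣ᵖ-*ˡ U (∣ᵖ-* ∣ᵖ-refl q∣A)))
          (∣ᵖ-resp (≃-sym (*-assoc V Q A)) (∣ᵖ-*ˡ V (∣ᵖ-respˡ (*-comm Q P) (∣ᵖ-* ∣ᵖ-refl p∣A))))))
  where
  divides-scaled : ∀ {R} → R ∣ᵖ constP c * A → R ∣ᵖ A
  divides-scaled (divides {d} n C p) = divides (≢0-* n m) C (≃-trans (≃-trans (*-congʳ (≃-sym (constP-* d c))) (*-assoc _ _ A)) p)

∣ᵖ⇒DividesP : ∀ {P A} → P ∣ᵖ A → DividesP P A
∣ᵖ⇒DividesP {P} {A} (divides {c} n C p) = c , n , C , _≃_.coeff≡ (≃-trans (scaleP≈* c A) (≃-trans p (reflexive (*≡⊗ P C))))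

Coprimeᵖ⇒CoprimeP : ∀ {B P} → Coprimeᵖ B P → CoprimeP B P
Coprimeᵖ⇒CoprimeP {B} {P} (bezout {c} n U V e) = c , n , U , V ,
  _≃_.coeff≡ (≃-trans (reflexive (≡.sym (≡.trans (+≡⊕ (U * B) (V * P)) (≡.cong₂ _⊕_ (*≡⊗ U B) (*≡⊗ V P))))) e)

≈⇒∣ᵖ- : ∀ {P A B} → A ≈ B → P ∣ᵖ A - B
≈⇒∣ᵖ- {P} {A} {B} e = ∣ᵖ-resp (≃-sym (≃-trans (+-congʳ e) (-‿inverseʳ B))) ∣ᵖ-0

-- The image of ℤ[q] in ℚ[q] / (P).
ℤ[q]/_ : Poly → CommutativeRing 0ℓ 0ℓ
ℤ[q]/ P = makeCommutativeRing {_≈_ = λ A B → P ∣ᵖ A - B} {_+ₚ_} {_*ₚ_} { -ₚ_} {0ₚ} {1ₚ}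
  (record { refl = ≈⇒∣ᵖ- ≃-refl
          ; sym = λ {a} {b} d → ∣ᵖ-resp (solve 2 (λ a b → :- (a :- b) := b :- a) ≃-refl a b) (∣ᵖ-neg d)
          ; trans = λ {a} {b} {c} d e → ∣ᵖ-resp (solve 3 (λ a b c → (a :- b) :+ (b :- c) := a :- c) ≃-refl a b c) (∣ᵖ-+ d e) })
  (λ {a} {b} {c} {d} p r → ∣ᵖ-resp (solve 4 (λ a b c d → (a :- b) :+ (c :- d) := (a :+ c) :- (b :+ d)) ≃-refl a b c d) (∣ᵖ-+ p r))
  (λ {a} {b} {c} {d} p r → ∣ᵖ-resp (solve 4 (λ a b c d → (a :- b) :* c :+ b :* (c :- d) := a :* c :- b :* d) ≃-refl a b c d) (∣ᵖ-+ (∣ᵖ-*ʳ c p) (∣ᵖ-*ˡ b r)))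
  (λ {a} {b} p → ∣ᵖ-resp (solve 2 (λ a b → :- (a :- b) := :- a :- :- b) ≃-refl a b) (∣ᵖ-neg p))
  (λ a b c → ≈⇒∣ᵖ- (+-assoc a b c)) (λ a b → ≈⇒∣ᵖ- (+-comm a b)) (λ a → ≈⇒∣ᵖ- (+-identityˡ a)) (λ a → ≈⇒∣ᵖ- (-‿inverseˡ a))
  (λ a b c → ≈⇒∣ᵖ- (*-assoc a b c)) (λ a b → ≈⇒∣ᵖ- (*-comm a b)) (λ a → ≈⇒∣ᵖ- (*-identityˡ a)) (λ a b c → ≈⇒∣ᵖ- (distribˡ a b c))

module ℤq/ (P : Poly) = Over (ℤ[q]/ P)

∣ᵖ⇒≈0 : ∀ {P A} → P ∣ᵖ A → ℤq/._≈_ P A 0#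
∣ᵖ⇒≈0 {A = A} = ∣ᵖ-resp (solve 1 (λ a → a := a :- con (+ 0)) ≃-refl A)

≈0⇒∣ᵖ : ∀ {P A} → ℤq/._≈_ P A 0# → P ∣ᵖ A
≈0⇒∣ᵖ {A = A} = ∣ᵖ-resp (solve 1 (λ a → a :- con (+ 0) := a) ≃-refl A)

-- Turns coprimality over ℚ into the cancellation property that the results on `Series` ask for.
coprime⇒regular : ∀ {B P} → Coprimeᵖ B P → ℤq/.Regular P B
coprime⇒regular c b e = ∣ᵖ⇒≈0 (coprime-∣ᵖ c (≈0⇒∣ᵖ e))

-- Cyclotomic polynomials

-- The helper functions of divMonic are private to Defs; each of them is recovered here as the
-- solution of a unification problem.
mutual
  divideFrom : ℕ → List ℤ → List ℤ → List ℤ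
  divideFrom = _

  divMonic-divideFrom : ∀ a b at bt → reverse a ≡ 1ℤ ∷ at → reverse b ≡ 1ℤ ∷ bt →
    divMonic a b ≡ divideFrom (suc (length at) ℕ.∸ length bt) (1ℤ ∷ at) bt
  divMonic-divideFrom a b at bt p r with reverse a | reverse b
  divMonic-divideFrom a b at bt ≡.refl ≡.refl | _ | _ with suc (length at) ℕ.∸ length bt | 1ℤ ∷ at
  ... | _ | _ = ≡.refl

mutual
  -- `reverse` is a left fold: once the first quotient digit is produced, a fold over the other
  -- digits with accumulator `r ∷ []` remains. Abstracting this list yields a division loop with an
  -- arbitrary accumulator.
  divideStep : List ℤ → ℕ → List ℤ → List ℤ → List ℤ → List ℤ
  divideStep = _

  divideFrom-divideStep : ∀ r rs k bt → divideFrom (suc k) (r ∷ rs) bt ≡ divideStep (r ∷ []) k rs (map (r ℤ.*_) bt) bt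
  divideFrom-divideStep r rs k bt with map (r ℤ.*_) bt | r ∷ []
  ... | _ | _ = ≡.refl

mutual
  -- With an empty accumulator both loops coincide, and comparing their arguments determines the
  -- private subtraction.
  subtractPrefix : List ℤ → List ℤ → List ℤ
  subtractPrefix = _

  divideStep-divideFrom : ∀ k rs ys bt → divideStep [] k rs ys bt ≡ divideFrom k (subtractPrefix rs ys) bt
  divideStep-divideFrom k rs ys bt = ≡.refl

subtractPrefix-[] : ∀ xs → subtractPrefix xs [] ≡ xs
subtractPrefix-[] []      = ≡.refl
subtractPrefix-[] (_ ∷ _) = ≡.refl

-- The quotient digits are accumulated on the list b, lowest degree first.
divideOnto : List ℤ → ℕ → List ℤ → List ℤ → List ℤ
divideOnto b k r bt = divideStep b k r [] bt

divideOnto-suc : ∀ b r rs k bt → divideOnto b (suc k) (r ∷ rs) bt ≡ divideOnto (r ∷ b) k (subtractPrefix rs (map (r ℤ.*_) bt)) bt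
divideOnto-suc b r rs k bt rewrite subtractPrefix-[] (subtractPrefix rs (map (r ℤ.*_) bt)) = ≡.refl

divideFrom-divideOnto : ∀ k r bt → divideFrom k r bt ≡ divideOnto [] k r bt
divideFrom-divideOnto k r bt rewrite subtractPrefix-[] r = ≡.refl

-- Correctness of the long division.

highFirst : List ℤ → Poly
highFirst []       = 0#
highFirst (x ∷ xs) = constP x * q ^ length xs + highFirst xs

opaque
  unfolding _+ₚ_

  ∷≈ : ∀ x p → x ∷ p ≈ constP x + q * p
  ∷≈ x p = ≃-trans ⌊ (λ { zero → ≡.sym (ℤ.+-identityʳ x) ; (suc i) → ≡.refl }) ⌋ (⊕-cong {constP x} ≃-refl (≃-sym (q-* p)))

  constP-+ : ∀ a b → constP a + constP b ≈ constP (a ℤ.+ b)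
  constP-+ a b = ≃-refl

  constP-neg : ∀ a → - constP a ≈ constP (ℤ.- a)
  constP-neg a = ≃-refl

foldl-highFirst : ∀ b xs → foldl (flip _∷_) b xs ≈ highFirst xs + q ^ length xs * b
foldl-highFirst b []       = solve 1 (λ b → b := con (+ 0) :+ con (+ 1) :* b) ≃-refl b
foldl-highFirst b (x ∷ xs) = begin
  foldl (flip _∷_) (x ∷ b) xs ≈⟨ foldl-highFirst (x ∷ b) xs ⟩
  highFirst xs + q ^ length xs * (x ∷ b) ≈⟨ +-congˡ (*-congˡ (∷≈ x b)) ⟩
  highFirst xs + q ^ length xs * (constP x + q * b)
    ≈⟨ solve 5 (λ h u c q b → h :+ u :* (c :+ q :* b) := (c :* u :+ h) :+ (q :* u) :* b) ≃-refl (highFirst xs) (q ^ length xs) (constP x) q b ⟩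
  highFirst (x ∷ xs) + q ^ length (x ∷ xs) * b ∎

reverse-highFirst : ∀ xs → reverse xs ≈ highFirst xs
reverse-highFirst xs = ≃-trans (foldl-highFirst [] xs) (≃-trans (+-congˡ (≃-trans (*-congˡ (reflexive (≡.sym 0≡[]))) (zeroʳ _))) (+-identityʳ _))

length-subtractPrefix : ∀ xs ys → length ys ≤ length xs → length (subtractPrefix xs ys) ≡ length xs
length-subtractPrefix xs       []       _         = ≡.cong length (subtractPrefix-[] xs)
length-subtractPrefix (x ∷ xs) (y ∷ ys) (s≤s p) = ≡.cong suc (length-subtractPrefix xs ys p)

highFirst-subtractPrefix : ∀ xs ys k → length xs ≡ k ℕ.+ length ys → highFirst (subtractPrefix xs ys) ≈ highFirst xs - q ^ k * highFirst ys
highFirst-subtractPrefix xs [] k _ = ≃-trans (reflexive (≡.cong highFirst (subtractPrefix-[] xs)))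
  (solve 2 (λ x u → x := x :- u :* con (+ 0)) ≃-refl (highFirst xs) (q ^ k))
highFirst-subtractPrefix [] (y ∷ ys) k p with ≡.trans p (ℕ.+-suc k (length ys))
... | ()
highFirst-subtractPrefix (x ∷ xs) (y ∷ ys) k p = begin
  constP (x ℤ.- y) * q ^ length (subtractPrefix xs ys) + highFirst (subtractPrefix xs ys)
    ≈⟨ +-cong (*-cong (≃-sym (≃-trans (+-congˡ (constP-neg y)) (constP-+ x (ℤ.- y))))
        (reflexive (≡.cong (q ^_) (length-subtractPrefix xs ys (ℕ.m+n≤o⇒n≤o k (ℕ.≤-reflexive (≡.sym len)))))))
        (highFirst-subtractPrefix xs ys k len) ⟩
  (constP x - constP y) * q ^ length xs + (highFirst xs - q ^ k * highFirst ys)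
    ≈⟨ solve 6 (λ x y u h v l → (x :- y) :* u :+ (h :- v :* l) := (x :* u :+ h) :- (y :* u :+ v :* l)) ≃-refl (constP x) (constP y) (q ^ length xs) (highFirst xs) (q ^ k) (highFirst ys) ⟩
  (constP x * q ^ length xs + highFirst xs) - (constP y * q ^ length xs + q ^ k * highFirst ys)
    ≈⟨ +-congˡ (-‿cong (+-congʳ (*-congˡ (≃-trans (reflexive (≡.cong (q ^_) len)) (^-homo-* q k (length ys)))))) ⟩
  (constP x * q ^ length xs + highFirst xs) - (constP y * (q ^ k * q ^ length ys) + q ^ k * highFirst ys)
    ≈⟨ +-congˡ (-‿cong (solve 4 (λ y v u l → y :* (v :* u) :+ v :* l := v :* (y :* u :+ l)) ≃-refl (constP y) (q ^ k) (q ^ length ys) (highFirst ys))) ⟩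
  highFirst (x ∷ xs) - q ^ k * highFirst (y ∷ ys) ∎
  where
  len : length xs ≡ k ℕ.+ length ys
  len = ℕ.suc-injective (≡.trans p (ℕ.+-suc k (length ys)))

highFirst-map : ∀ c xs → highFirst (map (c ℤ.*_) xs) ≈ constP c * highFirst xs
highFirst-map c []       = ≃-sym (zeroʳ (constP c))
highFirst-map c (x ∷ xs) = begin
  constP (c ℤ.* x) * q ^ length (map (c ℤ.*_) xs) + highFirst (map (c ℤ.*_) xs)
    ≈⟨ +-cong (*-cong (≃-sym (constP-* c x)) (reflexive (≡.cong (q ^_) (List.length-map (c ℤ.*_) xs)))) (highFirst-map c xs) ⟩
  constP c * constP x * q ^ length xs + constP c * highFirst xs
    ≈⟨ solve 4 (λ c x u h → c :* x :* u :+ c :* h := c :* (x :* u :+ h)) ≃-refl (constP c) (constP x) (q ^ length xs) (highFirst xs) ⟩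
  constP c * highFirst (x ∷ xs) ∎

record LongDivision (bt r : List ℤ) (b : List ℤ) (k : ℕ) : Set where
  field
    quotient remainder : List ℤ
    quotient≡  : divideOnto b k r bt ≡ foldl (flip _∷_) b quotient
    length≡    : length quotient ≡ k
    equation   : highFirst r ≈ highFirst (1ℤ ∷ bt) * highFirst quotient + highFirst remainder
    remainder< : length remainder ≤ length bt
    leading    : ∀ {x rs} → r ≡ x ∷ rs → k ≢ 0 → Σ (List ℤ) λ ys → quotient ≡ x ∷ ys

-- `k` counts the digits still to come; when it reaches zero, what is left of `r` is no longer than
-- `bt`, so its degree is below that of the divisor `1ℤ ∷ bt`. The field `leading` will show that
-- quotients of monic polynomials are monic.
longDivision : ∀ k bt r b → k ≡ length r ℕ.∸ length bt → LongDivision bt r b k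
longDivision zero bt r b e = record
  { quotient = [] ; remainder = r ; quotient≡ = ≡.refl ; length≡ = ≡.refl
  ; equation = solve 2 (λ r d → r := d :* con (+ 0) :+ r) ≃-refl (highFirst r) (highFirst (1ℤ ∷ bt))
  ; remainder< = ℕ.m∸n≡0⇒m≤n (≡.sym e)
  ; leading = λ _ k≢0 → contradiction ≡.refl k≢0 }
longDivision (suc k) bt [] b e with ≡.trans e (ℕ.0∸n≡0 (length bt))
... | ()
longDivision (suc k) bt (x ∷ rs) b e = record
  { quotient = x ∷ D.quotient ; remainder = D.remainder
  ; quotient≡ = ≡.trans (divideOnto-suc b x rs k bt) D.quotient≡
  ; length≡ = ≡.cong suc D.length≡
  ; equation = begin
      constP x * q ^ length rs + highFirst rs
        ≈⟨ solve 4 (λ a h k t → a :+ h := a :+ k :* t :+ (h :- k :* t)) ≃-refl (constP x * q ^ length rs) (highFirst rs) (q ^ k) (highFirst (map (x ℤ.*_) bt)) ⟩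
      constP x * q ^ length rs + q ^ k * highFirst (map (x ℤ.*_) bt) + (highFirst rs - q ^ k * highFirst (map (x ℤ.*_) bt))
        ≈⟨ +-cong (+-cong (*-congˡ (≃-trans (reflexive (≡.cong (q ^_) len)) (^-homo-* q k (length bt)))) (*-congˡ (highFirst-map x bt)))
             (≃-sym (highFirst-subtractPrefix rs (map (x ℤ.*_) bt) k len′)) ⟩
      constP x * (q ^ k * q ^ length bt) + q ^ k * (constP x * highFirst bt) + highFirst rs′
        ≈⟨ +-congˡ D.equation ⟩
      constP x * (q ^ k * q ^ length bt) + q ^ k * (constP x * highFirst bt) + (highFirst (1ℤ ∷ bt) * highFirst D.quotient + highFirst D.remainder)
        ≈⟨ +-congˡ (+-congʳ (*-congʳ monic)) ⟩
      constP x * (q ^ k * q ^ length bt) + q ^ k * (constP x * highFirst bt) + ((q ^ length bt + highFirst bt) * highFirst D.quotient + highFirst D.remainder)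
        ≈⟨ solve 6 (λ x u v h g r → x :* (u :* v) :+ u :* (x :* h) :+ ((v :+ h) :* g :+ r) := (v :+ h) :* (x :* u :+ g) :+ r) ≃-refl
             (constP x) (q ^ k) (q ^ length bt) (highFirst bt) (highFirst D.quotient) (highFirst D.remainder) ⟩
      (q ^ length bt + highFirst bt) * (constP x * q ^ k + highFirst D.quotient) + highFirst D.remainder
        ≈⟨ +-congʳ (*-cong (≃-sym monic) (+-congʳ (*-congˡ (reflexive (≡.cong (q ^_) (≡.sym D.length≡)))))) ⟩
      highFirst (1ℤ ∷ bt) * highFirst (x ∷ D.quotient) + highFirst D.remainder ∎
  ; remainder< = D.remainder<
  ; leading = λ { ≡.refl _ → D.quotient , ≡.refl } }
  where
  rs′ = subtractPrefix rs (map (x ℤ.*_) bt)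
  bt≤rs : length bt ≤ length rs
  bt≤rs = ℕ.≤-pred (ℕ.m∸n≢0⇒n<m λ z → contradiction (≡.trans e z) λ ())
  k≡ : k ≡ length rs ℕ.∸ length bt
  k≡ = ℕ.suc-injective (≡.trans e (ℕ.+-∸-assoc 1 bt≤rs))
  len : length rs ≡ k ℕ.+ length bt
  len = ≡.sym (≡.trans (≡.cong (ℕ._+ length bt) k≡) (ℕ.m∸n+n≡m bt≤rs))
  len′ : length rs ≡ k ℕ.+ length (map (x ℤ.*_) bt)
  len′ = ≡.trans len (≡.cong (k ℕ.+_) (≡.sym (List.length-map (x ℤ.*_) bt)))
  module D = LongDivision (longDivision k bt rs′ (x ∷ b) (≡.trans k≡ (≡.cong (ℕ._∸ length bt)
    (≡.sym (length-subtractPrefix rs (map (x ℤ.*_) bt) (ℕ.≤-trans (ℕ.≤-reflexive (List.length-map (x ℤ.*_) bt)) bt≤rs))))))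
  monic : highFirst (1ℤ ∷ bt) ≈ q ^ length bt + highFirst bt
  monic = +-congʳ (≃-trans (*-congʳ constP-1) (*-identityˡ _))

coeff-highFirst : ∀ xs {i} → length xs ≤ i → coeff (highFirst xs) i ≡ 0ℤ
coeff-highFirst xs {i} p = ≡.trans (≡.sym (_≃_.coeff≡ (reverse-highFirst xs) i)) (beyond (reverse xs) (ℕ.≤-trans (ℕ.≤-reflexive (List.length-reverse xs)) p))
  where
  beyond : ∀ xs {i} → length xs ≤ i → coeff xs i ≡ 0ℤ
  beyond []       _       = ≡.refl
  beyond (x ∷ xs) (s≤s p) = beyond xs p

-- Monic as a list: without trailing zeros, so that reversing the list exposes the leading coefficient.
record Monic (d : ℕ) (p : Poly) : Set where
  constructor monic
  field
    initial : List ℤ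
    shape   : p ≡ initial ++ 1ℤ ∷ []
    degree  : length initial ≡ d

⊕-[]-identityʳ : ∀ p → p ⊕ [] ≡ p
⊕-[]-identityʳ []      = ≡.refl
⊕-[]-identityʳ (_ ∷ _) = ≡.refl

short-⊕ : ∀ r s → length r ≤ length s → Σ (List ℤ) λ t → r ⊕ (s ++ 1ℤ ∷ []) ≡ t ++ 1ℤ ∷ [] × length t ≡ length s
short-⊕ []      s       _       = s , ≡.refl , ≡.refl
short-⊕ (a ∷ r) (b ∷ s) (s≤s p) with short-⊕ r s p
... | t , e , l = a ℤ.+ b ∷ t , ≡.cong (a ℤ.+ b ∷_) e , ≡.cong suc l

Monic-⊗ : ∀ {d e p r} → Monic d p → Monic e r → Monic (d ℕ.+ e) (p ⊗ r)
Monic-⊗ (monic [] ≡.refl ≡.refl) (monic s ≡.refl ≡.refl) = monic s (one s) ≡.refl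
  where
  scale-1 : ∀ xs → scaleP 1ℤ xs ≡ xs
  scale-1 []       = ≡.refl
  scale-1 (x ∷ xs) = ≡.cong₂ _∷_ (ℤ.*-identityˡ x) (scale-1 xs)
  add-0 : ∀ s → (s ++ 1ℤ ∷ []) ⊕ (0ℤ ∷ []) ≡ s ++ 1ℤ ∷ []
  add-0 []      = ≡.refl
  add-0 (x ∷ s) = ≡.cong₂ _∷_ (ℤ.+-identityʳ x) (⊕-[]-identityʳ (s ++ 1ℤ ∷ []))
  one : ∀ s → (1ℤ ∷ []) ⊗ (s ++ 1ℤ ∷ []) ≡ s ++ 1ℤ ∷ []
  one s = ≡.trans (≡.cong (_⊕ (0ℤ ∷ [])) (scale-1 (s ++ 1ℤ ∷ []))) (add-0 s)
Monic-⊗ {r = r} (monic (a ∷ p) ≡.refl ≡.refl) m@(monic s ≡.refl ≡.refl) with Monic-⊗ (monic p ≡.refl ≡.refl) m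
... | monic u e l with short-⊕ (scaleP a r) (0ℤ ∷ u) (ℕ.≤-trans (ℕ.≤-reflexive len) (s≤s (ℕ.≤-trans (ℕ.m≤n+m (length s) (length p)) (ℕ.≤-reflexive (≡.sym l)))))
  where
  len : length (scaleP a r) ≡ suc (length s)
  len = ≡.trans (List.length-map (a ℤ.*_) r) (≡.trans (List.length-++ s) (ℕ.+-comm (length s) 1))
... | t , e′ , l′ = monic t (≡.trans (≡.cong (λ x → scaleP a r ⊕ (0ℤ ∷ x)) e) e′) (≡.trans l′ (≡.cong suc l))

Monic-reverse : ∀ {d p} → Monic d p → Σ (List ℤ) λ bt → reverse p ≡ 1ℤ ∷ bt × length bt ≡ d
Monic-reverse (monic s ≡.refl ≡.refl) = reverse s , List.reverse-++ s (1ℤ ∷ []) , List.length-reverse s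

Monic-coeff : ∀ {d p} → Monic d p → coeff p d ≡ 1ℤ × (∀ i → d < i → coeff p i ≡ 0ℤ)
Monic-coeff (monic [] ≡.refl ≡.refl) = ≡.refl , λ { (suc i) _ → ≡.refl }
Monic-coeff (monic (a ∷ s) ≡.refl ≡.refl) with Monic-coeff (monic s ≡.refl ≡.refl)
... | e , f = e , λ { (suc i) (s≤s p) → f i p }

opaque
  unfolding _+ₚ_

  coeff-*-top : ∀ d p r j → (∀ i → d < i → coeff p i ≡ 0ℤ) → (∀ i → j < i → coeff r i ≡ 0ℤ) →
    coeff (p * r) (d ℕ.+ j) ≡ coeff p d ℤ.* coeff r j
  coeff-*-top d       []      r j hp hr = ≡.refl
  coeff-*-top zero    (a ∷ p) r j hp hr = ≡.trans (_≃_.coeff≡ (≃-trans (⊕-cong {scaleP a r} ≃-refl (≃-trans (shift-cong (⊗-cong {p} {[]} {r} p≈[] ≃-refl)) shift-[])) (⊕-identityʳ (scaleP a r))) j)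
    (coeff-scaleP a r j)
    where
    p≈[] : p ≃ []
    p≈[] = ⌊ (λ i → hp (suc i) (s≤s z≤n)) ⌋
  coeff-*-top (suc d) (a ∷ p) r j hp hr = ≡.trans (coeff-⊕ (scaleP a r) (0ℤ ∷ p ⊗ r) (suc (d ℕ.+ j))) (≡.trans
    (≡.cong₂ ℤ._+_ (≡.trans (coeff-scaleP a r (suc (d ℕ.+ j))) (≡.trans (≡.cong (a ℤ.*_) (hr _ (s≤s (ℕ.m≤n+m j d)))) (ℤ.*-zeroʳ a)))
      (coeff-*-top d p r j (λ i d<i → hp (suc i) (s≤s d<i)) hr))
    (ℤ.+-identityˡ _))

  coeff-constP-* : ∀ c p i → coeff (constP c * p) i ≡ c ℤ.* coeff p i
  coeff-constP-* c p i = ≡.trans (_≃_.coeff≡ (constP-⊗ c p) i) (coeff-scaleP c p i)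

coeff-beyond : ∀ p {i} → length p ≤ i → coeff p i ≡ 0ℤ
coeff-beyond []      _       = ≡.refl
coeff-beyond (_ ∷ p) (s≤s l) = coeff-beyond p l

-- The coefficients of `Y` are killed from the top down: once all higher ones vanish, `coeff Y i`
-- equals the coefficient of `p * Y` at `d + i`. In `vanish`, `j` bounds the distance from `i` up to
-- `length Y`.
monic-multiple≈0 : ∀ {d p} Y → Monic d p → (∀ i → d ≤ i → coeff (p * Y) i ≡ 0ℤ) → Y ≈ 0#
monic-multiple≈0 {d} {p} Y m h = ⌊ (λ i → ≡.trans (vanish (length Y) i (ℕ.m≤n+m (length Y) i)) (≡.sym (coeff-0 i))) ⌋
  where
  vanish : ∀ j i → length Y ≤ i ℕ.+ j → coeff Y i ≡ 0ℤ
  vanish zero    i le = coeff-beyond Y (≡.subst (length Y ≤_) (ℕ.+-identityʳ i) le)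
  vanish (suc j) i le = ≡.trans (≡.sym (ℤ.*-identityˡ _)) (≡.trans (≡.cong (ℤ._* coeff Y i) (≡.sym (proj₁ (Monic-coeff m))))
    (≡.trans (≡.sym (coeff-*-top d p Y i (proj₂ (Monic-coeff m)) λ i′ i<i′ → vanish j i′ (ℕ.≤-trans le (ℕ.≤-trans (ℕ.≤-reflexive (ℕ.+-suc i j)) (ℕ.+-monoˡ-≤ j i<i′)))))
      (h (d ℕ.+ i) (ℕ.m≤m+n d i))))

-- Gauss's lemma for a monic divisor: divisibility over ℚ already makes the remainder of the division vanish.
divMonic-exact : ∀ {d p n a} → Monic d p → Monic n a → p ∣ᵖ a → p * divMonic a p ≈ a × ∃ λ e → Monic e (divMonic a p)
divMonic-exact {d} {p} {n} {a} m ma (divides {c} c≢0 C eq) with Monic-reverse m | Monic-reverse ma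
... | bt , rp , ≡.refl | at , ra , ≡.refl = exact , leading
  where
  module D = LongDivision (longDivision (suc (length at) ℕ.∸ length bt) bt (1ℤ ∷ at) [] ≡.refl)
  high : ∀ {p bt} → reverse p ≡ bt → p ≈ highFirst bt
  high {p} {bt} e = ≃-trans (reflexive (≡.sym (≡.trans (≡.cong reverse (≡.sym e)) (List.reverse-involutive p)))) (reverse-highFirst bt)
  Q R : Poly
  Q = highFirst D.quotient
  R = highFirst D.remainder
  divMonic≡ : divMonic a p ≡ reverse D.quotient
  divMonic≡ = ≡.trans (divMonic-divideFrom a p at bt ra rp) (≡.trans (divideFrom-divideOnto (suc (length at) ℕ.∸ length bt) (1ℤ ∷ at) bt) D.quotient≡)
  a≈ : a ≈ p * Q + R
  a≈ = ≃-trans (high ra) (≃-trans D.equation (+-congʳ (*-congʳ (≃-sym (high rp)))))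
  -- The quotient over ℚ is `C` divided by `c`; `Y` is `c` times its difference from the computed
  -- quotient `Q`.
  Y : Poly
  Y = C - constP c * Q
  pY≈cR : p * Y ≈ constP c * R
  pY≈cR = begin
    p * (C - constP c * Q) ≈⟨ solve 4 (λ p C c Q → p :* (C :- c :* Q) := p :* C :- c :* (p :* Q)) ≃-refl p C (constP c) Q ⟩
    p * C - constP c * (p * Q) ≈⟨ +-congʳ (≃-trans (≃-sym eq) (*-congˡ a≈)) ⟩
    constP c * (p * Q + R) - constP c * (p * Q) ≈⟨ solve 3 (λ c x R → c :* (x :+ R) :- c :* x := c :* R) ≃-refl (constP c) (p * Q) R ⟩
    constP c * R ∎
  R≈0 : R ≈ 0#
  R≈0 = regular-constP c≢0 R (≃-trans (≃-sym pY≈cR) (≃-trans (*-congˡ (monic-multiple≈0 Y m λ i d≤i →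
    ≡.trans (_≃_.coeff≡ pY≈cR i) (≡.trans (coeff-constP-* c R i) (≡.trans (≡.cong (c ℤ.*_) (coeff-highFirst D.remainder (ℕ.≤-trans D.remainder< d≤i))) (ℤ.*-zeroʳ c)))))
    (zeroʳ p)))
  exact : p * divMonic a p ≈ a
  exact = ≃-trans (*-congˡ (≃-trans (reflexive divMonic≡) (reverse-highFirst D.quotient)))
    (≃-sym (≃-trans a≈ (≃-trans (+-congˡ R≈0) (+-identityʳ _))))
  leading : ∃ λ e → Monic e (divMonic a p)
  leading = length (proj₁ led) , monic (reverse (proj₁ led))
    (≡.trans divMonic≡ (≡.trans (≡.cong reverse (proj₂ led)) (List.unfold-reverse 1ℤ (proj₁ led)))) (List.length-reverse (proj₁ led))
    where
    empty : ∀ (xs : List ℤ) → length xs ≡ 0 → xs ≡ []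
    empty [] _ = ≡.refl
    a≈0 : suc (length at) ℕ.∸ length bt ≡ 0 → a ≈ 0#
    a≈0 k≡0 = ≃-trans a≈ (≃-trans (+-cong (*-congˡ (reflexive (≡.cong highFirst (empty D.quotient (≡.trans D.length≡ k≡0))))) R≈0)
      (≃-trans (+-identityʳ _) (zeroʳ p)))
    a≉0 : ¬ (a ≈ 0#)
    a≉0 z = 1≢0 (≡.trans (≡.sym (proj₁ (Monic-coeff ma))) (≡.trans (_≃_.coeff≡ z n) (coeff-0 n)))
    led : Σ (List ℤ) λ ys → D.quotient ≡ 1ℤ ∷ ys
    led = D.leading ≡.refl λ k≡0 → a≉0 (a≈0 k≡0)

-- The cyclotomic recursion, the factorisation of `q ^ n - 1`, and coprimality.

mutual
  lastOf : List (ℕ × Poly) → Poly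
  lastOf = _

  Φ-lastOf : ∀ n → Φ n ≡ lastOf (cycTable n)
  Φ-lastOf n with cycTable n
  ... | _ = ≡.refl

lastOf-∷ʳ : ∀ es e → lastOf (es ++ e ∷ []) ≡ proj₂ e
lastOf-∷ʳ []            e = ≡.refl
lastOf-∷ʳ (_ ∷ [])      e = ≡.refl
lastOf-∷ʳ (_ ∷ e′ ∷ es) e = lastOf-∷ʳ (e′ ∷ es) e

properProduct : ℕ → ℕ → Poly
properProduct n m = prodP (map proj₂ (filter (λ e → proj₁ e ∣? n) (cycTable m)))

Φ-suc : ∀ m → Φ (suc m) ≡ divMonic (X^ (suc m) ⊖ oneP) (properProduct (suc m) m)
Φ-suc m = ≡.trans (Φ-lastOf (suc m)) (lastOf-∷ʳ (cycTable m) _)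

cycTable-suc : ∀ m → cycTable (suc m) ≡ cycTable m ++ (suc m , Φ (suc m)) ∷ []
cycTable-suc m = ≡.cong (λ p → cycTable m ++ (suc m , p) ∷ []) (≡.sym (Φ-suc m))

choose : ∀ {A : Set} → Dec A → Poly → Poly → Poly
choose d p r = if does d then p else r

choose-yes : ∀ {A : Set} (d : Dec A) {p r} → A → choose d p r ≡ p
choose-yes (yes _) a = ≡.refl
choose-yes (no ¬a) a = contradiction a ¬a

choose-elim : ∀ {A : Set} (d : Dec A) {p r} (P : Poly → Set) → (A → P p) → (¬ A → P r) → P (choose d p r)
choose-elim (yes a) P y n = y a
choose-elim (no ¬a) P y n = n ¬a

-- Padding with `1#` at non-divisors turns products over divisors into products over an initial
-- segment.
Φ∣ : ℕ → ℕ → Poly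
Φ∣ n k = choose (suc k ∣? n) (Φ (suc k)) 1#

Φ∣-divisor : ∀ {n k} → suc k ∣ n → Φ∣ n k ≡ Φ (suc k)
Φ∣-divisor {n} {k} = choose-yes (suc k ∣? n)

Φ∣-elim : ∀ n k (P : Poly → Set) → (suc k ∣ n → P (Φ (suc k))) → P 1# → P (Φ∣ n k)
Φ∣-elim n k P y n′ = choose-elim (suc k ∣? n) P y λ _ → n′

prodP-++ : ∀ ps rs → prodP (ps ++ rs) ≈ prodP ps * prodP rs
prodP-++ []       rs = ≃-sym (≃-trans (*-congʳ (reflexive (≡.sym 1≡oneP))) (*-identityˡ _))
prodP-++ (p ∷ ps) rs = begin
  p ⊗ prodP (ps ++ rs) ≡⟨ *≡⊗ p _ ⟨
  p * prodP (ps ++ rs) ≈⟨ *-congˡ (prodP-++ ps rs) ⟩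
  p * (prodP ps * prodP rs) ≈⟨ *-assoc p _ _ ⟨
  p * prodP ps * prodP rs ≡⟨ ≡.cong (_* prodP rs) (*≡⊗ p _) ⟩
  (p ⊗ prodP ps) * prodP rs ∎

prodP-[-] : ∀ p → prodP (p ∷ []) ≈ p
prodP-[-] p = ≃-trans (reflexive (≡.sym (≡.trans (≡.cong (p *_) 1≡oneP) (*≡⊗ p oneP)))) (*-identityʳ p)

properProduct≈∏ : ∀ n m → properProduct n m ≈ ∏ m (Φ∣ n)
properProduct≈∏ n zero    = reflexive (≡.sym 1≡oneP)
properProduct≈∏ n (suc m) = begin
  properProduct n (suc m) ≡⟨ ≡.cong (λ t → prodP (map proj₂ (filter (λ e → proj₁ e ∣? n) t))) (cycTable-suc m) ⟩
  prodP (map proj₂ (filter (λ e → proj₁ e ∣? n) (cycTable m ++ (suc m , Φ (suc m)) ∷ [])))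
    ≡⟨ ≡.cong (λ t → prodP (map proj₂ t)) (List.filter-++ (λ e → proj₁ e ∣? n) (cycTable m) _) ⟩
  prodP (map proj₂ (filter (λ e → proj₁ e ∣? n) (cycTable m) ++ last))
    ≡⟨ ≡.cong prodP (List.map-++ proj₂ (filter (λ e → proj₁ e ∣? n) (cycTable m)) last) ⟩
  prodP (map proj₂ (filter (λ e → proj₁ e ∣? n) (cycTable m)) ++ map proj₂ last)
    ≈⟨ prodP-++ (map proj₂ (filter (λ e → proj₁ e ∣? n) (cycTable m))) _ ⟩
  properProduct n m * prodP (map proj₂ last) ≈⟨ *-cong (properProduct≈∏ n m) last≈ ⟩
  ∏ (suc m) (Φ∣ n) ∎
  where
  last : List (ℕ × Poly)
  last = filter (λ e → proj₁ e ∣? n) ((suc m , Φ (suc m)) ∷ [])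
  last≈ : prodP (map proj₂ last) ≈ Φ∣ n m
  last≈ = choose-elim (suc m ∣? n) (λ p → prodP (map proj₂ last) ≈ p)
    (λ d → ≃-trans (reflexive (≡.cong (λ t → prodP (map proj₂ t)) (List.filter-accept (λ e → proj₁ e ∣? n) d))) (prodP-[-] (Φ (suc m))))
    (λ ¬d → ≃-trans (reflexive (≡.cong (λ t → prodP (map proj₂ t)) (List.filter-reject (λ e → proj₁ e ∣? n) ¬d))) (reflexive (≡.sym 1≡oneP)))

MonicSome : Poly → Set
MonicSome p = ∃ λ d → Monic d p

Monic-prodP : ∀ {es : List (ℕ × Poly)} → All (λ e → MonicSome (proj₂ e)) es → MonicSome (prodP (map proj₂ es))
Monic-prodP All.[]             = 0 , monic [] ≡.refl ≡.refl
Monic-prodP ((_ , m) All.∷ ms) = _ , Monic-⊗ m (proj₂ (Monic-prodP ms))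

Monic-properProduct : ∀ n m → (∀ k → k < m → MonicSome (Φ (suc k))) → MonicSome (properProduct n m)
Monic-properProduct n m h = Monic-prodP (All.filter⁺ (λ e → proj₁ e ∣? n) (all m h))
  where
  all : ∀ m → (∀ k → k < m → MonicSome (Φ (suc k))) → All (λ e → MonicSome (proj₂ e)) (cycTable m)
  all zero    h = All.[]
  all (suc m) h = ≡.subst (All _) (≡.sym (cycTable-suc m)) (All.++⁺ (all m λ k k<m → h k (ℕ.m<n⇒m<1+n k<m)) (h m ℕ.≤-refl All.∷ All.[]))

Monic-1-q^ : ∀ m → Monic (suc m) (X^ (suc m) ⊖ oneP)
Monic-1-q^ m = monic (ℤ.-1ℤ ∷ replicate m 0ℤ) (≡.cong (ℤ.-1ℤ ∷_) (⊕-[]-identityʳ (X^ m))) (≡.cong suc (List.length-replicate m))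

q^-1≈ : ∀ m → X^ m ⊖ oneP ≈ q ^ m - 1#
q^-1≈ m = ≃-trans (reflexive (≡.trans (≡.sym (-≡⊖ (X^ m) oneP)) (≡.cong (λ o → X^ m - o) (≡.sym 1≡oneP)))) (+-congʳ (X^≈q^ m))

record Factorises (n : ℕ) : Set where
  constructor factorises
  field factorisation : ∏ n (Φ∣ n) ≈ q ^ n - 1#

binomial : ∀ y t → ∃ λ W → (1# + y) ^ t ≈ 1# + y * (constP (+ t) + y * W)
binomial y zero    = 0# , ≃-sym (≃-trans (+-congˡ (*-congˡ (+-congʳ constP-0))) (solve 1 (λ y → con (+ 1) :+ y :* (con (+ 0) :+ y :* con (+ 0)) := con (+ 1)) ≃-refl y))
  where
  constP-0 : constP 0ℤ ≈ 0#
  constP-0 = ⌊ (λ { zero → ≡.sym (coeff-0 0) ; (suc i) → ≡.sym (coeff-0 (suc i)) }) ⌋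
binomial y (suc t) with binomial y t
... | W , e = constP (+ t) + W + y * W , (begin
  (1# + y) * (1# + y) ^ t ≈⟨ *-congˡ e ⟩
  (1# + y) * (1# + y * (constP (+ t) + y * W))
    ≈⟨ solve 3 (λ y t W → let one = con (+ 1) in (one :+ y) :* (one :+ y :* (t :+ y :* W)) := one :+ y :* ((one :+ t) :+ y :* (t :+ W :+ y :* W))) ≃-refl y (constP (+ t)) W ⟩
  1# + y * ((1# + constP (+ t)) + y * (constP (+ t) + W + y * W))
    ≈⟨ +-congˡ (*-congˡ (+-congʳ (≃-trans (+-congʳ (≃-sym constP-1)) (constP-+ 1ℤ (+ t))))) ⟩
  1# + y * (constP (+ suc t) + y * (constP (+ t) + W + y * W)) ∎)

-- Expand `(1 + y) ^ t` for `y = q ^ g - 1`. The quotient by `y` is the integer `t` modulo `y`;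
-- keeping `W` explicit makes this a Bézout identity.
q^-1-* : ∀ g t → ∃ λ W → q ^ (t ℕ.* g) - 1# ≈ (q ^ g - 1#) * (constP (+ t) + (q ^ g - 1#) * W)
q^-1-* g t with binomial (q ^ g - 1#) t
... | W , e = W , (begin
  q ^ (t ℕ.* g) - 1# ≈⟨ +-congʳ (≃-trans (reflexive (≡.cong (q ^_) (ℕ.*-comm t g))) (≃-trans (≃-sym (^-assocʳ q g t))
      (^-congˡ t (solve 1 (λ a → a := con (+ 1) :+ (a :- con (+ 1))) ≃-refl (q ^ g))))) ⟩
  (1# + (q ^ g - 1#)) ^ t - 1# ≈⟨ +-congʳ e ⟩
  1# + (q ^ g - 1#) * (constP (+ t) + (q ^ g - 1#) * W) - 1# ≈⟨ solve 1 (λ a → con (+ 1) :+ a :- con (+ 1) := a) ≃-refl _ ⟩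
  (q ^ g - 1#) * (constP (+ t) + (q ^ g - 1#) * W) ∎)

q^-1-∣ : ∀ {d n} → d ∣ n → q ^ d - 1# ∣ᵖ q ^ n - 1#
q^-1-∣ {d} (ℕ∣.divides t ≡.refl) = ∣ᵖ-multiple _ (proj₂ (q^-1-* d t))

regular-q^-1 : ∀ k → Regular (q ^ suc k - 1#)
regular-q^-1 k b e = regular-1-q^ k b (begin
  (1# - q ^ suc k) * b ≈⟨ solve 2 (λ a b → (con (+ 1) :- a) :* b := :- ((a :- con (+ 1)) :* b)) ≃-refl (q ^ suc k) b ⟩
  - ((q ^ suc k - 1#) * b) ≈⟨ ≃-trans (-‿cong e) -0#≈0# ⟩
  0# ∎)

Φ∣-extract : ∀ {m} → Factorises (suc m) → q ^ suc m - 1# ≈ ∏ m (Φ∣ (suc m)) * Φ (suc m)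
Φ∣-extract {m} (factorises f) = ≃-trans (≃-sym f) (*-congˡ (reflexive (Φ∣-divisor {suc m} {m} ℕ∣.∣-refl)))

Φ∣ᵖq^-1 : ∀ {m} → Factorises (suc m) → Φ (suc m) ∣ᵖ q ^ suc m - 1#
Φ∣ᵖq^-1 f = ∣ᵖ-multiple _ (≃-trans (Φ∣-extract f) (*-comm _ _))

-- For a proper divisor g of d, Φ_d divides (q^d - 1) / (q^g - 1), which is ≡ d / g modulo q^g - 1.
Φ-coprime-divisor : ∀ {m h} → let d = suc m ; g = suc h in Factorises d → Factorises g → g ∣ d → g < d → Coprimeᵖ (Φ d) (q ^ g - 1#)
Φ-coprime-divisor {m} {h} fd fg g∣d@(ℕ∣.divides t d≡tg) g<d =
  Coprimeᵖ-sym (∣ᵖ-coprime (∣ᵖ-multiple Z Ψ≈) (Coprimeᵖ-sym (bezout t≢0 1# (- W) (begin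
    1# * Ψ + - W * y ≈⟨ solve 3 (λ t W y → con (+ 1) :* (t :+ y :* W) :+ (:- W) :* y := t) ≃-refl (constP (+ t)) W y ⟩
    constP (+ t) ∎))))
  where
  d g : ℕ
  d = suc m
  g = suc h
  y W Ψ : Poly
  y = q ^ g - 1#
  W = proj₁ (q^-1-* g t)
  Ψ = constP (+ t) + y * W
  t≢0 : + t ≢ 0ℤ
  t≢0 e = ℕ.1+n≢0 (≡.trans d≡tg (≡.cong (ℕ._* g) (ℤ.+-injective e)))
  rest : ℕ → Poly
  rest k = choose (suc k ∣? g) 1# (Φ∣ d k)
  split : ∀ k → Φ∣ d k ≈ Φ∣ g k * rest k
  split k = split-by (suc k ∣? g)
    where
    split-by : (δ : Dec (suc k ∣ g)) → Φ∣ d k ≈ choose δ (Φ (suc k)) 1# * choose δ 1# (Φ∣ d k)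
    split-by (yes k∣g) = ≃-trans (reflexive (Φ∣-divisor {d} {k} (ℕ∣.∣-trans k∣g g∣d))) (≃-sym (*-identityʳ _))
    split-by (no _)    = ≃-sym (*-identityˡ _)
  k : ℕ
  k = m ℕ.∸ g
  Z : Poly
  Z = ∏ g rest * ∏ k (λ i → Φ∣ d (g ℕ.+ i))
  below : ∏ m (Φ∣ d) ≈ y * Z
  below = begin
    ∏ m (Φ∣ d) ≡⟨ ≡.cong (λ j → ∏ j (Φ∣ d)) (≡.sym (ℕ.m+[n∸m]≡n (ℕ.≤-pred g<d))) ⟩
    ∏ (g ℕ.+ k) (Φ∣ d) ≈⟨ ∏-+ g k (Φ∣ d) ⟩
    ∏ g (Φ∣ d) * ∏ k (λ i → Φ∣ d (g ℕ.+ i)) ≈⟨ *-congʳ (≃-trans (∏-cong g λ i _ → split i) (∏-* g (Φ∣ g) rest)) ⟩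
    ∏ g (Φ∣ g) * ∏ g rest * ∏ k (λ i → Φ∣ d (g ℕ.+ i)) ≈⟨ *-assoc _ _ _ ⟩
    ∏ g (Φ∣ g) * Z ≈⟨ *-congʳ (Factorises.factorisation fg) ⟩
    y * Z ∎
  Ψ≈ : Ψ ≈ Φ d * Z
  Ψ≈ = Regular-cancel (regular-q^-1 h) (begin
    y * Ψ ≈⟨ proj₂ (q^-1-* g t) ⟨
    q ^ (t ℕ.* g) - 1# ≡⟨ ≡.cong (λ j → q ^ j - 1#) (≡.sym d≡tg) ⟩
    q ^ d - 1# ≈⟨ Φ∣-extract fd ⟩
    ∏ m (Φ∣ d) * Φ d ≈⟨ *-congʳ below ⟩
    y * Z * Φ d ≈⟨ solve 3 (λ y z p → y :* z :* p := y :* (p :* z)) ≃-refl y Z (Φ d) ⟩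
    y * (Φ d * Z) ∎)

-- Modulo `P`, `Y * C` is a multiple of `X`, so a Bézout identity for `Y * C` and `P` becomes one
-- for `X` and `P`.
Coprimeᵖ-linear : ∀ {P Y X A B C} → Coprimeᵖ P Y → Y * C ≈ X * A + P * B → Coprimeᵖ P C → Coprimeᵖ P X
Coprimeᵖ-linear {P} {Y} {X} {A} {B} {C} c e c′ = combine (Coprimeᵖ-*ʳ c c′)
  where
  combine : Coprimeᵖ P (Y * C) → Coprimeᵖ P X
  combine (bezout {k} n U V eq) = bezout n (U + V * B) (V * A) (begin
    (U + V * B) * P + V * A * X ≈⟨ solve 6 (λ u v a b p x → (u :+ v :* b) :* p :+ v :* a :* x := u :* p :+ v :* (x :* a :+ p :* b)) ≃-refl U V A B P X ⟩
    U * P + V * (X * A + P * B) ≈⟨ +-congˡ (*-congˡ e) ⟨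
    U * P + V * (Y * C) ≈⟨ eq ⟩
    constP k ∎)

-- For `g = gcd d e`, Bézout on the exponents writes `q ^ g - 1` as a combination of `q ^ e - 1` and
-- `Φ d`. As `g` is a proper divisor of `d`, `Φ-coprime-divisor` applies to it.
Coprimeᵖ-q^-1 : ∀ {m} e → let d = suc m in (∀ k → k ≤ m → Factorises (suc k)) → ¬ (d ∣ e) → Coprimeᵖ (Φ d) (q ^ e - 1#)
Coprimeᵖ-q^-1 {m} e f d∤e with gcd (suc m) e in g≡ | GCD.gcd-GCD (suc m) e
... | zero | G = contradiction (GCD.GCD.gcd∣m G) λ z → ℕ.1+n≢0 (ℕ∣.0∣⇒≡0 z)
... | suc h | G = Coprimeᵖ-linear′ (GCD.Bézout.identity G)
  where
  d g : ℕ
  d = suc m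
  g = suc h
  g∣d : g ∣ d
  g∣d = GCD.GCD.gcd∣m G
  g<d : g < d
  g<d = ℕ.≤∧≢⇒< (ℕ∣.∣⇒≤ g∣d) λ g≡d → d∤e (≡.subst (_∣ e) g≡d (GCD.GCD.gcd∣n G))
  coprime-g : Coprimeᵖ (Φ d) (q ^ g - 1#)
  coprime-g = Φ-coprime-divisor (f m ℕ.≤-refl) (f h (ℕ.≤-trans (ℕ.n≤1+n h) (ℕ.≤-pred g<d))) g∣d g<d
  multiple : ∀ b → ∃ λ B → q ^ (b ℕ.* d) - 1# ≈ Φ d * B
  multiple b = _ , ≃-trans (proj₂ (q^-1-* d b)) (≃-trans (*-congʳ (≃-trans (Φ∣-extract (f m ℕ.≤-refl)) (*-comm _ _))) (*-assoc _ _ _))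
  Coprimeᵖ-linear′ : GCD.Bézout.Identity g d e → Coprimeᵖ (Φ d) (q ^ e - 1#)
  Coprimeᵖ-linear′ (GCD.Bézout.+- b a eq) = Coprimeᵖ-linear {A = - (q ^ g * A)} {B = B} {C = 1#} coprime-g (begin
      (q ^ g - 1#) * 1# ≈⟨ solve 2 (λ u v → (u :- con (+ 1)) :* con (+ 1) := :- (u :* (v :- con (+ 1))) :+ (u :* v :- con (+ 1))) ≃-refl (q ^ g) (q ^ (a ℕ.* e)) ⟩
      - (q ^ g * (q ^ (a ℕ.* e) - 1#)) + (q ^ g * q ^ (a ℕ.* e) - 1#)
        ≈⟨ +-cong (-‿cong (*-congˡ (proj₂ (q^-1-* e a)))) (+-congʳ (≃-trans (≃-sym (^-homo-* q g (a ℕ.* e))) (reflexive (≡.cong (q ^_) eq)))) ⟩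
      - (q ^ g * ((q ^ e - 1#) * A)) + (q ^ (b ℕ.* d) - 1#)
        ≈⟨ +-cong (solve 3 (λ u x a → :- (u :* (x :* a)) := x :* (:- (u :* a))) ≃-refl (q ^ g) (q ^ e - 1#) A) (proj₂ (multiple b)) ⟩
      (q ^ e - 1#) * - (q ^ g * A) + Φ d * B ∎) (Coprimeᵖ-sym Coprimeᵖ-1)
    where
    A B : Poly
    A = constP (+ a) + (q ^ e - 1#) * proj₁ (q^-1-* e a)
    B = proj₁ (multiple b)
  Coprimeᵖ-linear′ (GCD.Bézout.-+ b a eq) = Coprimeᵖ-linear {A = A} {B = - (q ^ g * B)} {C = 1#} coprime-g (begin
      (q ^ g - 1#) * 1# ≈⟨ solve 2 (λ u v → (u :- con (+ 1)) :* con (+ 1) := (u :* v :- con (+ 1)) :- (u :* (v :- con (+ 1)))) ≃-refl (q ^ g) (q ^ (b ℕ.* d)) ⟩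
      (q ^ g * q ^ (b ℕ.* d) - 1#) - q ^ g * (q ^ (b ℕ.* d) - 1#)
        ≈⟨ +-cong (≃-trans (+-congʳ (≃-trans (≃-sym (^-homo-* q g (b ℕ.* d))) (reflexive (≡.cong (q ^_) eq)))) (proj₂ (q^-1-* e a)))
             (≃-trans (-‿cong (*-congˡ (proj₂ (multiple b)))) (solve 3 (λ u p b → :- (u :* (p :* b)) := p :* (:- (u :* b))) ≃-refl (q ^ g) (Φ d) B)) ⟩
      (q ^ e - 1#) * A + Φ d * - (q ^ g * B) ∎) (Coprimeᵖ-sym Coprimeᵖ-1)
    where
    A B : Poly
    A = constP (+ a) + (q ^ e - 1#) * proj₁ (q^-1-* e a)
    B = proj₁ (multiple b)

Coprimeᵖ-Φ∣ : ∀ {n m k} → (∀ k → k ≤ m → Factorises (suc k)) → k < m → Coprimeᵖ (Φ∣ n k) (Φ (suc m))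
Coprimeᵖ-Φ∣ {n} {m} {k} f k<m = Φ∣-elim n k (λ p → Coprimeᵖ p (Φ (suc m)))
  (λ _ → Coprimeᵖ-sym (∣ᵖ-coprime (Φ∣ᵖq^-1 (f k (ℕ.<⇒≤ k<m))) (Coprimeᵖ-q^-1 (suc k) f λ d → ℕ.<⇒≱ (s≤s k<m) (ℕ∣.∣⇒≤ d))))
  Coprimeᵖ-1

product-∣ᵖ : ∀ {n A} m → (∀ k → k < m → Factorises (suc k)) → (∀ k → k < m → Φ∣ n k ∣ᵖ A) → ∏ m (Φ∣ n) ∣ᵖ A
product-∣ᵖ     zero    f h = ∣ᵖ-multiple _ (≃-sym (*-identityˡ _))
product-∣ᵖ {n} (suc m) f h = coprime-product-∣ᵖ coprime (product-∣ᵖ {n} m (λ k k<m → f k (ℕ.m<n⇒m<1+n k<m)) (λ k k<m → h k (ℕ.m<n⇒m<1+n k<m))) (h m ℕ.≤-refl)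
  where
  coprime : Coprimeᵖ (∏ m (Φ∣ n)) (Φ∣ n m)
  coprime = Φ∣-elim n m (Coprimeᵖ _) (λ _ → Coprimeᵖ-∏ m λ k k<m → Coprimeᵖ-Φ∣ {n} (λ j j≤m → f j (s≤s j≤m)) k<m)
    (Coprimeᵖ-sym Coprimeᵖ-1)

-- One induction for both facts: `divMonic-exact` asks for a monic divisor, hence for earlier Φ to
-- be monic, and for divisibility, which rests on their factorisations.
cyclotomic : ∀ m → Factorises (suc m) × MonicSome (Φ (suc m))
cyclotomic = <-rec _ step
  where
  step : ∀ m → (∀ {k} → k < m → Factorises (suc k) × MonicSome (Φ (suc k))) → Factorises (suc m) × MonicSome (Φ (suc m))
  step m ih = factorises (begin
      ∏ m (Φ∣ n) * Φ∣ n m ≈⟨ *-cong (≃-sym (properProduct≈∏ n m)) (reflexive (≡.trans (Φ∣-divisor {n} {m} ℕ∣.∣-refl) (Φ-suc m))) ⟩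
      properProduct n m * divMonic (X^ n ⊖ oneP) (properProduct n m) ≈⟨ proj₁ exact ⟩
      X^ n ⊖ oneP ≈⟨ q^-1≈ n ⟩
      q ^ n - 1# ∎)
    , ≡.subst MonicSome (≡.sym (Φ-suc m)) (proj₂ exact)
    where
    n : ℕ
    n = suc m
    Π∣ : properProduct n m ∣ᵖ X^ n ⊖ oneP
    Π∣ = ∣ᵖ-resp (≃-sym (q^-1≈ n)) (∣ᵖ-respˡ (≃-sym (properProduct≈∏ n m)) (product-∣ᵖ {n} m (λ k k<m → proj₁ (ih k<m)) divides-each))
      where
      divides-each : ∀ k → k < m → Φ∣ n k ∣ᵖ q ^ n - 1#
      divides-each k k<m = Φ∣-elim n k (_∣ᵖ q ^ n - 1#) (λ k∣n → ∣ᵖ-trans (Φ∣ᵖq^-1 (proj₁ (ih k<m))) (q^-1-∣ k∣n))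
        (∣ᵖ-multiple _ (≃-sym (*-identityˡ _)))
    exact : properProduct n m * divMonic (X^ n ⊖ oneP) (properProduct n m) ≈ X^ n ⊖ oneP × MonicSome (divMonic (X^ n ⊖ oneP) (properProduct n m))
    exact = divMonic-exact (proj₂ (Monic-properProduct n m λ k k<m → proj₂ (ih k<m))) (Monic-1-q^ m) Π∣

-- Integrality of the terms

module Integrality (P : Poly) where
  open ℤq hiding (trans; sym; refl)

  -- The fraction A / B lies in the localisation of ℤ[q] at the polynomials coprime to P.
  record Integral (A B : Poly) : Set where
    constructor integral
    field
      {denominator} : Poly
      coprime   : Coprimeᵖ denominator P
      numerator : Poly
      equation  : denominator * A ≈ numerator * B

  Integral-refl : ∀ {A} → Integral A A
  Integral-refl = integral Coprimeᵖ-1 1# ≃-refl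

  Integral-* : ∀ {A B C D} → Integral A B → Integral C D → Integral (A * C) (B * D)
  Integral-* {A} {B} {C} {D} (integral {ω} c z e) (integral {ω′} c′ z′ e′) = integral (Coprimeᵖ-* c c′) (z * z′)
    (≃-trans (*-interchange ω ω′ A C) (≃-trans (*-cong e e′) (*-interchange z B z′ D)))

  Integral-resp : ∀ {A B C D} → A ≈ C → B ≈ D → Integral A B → Integral C D
  Integral-resp p r (integral c z e) = integral c z (≃-trans (*-congˡ (≃-sym p)) (≃-trans e (*-congˡ r)))

  Integral-trans : ∀ {A B C} → Integral A B → Integral B C → Integral A C
  Integral-trans {A} {B} {C} (integral {ω} c z e) (integral {ω′} c′ z′ e′) = integral (Coprimeᵖ-* c′ c) (z * z′) (begin
    ω′ * ω * A ≈⟨ *-assoc ω′ ω A ⟩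
    ω′ * (ω * A) ≈⟨ *-congˡ e ⟩
    ω′ * (z * B) ≈⟨ solve 3 (λ a b c → a :* (b :* c) := b :* (a :* c)) ≃-refl ω′ z B ⟩
    z * (ω′ * B) ≈⟨ *-congˡ e′ ⟩
    z * (z′ * C) ≈⟨ *-assoc z z′ C ⟨
    z * z′ * C ∎)

  module _ (p x : Poly) where
    open Vandermonde ℤ[q] p

    -- The q-Vandermonde sum for (x²; p)_k has the extreme terms (x; p)_k and (x; p)_k x^k; by induction all
    -- the others are integral multiples of (p; p)_k, so that (1 + x^k) (x; p)_k is one as well.
    Integral-pochhammer : (∀ k → Coprimeᵖ (1# + x ^ suc k) P) → (∀ k → Integral (pochhammer (x * x) k) (pochhammer p k)) →
      ∀ k → Integral (pochhammer x k) (pochhammer p k)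
    Integral-pochhammer 1+x^ square = <-rec _ step
      where
      step : ∀ k → (∀ {j} → j < k → Integral (pochhammer x j) (pochhammer p j)) → Integral (pochhammer x k) (pochhammer p k)
      step zero    ih = Integral-refl
      step (suc k) ih with inner k 0 ≡.refl
        where
        -- The diagonal without its first summand. Its last summand is `pochhammer x (suc k)`; in
        -- every other one `gauss` combines two shorter, already integral quotients into a multiple
        -- of `pochhammer p (suc k)`.
        inner : ∀ j i → i ℕ.+ j ≡ k → ∃ λ ω → ∃ λ z → Coprimeᵖ ω P × ω * diagonal (summand x x) (suc i) j ≈ z * pochhammer p (suc k) + ω * pochhammer x (suc k)
        inner zero i e = 1# , 0# , Coprimeᵖ-1 , (begin
          1# * (1# * (pochhammer x (suc i) * 1# * 1#)) ≡⟨ ≡.cong (λ l → 1# * (1# * (pochhammer x (suc l) * 1# * 1#))) (≡.trans (≡.sym (ℕ.+-identityʳ i)) e) ⟩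
          1# * (1# * (pochhammer x (suc k) * 1# * 1#))
            ≈⟨ solve 2 (λ a b → let one = con (+ 1) in one :* (one :* (a :* one :* one)) := con (+ 0) :* b :+ one :* a) ≃-refl (pochhammer x (suc k)) (pochhammer p (suc k)) ⟩
          0# * pochhammer p (suc k) + 1# * pochhammer x (suc k) ∎)
        inner (suc j) i e with inner j (suc i) (≡.trans (≡.sym (ℕ.+-suc i j)) e)
          | ih {suc i} (s≤s (ℕ.≤-trans (ℕ.m≤m+n (suc i) j) (ℕ.≤-reflexive (≡.trans (≡.sym (ℕ.+-suc i j)) e))))
          | ih {suc j} (s≤s (ℕ.≤-trans (ℕ.m≤n+m (suc j) i) (ℕ.≤-reflexive e)))
        ... | ω , z , c , f | integral {ω₁} c₁ z₁ f₁ | integral {ω₂} c₂ z₂ f₂ =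
          ω₁ * ω₂ * ω , ω * (z₁ * z₂ * x ^ suc j) + ω₁ * ω₂ * z , Coprimeᵖ-* (Coprimeᵖ-* c₁ c₂) c , (begin
          ω₁ * ω₂ * ω * (g * (X * Y * u) + d)
            ≈⟨ solve 8 (λ a b w g X Y u d → a :* b :* w :* (g :* (X :* Y :* u) :+ d) := w :* g :* u :* ((a :* X) :* (b :* Y)) :+ a :* b :* (w :* d)) ≃-refl ω₁ ω₂ ω g X Y u d ⟩
          ω * g * u * ((ω₁ * X) * (ω₂ * Y)) + ω₁ * ω₂ * (ω * d) ≈⟨ +-cong (*-congˡ (*-cong f₁ f₂)) (*-congˡ f) ⟩
          ω * g * u * ((z₁ * X′) * (z₂ * Y′)) + ω₁ * ω₂ * (z * pochhammer p (suc k) + ω * pochhammer x (suc k))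
            ≈⟨ +-congʳ (solve 7 (λ w g u y X z Y → w :* g :* u :* ((y :* X) :* (z :* Y)) := w :* (y :* z :* u) :* (g :* (X :* Y))) ≃-refl ω g u z₁ X′ z₂ Y′) ⟩
          ω * (z₁ * z₂ * u) * (g * (X′ * Y′)) + ω₁ * ω₂ * (z * pochhammer p (suc k) + ω * pochhammer x (suc k))
            ≈⟨ +-congʳ (*-congˡ (≃-trans (gauss-pochhammer (suc i) (suc j)) (reflexive (≡.cong (λ l → pochhammer p (suc l)) e)))) ⟩
          ω * (z₁ * z₂ * u) * pochhammer p (suc k) + ω₁ * ω₂ * (z * pochhammer p (suc k) + ω * pochhammer x (suc k))
            ≈⟨ solve 6 (λ s b z P w A → s :* P :+ b :* (z :* P :+ w :* A) := (s :+ b :* z) :* P :+ b :* w :* A) ≃-refl (ω * (z₁ * z₂ * u)) (ω₁ * ω₂) z (pochhammer p (suc k)) ω (pochhammer x (suc k)) ⟩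
          (ω * (z₁ * z₂ * u) + ω₁ * ω₂ * z) * pochhammer p (suc k) + ω₁ * ω₂ * ω * pochhammer x (suc k) ∎)
          where
          g = gauss (suc i) (suc j)
          X = pochhammer x (suc i)
          Y = pochhammer x (suc j)
          X′ = pochhammer p (suc i)
          Y′ = pochhammer p (suc j)
          u = x ^ suc j
          d = diagonal (summand x x) (suc (suc i)) j
      ... | ω , z , c , f with square (suc k)
      -- The two extreme summands add up to `(1 + x ^ suc k) * pochhammer x (suc k)`; the coprime
      -- first factor joins the denominator.
      ... | integral {ω₀} c₀ z₀ f₀ = integral (Coprimeᵖ-* (Coprimeᵖ-* c c₀) (1+x^ k)) (ω * z₀ - ω₀ * z) (begin
        ω * ω₀ * (1# + u) * A
          ≈⟨ solve 6 (λ w o u A d B → w :* o :* (con (+ 1) :+ u) :* A := o :* (w :* (con (+ 1) :* (con (+ 1) :* A :* u) :+ d)) :- o :* (w :* d) :+ o :* w :* A) ≃-refl ω ω₀ u A d B ⟩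
        ω₀ * (ω * (1# * (1# * A * u) + d)) - ω₀ * (ω * d) + ω₀ * ω * A
          ≈⟨ +-congʳ (+-cong (*-congˡ (*-congˡ (vandermonde x x (suc k)))) (-‿cong (*-congˡ f))) ⟩
        ω₀ * (ω * T) - ω₀ * (z * B + ω * A) + ω₀ * ω * A
          ≈⟨ solve 6 (λ o w T z B A → o :* (w :* T) :- o :* (z :* B :+ w :* A) :+ o :* w :* A := w :* (o :* T) :- o :* z :* B) ≃-refl ω₀ ω T z B A ⟩
        ω * (ω₀ * T) - ω₀ * z * B ≈⟨ +-congʳ (*-congˡ f₀) ⟩
        ω * (z₀ * B) - ω₀ * z * B ≈⟨ solve 5 (λ w y o z B → w :* (y :* B) :- o :* z :* B := (w :* y :- o :* z) :* B) ≃-refl ω z₀ ω₀ z B ⟩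
        (ω * z₀ - ω₀ * z) * B ∎)
        where
        u = x ^ suc k
        A = pochhammer x (suc k)
        B = pochhammer p (suc k)
        T = pochhammer (x * x) (suc k)
        d = diagonal (summand x x) 1 k

-- 1 + y divides 1 + y^n for odd n, and 1 + q^{jn} ≡ 2 modulo q^n - 1.
Coprimeᵖ-1+q^ : ∀ r j → let n = suc (2 ℕ.* r) in Coprimeᵖ (ℤq._+_ ℤq.1# (q ℤq.^ j)) (q ℤq.^ n ℤq.- ℤq.1#)
Coprimeᵖ-1+q^ r j = bezout (λ ()) (proj₁ (odd r)) (- W) (begin
  proj₁ (odd r) * (1# + y) + - W * (q ^ n - 1#) ≈⟨ +-congʳ (≃-trans (*-comm _ _) (≃-sym (proj₂ (odd r)))) ⟩
  1# + y ^ n + - W * (q ^ n - 1#) ≈⟨ +-congʳ (+-congˡ (≃-trans (^-assocʳ q j n) (solve 1 (λ a → a := con (+ 1) :+ (a :- con (+ 1))) ≃-refl _))) ⟩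
  1# + (1# + (q ^ (j ℕ.* n) - 1#)) + - W * (q ^ n - 1#) ≈⟨ +-congʳ (+-congˡ (+-congˡ (proj₂ (q^-1-* n j)))) ⟩
  1# + (1# + (q ^ n - 1#) * W) + - W * (q ^ n - 1#) ≈⟨ solve 2 (λ a W → let one = con (+ 1) in one :+ (one :+ a :* W) :+ (:- W) :* a := one :+ one) ≃-refl (q ^ n - 1#) W ⟩
  1# + 1# ≈⟨ ≃-trans (+-cong (≃-sym constP-1) (≃-sym constP-1)) (constP-+ 1ℤ 1ℤ) ⟩
  constP (+ 2) ∎)
  where
  open ℤq hiding (trans; sym; refl)
  n = suc (2 ℕ.* r)
  y = q ^ j
  W = constP (+ j) + (q ^ n - 1#) * proj₁ (q^-1-* n j)
  odd : ∀ r → ∃ λ A → 1# + y ^ suc (2 ℕ.* r) ≈ (1# + y) * A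
  odd zero    = 1# , solve 1 (λ y → con (+ 1) :+ y :* con (+ 1) := (con (+ 1) :+ y) :* con (+ 1)) ≃-refl y
  odd (suc r) with odd r
  ... | A , e = y * y * A + (1# - y) , (begin
    1# + y ^ suc (2 ℕ.* suc r) ≡⟨ ≡.cong (λ k → 1# + y ^ suc k) (ℕ.*-suc 2 r) ⟩
    1# + y * (y * (y ^ suc (2 ℕ.* r))) ≈⟨ solve 2 (λ y z → let one = con (+ 1) in one :+ y :* (y :* z) := y :* y :* (one :+ z) :+ (one :- y :* y)) ≃-refl y _ ⟩
    y * y * (1# + y ^ suc (2 ℕ.* r)) + (1# - y * y) ≈⟨ +-congʳ (*-congˡ e) ⟩
    y * y * ((1# + y) * A) + (1# - y * y) ≈⟨ solve 2 (λ y A → let one = con (+ 1) in y :* y :* ((one :+ y) :* A) :+ (one :- y :* y) := (one :+ y) :* (y :* y :* A :+ (one :- y))) ≃-refl y A ⟩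
    (1# + y) * (y * y * A + (1# - y)) ∎)

-- Vanishing modulo Φ_d and modulo Φ_n⁴

reduce : ∀ P → IsRingHomomorphism (CommutativeRing.rawRing ℤ[q]) (CommutativeRing.rawRing (ℤ[q]/ P)) (λ A → A)
reduce P = Evaluation.mkHom (ℤ[q]/ P) ℤ[q] (λ A → A) ≈⇒∣ᵖ- (λ _ _ → ≈⇒∣ᵖ- ≃-refl) (λ _ _ → ≈⇒∣ᵖ- ≃-refl) (λ _ → ≈⇒∣ᵖ- ≃-refl) (≈⇒∣ᵖ- ≃-refl) (≈⇒∣ᵖ- ≃-refl)

module _ (P s w₀ x₀ h g : Poly) where
  private
    module D = Deformation ℤ[q] q s w₀ x₀ h g
    module D/P = Deformation (ℤ[q]/ P) q s w₀ x₀ h g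
    module E = Extensions (ℤ[q]/ P)
    module E² = Extensions (E.Quadratic g)

  opaque
    unfolding E._+²_ E²._+³_

    -- The quotient keeps the carrier `Poly`, so reduction of coordinates is the identity map and
    -- only the equality changes.
    reduce³ : IsRingHomomorphism (CommutativeRing.rawRing D.R[δ,η]) (CommutativeRing.rawRing D/P.R[δ,η]) (λ a → a)
    reduce³ = Evaluation.mkHom D/P.R[δ,η] D.R[δ,η] (λ a → a)
      (λ ((a Extensions.﹐ b) Extensions.﹐ (c Extensions.﹐ d) ﹐ (e Extensions.﹐ f)) →
        (≈⇒∣ᵖ- a E.﹐ ≈⇒∣ᵖ- b) E².﹐ (≈⇒∣ᵖ- c E.﹐ ≈⇒∣ᵖ- d) ﹐ (≈⇒∣ᵖ- e E.﹐ ≈⇒∣ᵖ- f))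
      (λ _ _ → D/P.R[δ,η].refl) (λ _ _ → D/P.R[δ,η].refl) (λ _ → D/P.R[δ,η].refl) D/P.R[δ,η].refl D/P.R[δ,η].refl

  Ñ₁₁-reduce : ∀ n → P ∣ᵖ D/P.Ñ₁₁ n → P ∣ᵖ D.Ñ₁₁ n
  Ñ₁₁-reduce n P∣ = ∣ᵖ-resp (solve 2 (λ a b → (a :- b) :+ b := a) ≃-refl (D.Ñ₁₁ n) (D/P.Ñ₁₁ n)) (∣ᵖ-+ (E._≈²_.coord₁ (E²._≈³_.coord₁ Ñ≈)) P∣)
    where
    Ñ≈ : D/P.R[δ,η]._≈_ (D.Ñ n) (D/P.Ñ n)
    Ñ≈ = Homomorphic.N-homo reduce³ {D.constant q} {D.constant s} {D.w̃} {D.x̃} D/P.R[δ,η].refl D/P.R[δ,η].refl D/P.R[δ,η].refl D/P.R[δ,η].refl n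

parity : ∀ r → (∃ λ a → r ≡ 2 ℕ.* a) ⊎ (∃ λ a → r ≡ suc (2 ℕ.* a))
parity zero = inj₁ (0 , ≡.refl)
parity (suc r) with parity r
... | inj₁ (a , ≡.refl) = inj₂ (a , ≡.refl)
... | inj₂ (a , ≡.refl) = inj₁ (suc a , ≡.sym (ℕ.*-suc 2 a))

-- The multiple reached is `3 n` if `n = 4 a + 1`, and `n` itself if `n = 4 a + 3`.
i₀-exists : ∀ r → let n = suc (2 ℕ.* r) in ∃ λ i₀ → i₀ < n × n ∣ 3 ℕ.+ 4 ℕ.* i₀
i₀-exists r with parity r
... | inj₁ (a , ≡.refl) = 3 ℕ.* a , s≤s (ℕ.≤-trans (ℕ.m≤m+n (3 ℕ.* a) a) (ℕ.≤-reflexive (ar a))) , ℕ∣.divides 3 (ar′ a)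
  where
  ar : ∀ a → 3 ℕ.* a ℕ.+ a ≡ 2 ℕ.* (2 ℕ.* a)
  ar = solve-∀
  ar′ : ∀ a → 3 ℕ.+ 4 ℕ.* (3 ℕ.* a) ≡ 3 ℕ.* suc (2 ℕ.* (2 ℕ.* a))
  ar′ = solve-∀
... | inj₂ (a , ≡.refl) = a , s≤s (ℕ.≤-trans (ℕ.m≤m+n a (3 ℕ.* a ℕ.+ 2)) (ℕ.≤-reflexive (ar a))) , ℕ∣.divides 1 (ar′ a)
  where
  ar : ∀ a → a ℕ.+ (3 ℕ.* a ℕ.+ 2) ≡ 2 ℕ.* suc (2 ℕ.* a)
  ar = solve-∀
  ar′ : ∀ a → 3 ℕ.+ 4 ℕ.* a ≡ 1 ℕ.* suc (2 ℕ.* suc (2 ℕ.* a))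
  ar′ = solve-∀

factorises-all : ∀ m k → k ≤ m → Factorises (suc k)
factorises-all _ k _ = proj₁ (cyclotomic k)

Coprimeᵖ-1-q^ : ∀ {m e} → ¬ (suc m ∣ e) → Coprimeᵖ (1# - q ^ e) (Φ (suc m))
Coprimeᵖ-1-q^ {m} {e} d∤e = Coprimeᵖ-resp (solve 1 (λ a → (:- con (+ 1)) :* (a :- con (+ 1)) := con (+ 1) :- a) ≃-refl (q ^ e))
  (Coprimeᵖ-* (bezout 1≢0 (- 1#) 0# (≃-trans (solve 1 (λ p → (:- con (+ 1)) :* (:- con (+ 1)) :+ con (+ 0) :* p := con (+ 1)) ≃-refl (Φ (suc m))) (≃-sym constP-1)))
    (Coprimeᵖ-sym (Coprimeᵖ-q^-1 e (factorises-all m) d∤e)))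

-- The hypotheses make `q` behave like a primitive root of unity of odd order `n` modulo `P`. Both
-- Φ_n and the Φ_d of proper divisors are put in for `P`.
module Modulo (r : ℕ) (P : Poly) (P∣q^-1 : P ∣ᵖ q ^ suc (2 ℕ.* r) - 1#)
  (1-q^-coprime : ∀ j → ¬ (suc (2 ℕ.* r) ∣ j) → Coprimeᵖ (1# - q ^ j) P) where

  private
    n : ℕ
    n = suc (2 ℕ.* r)

  module K = ℤq/ P

  ^≈ : ∀ k → q K.^ k K.≈ q ^ k
  ^≈ k = K.sym {q ^ k} (Homomorphic.^-homo {ℤ[q]} {ℤ[q]/ P} (reduce P) q k)

  qⁿ≈1 : q K.^ n K.≈ 1#
  qⁿ≈1 = K.trans (^≈ n) P∣q^-1

  regular : ∀ j → ¬ (n ∣ j) → K.Regular (1# K.- q K.^ j)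
  regular j n∤j = K.Regular-resp (K.+-congˡ (K.-‿cong (K.sym (^≈ j)))) (coprime⇒regular (1-q^-coprime j n∤j))

  module _ (s w₀ x₀ h g : Poly) (h≈0 : h K.≈ 0#) (g≈0 : g K.≈ 0#) (w₀≈2s : w₀ K.≈ s K.+ s) (x₀≈1 : x₀ K.≈ 1#) (s-reg : K.Regular s) where
    private module D = Deformation (ℤ[q]/ P) q s w₀ x₀ h g

    N≈0 : K.Series.N q s w₀ x₀ n K.≈ 0#
    N≈0 = K.trans (D.at-base n) (D.Ñ₀₀≈0 r h≈0 g≈0 qⁿ≈1 w₀≈2s x₀≈1 s-reg regular (proj₁ (proj₂ (i₀-exists r))) (proj₂ (proj₂ (i₀-exists r))))

    Ñ₁₁∈P : P ∣ᵖ Deformation.Ñ₁₁ ℤ[q] q s w₀ x₀ h g n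
    Ñ₁₁∈P = Ñ₁₁-reduce P s w₀ x₀ h g n (≈0⇒∣ᵖ (D.Ñ₁₁≈0 r h≈0 g≈0 qⁿ≈1 w₀≈2s x₀≈1 s-reg regular (proj₁ (proj₂ (i₀-exists r))) (proj₂ (proj₂ (i₀-exists r)))))

regular-q^-q^ : ∀ {a b} → a < b → Regular (q ^ a - q ^ b)
regular-q^-q^ {a} {b} a<b = Regular-resp (begin
  q ^ a * (1# - q ^ suc k) ≈⟨ solve 2 (λ u v → u :* (con (+ 1) :- v) := u :- u :* v) ≃-refl (q ^ a) (q ^ suc k) ⟩
  q ^ a - q ^ a * q ^ suc k ≈⟨ +-congˡ (-‿cong (≃-sym (^-homo-* q a (suc k)))) ⟩
  q ^ a - q ^ (a ℕ.+ suc k) ≡⟨ ≡.cong (λ j → q ^ a - q ^ j) (≡.trans (ℕ.+-suc a k) (ℕ.m+[n∸m]≡n a<b)) ⟩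
  q ^ a - q ^ b ∎) (Regular-* (Regular-^ a regular-q) (regular-1-q^ k))
  where
  k : ℕ
  k = b ℕ.∸ suc a

regular-q^-q^-≢ : ∀ {a b} → a ≢ b → Regular (q ^ a - q ^ b)
regular-q^-q^-≢ {a} {b} a≢b with ℕ.<-cmp a b
... | tri< a<b _ _ = regular-q^-q^ a<b
... | tri≈ _ a≡b _ = contradiction a≡b a≢b
... | tri> _ _ b<a = λ c e → regular-q^-q^ b<a c (begin
  (q ^ b - q ^ a) * c ≈⟨ solve 3 (λ u v c → (v :- u) :* c := :- ((u :- v) :* c)) ≃-refl (q ^ a) (q ^ b) c ⟩
  - ((q ^ a - q ^ b) * c) ≈⟨ ≃-trans (-‿cong e) -0#≈0# ⟩
  0# ∎)

∣ᵖ-∏ : ∀ {P n i} F → i < n → P ∣ᵖ F i → P ∣ᵖ ∏ n F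
∣ᵖ-∏ F i<n d with ∏-extract F i<n
... | c , e , _ = ∣ᵖ-resp (≃-sym e) (∣ᵖ-*ʳ c d)

∣ᵖ-∏-difference : ∀ {P} n {F G} → (∀ i → P ∣ᵖ F i - G i) → P ∣ᵖ ∏ n F - ∏ n G
∣ᵖ-∏-difference zero    h = ≈⇒∣ᵖ- ≃-refl
∣ᵖ-∏-difference (suc n) {F} {G} h = ∣ᵖ-resp
  (solve 4 (λ a f b g → (a :- b) :* f :+ b :* (f :- g) := a :* f :- b :* g) ≃-refl (∏ n F) (F n) (∏ n G) (G n))
  (∣ᵖ-+ (∣ᵖ-*ʳ (F n) (∣ᵖ-∏-difference n h)) (∣ᵖ-*ˡ (∏ n G) (h n)))

-- n = 4 a + 3.  The partial sum vanishes at w = 1 + s² = w₀ + h, has a closed form at x = q^{3n},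
-- and its mixed difference carries the factor h g ∈ (Φ_n³).
module FourthPower (a : ℕ) (P : Poly) (P∣q^-1 : P ∣ᵖ q ^ suc (2 ℕ.* suc (2 ℕ.* a)) - 1#)
  (1-q^-coprime : ∀ j → ¬ (suc (2 ℕ.* suc (2 ℕ.* a)) ∣ j) → Coprimeᵖ (1# - q ^ j) P) where

  r m n : ℕ
  r = suc (2 ℕ.* a)
  m = 2 ℕ.* r
  n = suc m

  open Modulo r P P∣q^-1 1-q^-coprime using (module K; Ñ₁₁∈P)

  P∣q^-1-multiple : ∀ {e} → n ∣ e → P ∣ᵖ q ^ e - 1#
  P∣q^-1-multiple n∣e = ∣ᵖ-trans P∣q^-1 (q^-1-∣ n∣e)

  P∣1-q^-multiple : ∀ {e} → n ∣ e → P ∣ᵖ 1# - q ^ e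
  P∣1-q^-multiple {e} n∣e = ∣ᵖ-resp (solve 1 (λ a → :- (a :- con (+ 1)) := con (+ 1) :- a) ≃-refl (q ^ e)) (∣ᵖ-neg (P∣q^-1-multiple n∣e))

  -- Chosen so that `s + s + h` is `1 + s²`, where `f y` factors as `(1 - s y) (s - y)`, and `1 + g`
  -- is `q ^ (3 n)`.
  s h g : Poly
  s = q ^ n
  h = (1# - s) * (1# - s)
  g = q ^ (3 ℕ.* n) - 1#

  N : Poly → Poly → Poly
  N w x = ℤq.Series.N q s w x n

  q^-* : ∀ i j → q ^ i * q ^ j ≈ q ^ (i ℕ.+ j)
  q^-* i j = ≃-sym (^-homo-* q i j)

  1-cong : ∀ {y z} → y ≈ z → 1# - y ≈ 1# - z
  1-cong e = +-congˡ (-‿cong e)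

  f-factor : ∀ {w} → w ≈ s + s + h → ∀ y → ℤq.Series.f q s w y ≈ (1# - s * y) * (s - y)
  f-factor {w} e y = ≃-trans (+-congʳ (+-congˡ (-‿cong (*-congʳ e))))
    (solve 2 (λ s y → let one = con (+ 1) in s :- (s :+ s :+ (one :- s) :* (one :- s)) :* y :+ s :* (y :* y) := (one :- s :* y) :* (s :- y)) ≃-refl s y)

  f-at-s : ∀ {w} → w ≈ s + s + h → ∀ {y} → y ≈ s → ℤq.Series.f q s w y ≈ 0#
  f-at-s e {y} y≈s = ≃-trans (f-factor e y) (≃-trans (*-congˡ (≃-trans (+-congˡ (-‿cong y≈s)) (-‿inverseʳ s))) (zeroʳ _))

  -- Going from `1` to `q ^ (4 (a + 1))`, the last step contributes
  -- `f (q ^ (3 + 4 a)) = f (q ^ n) = 0`, while the factors beside `N w x` on the other side are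
  -- regular. The boundaries vanish because `gs r = g (q ^ n)` also contains `f (q ^ n)`.
  vanishes : ∀ {w x} → w ≈ s + s + h → x ≈ 1# → N w x ≈ 0#
  vanishes {w} {x} w≈ x≈1 = Regular-* (Regular-^ (suc a) (Regular-^ n regular-q)) (Regular-∏ (suc a) λ i _ →
      Regular-* (reg (4 ℕ.* i)) (reg (2 ℕ.+ 4 ℕ.* i))) _ (begin
    s ^ suc a * ∏ (suc a) Q * N w x ≈⟨ solve 3 (λ a b c → a :* b :* c := a :* c :* b) ≃-refl (s ^ suc a) (∏ (suc a) Q) (N w x) ⟩
    s ^ suc a * N w x * ∏ (suc a) Q ≈⟨ *-congˡ (∏-cong (suc a) λ i _ → *-cong (Q≈ (2 ℕ.* n ℕ.+ 4 ℕ.* i) _ (ar₁ m i)) (Q≈ (2 ℕ.+ 2 ℕ.* n ℕ.+ 4 ℕ.* i) _ (ar₂ m i))) ⟨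
    s ^ suc a * N w x * ∏ (suc a) (λ i → (1# - q ^ (2 ℕ.* n ℕ.+ 4 ℕ.* i) * x) * (1# - q ^ (2 ℕ.+ 2 ℕ.* n ℕ.+ 4 ℕ.* i) * x))
      ≈⟨ W.chain m x (suc a) (λ i _ → boundary≈0 (x * q ^ (4 ℕ.* i))) ⟨
    W.N (x * q ^ (4 ℕ.* suc a)) n * ∏ (suc a) (λ i → W.f (q ^ (3 ℕ.+ 4 ℕ.* i) * x))
      ≈⟨ ≃-trans (*-congˡ (∏-zero (λ i → W.f (q ^ (3 ℕ.+ 4 ℕ.* i) * x)) (ℕ.≤-refl {suc a}) (f-at-s w≈ (≃-trans (*-congˡ x≈1) (≃-trans (*-identityʳ _) (reflexive (≡.cong (q ^_) (ar₃ a)))))))) (zeroʳ _) ⟩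
    0# ∎)
    where
    module W = ℤq.Series q s w
    Q : ℕ → Poly
    Q i = (1# - q ^ (suc (suc (m ℕ.+ m ℕ.+ 4 ℕ.* i)))) * (1# - q ^ (suc (suc (m ℕ.+ m ℕ.+ (2 ℕ.+ 4 ℕ.* i)))))
    reg : ∀ k → Regular (1# - q ^ suc (suc (m ℕ.+ m ℕ.+ k)))
    reg k = regular-1-q^ (suc (m ℕ.+ m ℕ.+ k))
    Q≈ : ∀ i j → i ≡ j → 1# - q ^ i * x ≈ 1# - q ^ j
    Q≈ i j e = 1-cong (≃-trans (*-cong (reflexive (≡.cong (q ^_) e)) x≈1) (*-identityʳ _))
    ar₁ : ∀ m i → 2 ℕ.* suc m ℕ.+ 4 ℕ.* i ≡ suc (suc (m ℕ.+ m ℕ.+ 4 ℕ.* i))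
    ar₁ = solve-∀
    ar₂ : ∀ m i → 2 ℕ.+ 2 ℕ.* suc m ℕ.+ 4 ℕ.* i ≡ suc (suc (m ℕ.+ m ℕ.+ (2 ℕ.+ 4 ℕ.* i)))
    ar₂ = solve-∀
    ar₃ : ∀ a → 3 ℕ.+ 4 ℕ.* a ≡ suc (2 ℕ.* suc (2 ℕ.* a))
    ar₃ = solve-∀
    r<n : r < n
    r<n = s≤s (ℕ.m≤n*m r 2)
    boundary≈0 : ∀ y → W.boundary y m ≈ 0#
    boundary≈0 y = ≃-trans (*-congˡ (≃-trans (*-congʳ (∏-zero W.gs r<n (≃-trans (*-congˡ (f-at-s w≈ ≃-refl)) (zeroʳ _)))) (zeroˡ _))) (zeroʳ _)

  -- t steps x ↦ q⁴ x lead from q to q^{3n}.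
  t : ℕ
  t = 3 ℕ.* a ℕ.+ 2

  m≡t+a : m ≡ t ℕ.+ a
  m≡t+a = ar a
    where
    ar : ∀ a → 2 ℕ.* suc (2 ℕ.* a) ≡ (3 ℕ.* a ℕ.+ 2) ℕ.+ a
    ar = solve-∀

  y : ℕ → Poly
  y i = q ^ (4 ℕ.* suc i)

  E H : ℕ → Poly
  E i = (1# - y i) * (1# - q ^ (2 ℕ.* suc i) * q)
  H i = (1# - q ^ (2 ℕ.* n ℕ.+ 4 ℕ.* i) * q) * (1# - q ^ (2 ℕ.+ 2 ℕ.* n ℕ.+ 4 ℕ.* i) * q)

  tail : Poly → Poly
  tail w = ∏ a λ j → ℤq.Series.f q s w (y (t ℕ.+ j))

  common : Poly
  common = s ^ t * (1# - q) * (∏ m E * ∏ t H)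

  module _ {w : Poly} (reg : ∀ i → Regular (ℤq.Series.f q s w (y i))) where
    private module W = ℤq.Series q s w

    -- `node q 0` is zero, so every term after the first vanishes and only the common denominator
    -- grows.
    at-q : ∀ k → W.N q (suc k) ≈ (1# - q) * ∏ k (λ i → W.den q (suc i))
    at-q zero    = ≃-trans (W.N-1 q) (≃-sym (*-identityʳ _))
    at-q (suc k) = begin
      W.N q (suc k) * W.den q (suc k) + W.num q (suc k)
        ≈⟨ +-cong (*-congʳ (at-q k)) (≃-trans (*-congˡ (≃-trans (*-congˡ (∏-zero {suc k} {0} (W.node q) (s≤s z≤n)
             (solve 1 (λ q → q :- q :* con (+ 1) := con (+ 0)) ≃-refl q))) (zeroʳ _))) (zeroʳ _)) ⟩
      (1# - q) * ∏ k (λ i → W.den q (suc i)) * W.den q (suc k) + 0# ≈⟨ ≃-trans (+-identityʳ _) (*-assoc _ _ _) ⟩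
      (1# - q) * ∏ (suc k) (λ i → W.den q (suc i)) ∎

    -- The `t` values of `f` met on the way from `q` are the first `t` of the `m` values of `f` in
    -- the denominators of `W.N q n`. Cancelling them leaves the last `a`, which make up `tail w`;
    -- nothing else depends on `w`.
    closed-form : N w (q ^ (3 ℕ.* n)) ≈ common * tail w
    closed-form = Regular-cancel (Regular-∏ t λ i _ → reg i) (begin
      ∏ t F * N w (q ^ (3 ℕ.* n)) ≈⟨ *-comm _ _ ⟩
      N w (q ^ (3 ℕ.* n)) * ∏ t F
        ≈⟨ *-cong (W.N-cong n (reflexive (≡.cong (q ^_) (ar₁ a)))) (∏-cong t λ i _ → W.f-cong (≃-trans (reflexive (≡.cong (q ^_) (ar₂ i))) (≃-sym (q^-*-q (3 ℕ.+ 4 ℕ.* i))))) ⟩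
      W.N (q * q ^ (4 ℕ.* t)) n * ∏ t (λ i → W.f (q ^ (3 ℕ.+ 4 ℕ.* i) * q))
        ≈⟨ W.chain m q t boundary≈0 ⟩
      s ^ t * W.N q n * ∏ t H ≈⟨ *-congʳ (*-congˡ (at-q m)) ⟩
      s ^ t * ((1# - q) * ∏ m (λ i → W.den q (suc i))) * ∏ t H
        ≈⟨ *-congʳ (*-congˡ (*-congˡ (≃-trans (∏-cong m λ i _ → den≈ i) (∏-* m F E)))) ⟩
      s ^ t * ((1# - q) * (∏ m F * ∏ m E)) * ∏ t H
        ≈⟨ *-congʳ (*-congˡ (*-congˡ (*-congʳ (≃-trans (reflexive (≡.cong (λ k → ∏ k F) m≡t+a)) (∏-+ t a F))))) ⟩
      s ^ t * ((1# - q) * (∏ t F * tail w * ∏ m E)) * ∏ t H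
        ≈⟨ solve 6 (λ s c F G E H → s :* (c :* (F :* G :* E)) :* H := F :* (s :* c :* (E :* H) :* G)) ≃-refl (s ^ t) (1# - q) (∏ t F) (tail w) (∏ m E) (∏ t H) ⟩
      ∏ t F * (common * tail w) ∎)
      where
      F : ℕ → Poly
      F i = W.f (y i)
      q^-*-q : ∀ k → q ^ k * q ≈ q ^ suc k
      q^-*-q k = *-comm _ _
      ar₁ : ∀ a → 3 ℕ.* suc (2 ℕ.* suc (2 ℕ.* a)) ≡ suc (4 ℕ.* (3 ℕ.* a ℕ.+ 2))
      ar₁ = solve-∀
      ar₂ : ∀ i → 4 ℕ.* suc i ≡ suc (3 ℕ.+ 4 ℕ.* i)
      ar₂ i = ℕ.*-suc 4 i
      t≤m : t ≤ m
      t≤m = ℕ.≤-trans (ℕ.m≤m+n t a) (ℕ.≤-reflexive (≡.sym m≡t+a))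
      boundary≈0 : ∀ i → i < t → W.boundary (q * q ^ (4 ℕ.* i)) m ≈ 0#
      boundary≈0 i i<t = ≃-trans (*-congˡ (≃-trans (*-congˡ (∏-zero (W.node (q * q ^ (4 ℕ.* i))) (ℕ.≤-trans i<t t≤m) (-‿inverseʳ _))) (zeroʳ _))) (zeroʳ _)
      den≈ : ∀ i → W.den q (suc i) ≈ F i * E i
      den≈ i = solve 3 (λ y f z → (y :* f) :* z := f :* (y :* z)) ≃-refl (1# - y i) (F i) (1# - q ^ (2 ℕ.* suc i) * q)

  P²∣common : P * P ∣ᵖ common
  P²∣common = ∣ᵖ-*ˡ (s ^ t * (1# - q)) (∣ᵖ-*
    -- `E (2 a)` contains `1 - q ^ n`, and `H a` contains `1 - q ^ (3 n)`.
    (∣ᵖ-∏ E 2a<m (∣ᵖ-*ˡ _ (∣ᵖ-resp (1-cong (≃-trans (reflexive (≡.cong (q ^_) (ar₁ a))) (*-comm q _))) (P∣1-q^-multiple {n} ℕ∣.∣-refl))))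
    (∣ᵖ-∏ H a<t (∣ᵖ-*ˡ _ (∣ᵖ-resp (1-cong (≃-trans (reflexive (≡.cong (q ^_) (ar₂ a))) (*-comm q _))) (P∣1-q^-multiple {3 ℕ.* n} (ℕ∣.divides 3 ≡.refl))))))
    where
    2a<m : 2 ℕ.* a < m
    2a<m = ℕ.m≤n*m r 2
    a<t : a < t
    a<t = ℕ.≤-trans (ℕ.m≤m+n (suc a) (suc (2 ℕ.* a))) (ℕ.≤-reflexive (ar₃ a))
      where
      ar₃ : ∀ a → suc a ℕ.+ suc (2 ℕ.* a) ≡ 3 ℕ.* a ℕ.+ 2
      ar₃ = solve-∀
    ar₁ : ∀ a → suc (2 ℕ.* suc (2 ℕ.* a)) ≡ suc (2 ℕ.* suc (2 ℕ.* a))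
    ar₁ _ = ≡.refl
    ar₂ : ∀ a → 3 ℕ.* suc (2 ℕ.* suc (2 ℕ.* a)) ≡ suc (2 ℕ.+ 2 ℕ.* suc (2 ℕ.* suc (2 ℕ.* a)) ℕ.+ 4 ℕ.* a)
    ar₂ = solve-∀

  P²∣h : P * P ∣ᵖ h
  P²∣h = ∣ᵖ-* (P∣1-q^-multiple {n} ℕ∣.∣-refl) (P∣1-q^-multiple {n} ℕ∣.∣-refl)

  regular-at-w₀ : ∀ {w} → w ≈ s + s → ∀ i → Regular (ℤq.Series.f q s w (y i))
  regular-at-w₀ {w} w≈ i = Regular-resp (≃-sym (ℤq.Series.f-square q s w w≈ (≃-refl {1#}) (y i)))
    (Regular-* (Regular-^ n regular-q) (Regular-^ 2 (regular-1-q^ (i ℕ.+ 3 ℕ.* suc i))))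

  regular-at-w₁ : ∀ {w} → w ≈ s + s + h → ∀ i → Regular (ℤq.Series.f q s w (y i))
  regular-at-w₁ w≈ i = Regular-resp (≃-sym (f-factor w≈ (y i)))
    (Regular-* (Regular-resp (1-cong (≃-sym (q^-* n (4 ℕ.* suc i)))) (regular-1-q^ (m ℕ.+ 4 ℕ.* suc i)))
      -- The exponents `n` and `4 (i + 1)` differ in parity.
      (regular-q^-q^-≢ λ n≡4i → odd≢even r (2 ℕ.* suc i) (≡.trans n≡4i (ar i))))
    where
    ar : ∀ i → 4 ℕ.* suc i ≡ 2 ℕ.* (2 ℕ.* suc i)
    ar = solve-∀
    odd≢even : ∀ j k → suc (2 ℕ.* j) ≢ 2 ℕ.* k
    odd≢even j k e with ℕ∣.∣m+n∣m⇒∣n {2} {2 ℕ.* j} {1} (≡.subst (2 ∣_) (≡.trans (≡.sym e) (ℕ.+-comm 1 (2 ℕ.* j))) (ℕ∣.m∣m*n k)) (ℕ∣.m∣m*n j)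
    ... | d with ℕ∣.∣⇒≤ d
    ... | s≤s ()

  -- The summands `0#` make the four points agree literally with those of `mixed-difference`.
  w₀ w₁ x₀ x₁ : Poly
  w₀ = s + s + 0#
  w₁ = s + s + h
  x₀ = 1# + 0#
  x₁ = 1# + g

  w₀≈ : w₀ ≈ s + s
  w₀≈ = +-identityʳ _

  x₀≈ : x₀ ≈ 1#
  x₀≈ = +-identityʳ _

  private module D = Deformation ℤ[q] q s (s + s) 1# h g

  P∣g : P ∣ᵖ g
  P∣g = P∣q^-1-multiple {3 ℕ.* n} (ℕ∣.divides 3 ≡.refl)

  P∣h : P ∣ᵖ h
  P∣h = ∣ᵖ-*ʳ _ (P∣1-q^-multiple {n} ℕ∣.∣-refl)

  coprime-s : Coprimeᵖ s P
  coprime-s = from P∣q^-1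
   where
   from : P ∣ᵖ s - 1# → Coprimeᵖ s P
   from (divides {c} c≢0 C e) = bezout c≢0 (constP c) (- C) (begin
    constP c * s + - C * P ≈⟨ solve 4 (λ c s C P → c :* s :+ (:- C) :* P := c :* (s :- con (+ 1)) :- P :* C :+ c) ≃-refl (constP c) s C P ⟩
    constP c * (s - 1#) - P * C + constP c ≈⟨ +-congʳ (≃-trans (+-congʳ e) (-‿inverseʳ _)) ⟩
    0# + constP c ≈⟨ +-identityˡ _ ⟩
    constP c ∎)

  P∣Ñ₁₁ : P ∣ᵖ D.Ñ₁₁ n
  P∣Ñ₁₁ = Ñ₁₁∈P s (s + s) 1# h g (∣ᵖ⇒≈0 P∣h) (∣ᵖ⇒≈0 P∣g) K.refl K.refl (coprime⇒regular coprime-s)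

  at-x₁ : ∀ {w} → (∀ i → Regular (ℤq.Series.f q s w (y i))) → N w x₁ ≈ common * tail w
  at-x₁ {w} reg = ≃-trans (ℤq.Series.N-cong q s w n (solve 1 (λ a → con (+ 1) :+ (a :- con (+ 1)) := a) ≃-refl (q ^ (3 ℕ.* n)))) (closed-form reg)

  -- The mixed difference solved for one corner: the corner at `w₁` and `x₀` is zero, and those at
  -- `x₁` have closed forms that differ only in their tails.
  N-base : N w₀ x₀ ≈ h * g * (D.Ñ₁₁ n + h * D.Ñ₂₁ n) - common * (tail w₁ - tail w₀)
  N-base = begin
    N w₀ x₀ ≈⟨ solve 3 (λ u v z → z := (u :- con (+ 0)) :- (v :- z) :- (u :- v)) ≃-refl (common * tail w₁) (common * tail w₀) (N w₀ x₀) ⟩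
    (common * tail w₁ - 0#) - (common * tail w₀ - N w₀ x₀) - (common * tail w₁ - common * tail w₀)
      ≈⟨ +-congʳ (+-cong (+-cong (at-x₁ (regular-at-w₁ ≃-refl)) (-‿cong (vanishes ≃-refl x₀≈))) (-‿cong (+-congʳ (at-x₁ (regular-at-w₀ w₀≈))))) ⟨
    (N w₁ x₁ - N w₁ x₀) - (N w₀ x₁ - N w₀ x₀) - (common * tail w₁ - common * tail w₀)
      ≈⟨ +-cong (D.mixed-difference n) (-‿cong (solve 3 (λ c u v → c :* u :- c :* v := c :* (u :- v)) ≃-refl common (tail w₁) (tail w₀))) ⟩
    h * g * (D.Ñ₁₁ n + h * D.Ñ₂₁ n) - common * (tail w₁ - tail w₀) ∎

  tails : P * P ∣ᵖ tail w₁ - tail w₀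
  tails = ∣ᵖ-∏-difference a λ j → ∣ᵖ-resp
    (solve 4 (λ s w h y → h :* (:- y) := (s :- (w :+ h) :* y :+ s :* (y :* y)) :- (s :- (w :+ con (+ 0)) :* y :+ s :* (y :* y))) ≃-refl s (s + s) h (y (t ℕ.+ j)))
    (∣ᵖ-*ʳ (- y (t ℕ.+ j)) P²∣h)

  -- The first summand has two factors `P` in `h`, one in `g` and one in the cofactor; the second
  -- has two in `common` and two in the difference of the tails.
  P⁴∣N : (P * P) * (P * P) ∣ᵖ N w₀ x₀
  P⁴∣N = ∣ᵖ-resp (≃-sym N-base) (∣ᵖ-+
    (∣ᵖ-resp (≃-sym (*-assoc h g _)) (∣ᵖ-* P²∣h (∣ᵖ-* P∣g (∣ᵖ-+ P∣Ñ₁₁ (∣ᵖ-*ʳ _ P∣h)))))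
    (∣ᵖ-neg (∣ᵖ-* P²∣common tails)))

-- The theorem

qPochhammer : ℕ → ℕ → ℕ → Poly
qPochhammer a b k = ∏ k λ j → 1# - q ^ (a ℕ.+ b ℕ.* j)

∏-suc : ∀ n F → ∏ (suc n) F ≈ F 0 * ∏ n (λ i → F (suc i))
∏-suc n F = ≃-trans (∏-+ 1 n F) (*-congʳ (*-identityˡ _))

∑-suc : ∀ n F → ∑ (suc n) F ≈ F 0 + ∑ n (λ i → F (suc i))
∑-suc n F = ≃-trans (ℤq.∑-+ 1 n F) (+-congʳ (+-identityˡ _))

poch≈ : ∀ a b k → poch a b k ≈ qPochhammer a b k
poch≈ a b k = go k (λ j → j)
  where
  factor : ℕ → Poly
  factor j = oneP ⊖ X^ (a ℕ.+ b ℕ.* j)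
  factor≈ : ∀ j → factor j ≈ 1# - q ^ (a ℕ.+ b ℕ.* j)
  factor≈ j = ≃-trans (reflexive (≡.trans (≡.sym (-≡⊖ oneP _)) (≡.cong (_- X^ (a ℕ.+ b ℕ.* j)) (≡.sym 1≡oneP)))) (+-congˡ (-‿cong (X^≈q^ (a ℕ.+ b ℕ.* j))))
  go : ∀ k f → prodP (map factor (applyUpTo f k)) ≈ ∏ k λ j → 1# - q ^ (a ℕ.+ b ℕ.* f j)
  go zero    f = reflexive (≡.sym 1≡oneP)
  go (suc k) f = begin
    factor (f 0) ⊗ prodP (map factor (applyUpTo (λ i → f (suc i)) k)) ≡⟨ *≡⊗ (factor (f 0)) _ ⟨
    factor (f 0) * prodP (map factor (applyUpTo (λ i → f (suc i)) k)) ≈⟨ *-cong (factor≈ (f 0)) (go k (λ i → f (suc i))) ⟩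
    (1# - q ^ (a ℕ.+ b ℕ.* f 0)) * ∏ k (λ j → 1# - q ^ (a ℕ.+ b ℕ.* f (suc j))) ≈⟨ ∏-suc k (λ j → 1# - q ^ (a ℕ.+ b ℕ.* f j)) ⟨
    ∏ (suc k) (λ j → 1# - q ^ (a ℕ.+ b ℕ.* f j)) ∎

^ₚ≈ : ∀ p k → p ^ₚ k ≈ p ^ k
^ₚ≈ p zero    = reflexive (≡.sym 1≡oneP)
^ₚ≈ p (suc k) = ≃-trans (reflexive (≡.sym (*≡⊗ p (p ^ₚ k)))) (*-congˡ (^ₚ≈ p k))

∏-^3 : ∀ k F → ∏ k (λ i → F i ^ 3) ≈ ∏ k F ^ 3
∏-^3 zero    F = solve 0 (con (+ 1) := con (+ 1) :^ 3) ≃-refl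
∏-^3 (suc k) F = ≃-trans (*-congʳ (∏-^3 k F)) (solve 2 (λ a b → a :^ 3 :* b :^ 3 := (a :* b) :^ 3) ≃-refl (∏ k F) (F k))

∏-upper : ∀ k → ∏ k (upper q) ≈ qPochhammer 1 2 k ^ 3 * qPochhammer 1 4 k
∏-upper k = ≃-trans (∏-* k _ _) (*-congʳ (∏-^3 k _))

∏-lower : ∀ k → ∏ k (lower q) ≈ qPochhammer 2 2 k * qPochhammer 4 4 k ^ 3
∏-lower k = ≃-trans (∏-* k _ _) (*-congˡ (∏-^3 k _))

term-numerator : ∀ k → proj₁ (term k) ≈ qint (6 ℕ.* k ℕ.+ 1) * q ^ (k ℕ.* k ℕ.+ k) * ∏ k (upper q)
term-numerator k = begin
  qint (6 ℕ.* k ℕ.+ 1) ⊗ (poch 1 2 k ^ₚ 3) ⊗ poch 1 4 k ⊗ X^ (k ℕ.* k ℕ.+ k)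
    ≡⟨ ≡.sym (≡.trans (*≡⊗ _ (X^ (k ℕ.* k ℕ.+ k))) (≡.cong (_⊗ X^ (k ℕ.* k ℕ.+ k)) (≡.trans (*≡⊗ _ (poch 1 4 k)) (≡.cong (_⊗ poch 1 4 k) (*≡⊗ (qint (6 ℕ.* k ℕ.+ 1)) (poch 1 2 k ^ₚ 3)))))) ⟩
  qint (6 ℕ.* k ℕ.+ 1) * (poch 1 2 k ^ₚ 3) * poch 1 4 k * X^ (k ℕ.* k ℕ.+ k)
    ≈⟨ *-cong (*-cong (*-congˡ (≃-trans (^ₚ≈ (poch 1 2 k) 3) (^-congˡ 3 (poch≈ 1 2 k)))) (poch≈ 1 4 k)) (X^≈q^ (k ℕ.* k ℕ.+ k)) ⟩
  qint (6 ℕ.* k ℕ.+ 1) * qPochhammer 1 2 k ^ 3 * qPochhammer 1 4 k * q ^ (k ℕ.* k ℕ.+ k)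
    ≈⟨ solve 4 (λ a b c d → a :* b :* c :* d := a :* d :* (b :* c)) ≃-refl _ (qPochhammer 1 2 k ^ 3) (qPochhammer 1 4 k) _ ⟩
  qint (6 ℕ.* k ℕ.+ 1) * q ^ (k ℕ.* k ℕ.+ k) * (qPochhammer 1 2 k ^ 3 * qPochhammer 1 4 k) ≈⟨ *-congˡ (∏-upper k) ⟨
  qint (6 ℕ.* k ℕ.+ 1) * q ^ (k ℕ.* k ℕ.+ k) * ∏ k (upper q) ∎

term-denominator : ∀ k → proj₂ (term k) ≈ ∏ k (lower q)
term-denominator k = begin
  poch 2 2 k ⊗ (poch 4 4 k ^ₚ 3) ≡⟨ *≡⊗ _ (poch 4 4 k ^ₚ 3) ⟨
  poch 2 2 k * (poch 4 4 k ^ₚ 3) ≈⟨ *-cong (poch≈ 2 2 k) (≃-trans (^ₚ≈ (poch 4 4 k) 3) (^-congˡ 3 (poch≈ 4 4 k))) ⟩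
  qPochhammer 2 2 k * qPochhammer 4 4 k ^ 3 ≈⟨ ∏-lower k ⟨
  ∏ k (lower q) ∎

-- `sumᵣ` never reduces its fractions, so its denominator need not be coprime to the modulus.
-- Cross-multiplication with `Ω` exhibits an equal fraction whose denominator is under control.
sumᵣ-clear : ∀ (rs : ℕ → RatFun) Ω (σ : ℕ → Poly) n (f : ℕ → ℕ) → (∀ i → i < n → Ω * proj₁ (rs (f i)) ≈ σ (f i) * proj₂ (rs (f i))) →
  Ω * proj₁ (sumᵣ (map rs (applyUpTo f n))) ≈ ∑ n (λ i → σ (f i)) * proj₂ (sumᵣ (map rs (applyUpTo f n)))
sumᵣ-clear rs Ω σ zero    f h = ≃-trans (≃-trans (*-congˡ (reflexive (≡.sym 0≡[]))) (zeroʳ Ω)) (≃-sym (zeroˡ _))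
sumᵣ-clear rs Ω σ (suc n) f h = begin
  Ω * (A ⊗ D ⊕ C ⊗ B) ≡⟨ ≡.cong (Ω *_) (≡.sym (≡.trans (+≡⊕ (A * D) (C * B)) (≡.cong₂ _⊕_ (*≡⊗ A D) (*≡⊗ C B)))) ⟩
  Ω * (A * D + C * B) ≈⟨ solve 5 (λ o a b c d → o :* (a :* d :+ c :* b) := (o :* a) :* d :+ (o :* c) :* b) ≃-refl Ω A B C D ⟩
  (Ω * A) * D + (Ω * C) * B ≈⟨ +-cong (*-congʳ (h 0 (s≤s z≤n))) (*-congʳ (sumᵣ-clear rs Ω σ n (λ i → f (suc i)) λ i i<n → h (suc i) (s≤s i<n))) ⟩
  (σ (f 0) * B) * D + (∑ n (λ i → σ (f (suc i))) * D) * B ≈⟨ solve 4 (λ s t b d → (s :* b) :* d :+ (t :* d) :* b := (s :+ t) :* (b :* d)) ≃-refl (σ (f 0)) _ B D ⟩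
  (σ (f 0) + ∑ n (λ i → σ (f (suc i)))) * (B * D) ≈⟨ *-cong (≃-sym (∑-suc n (λ i → σ (f i)))) (reflexive (*≡⊗ B D)) ⟩
  ∑ (suc n) (λ i → σ (f i)) * (B ⊗ D) ∎
  where
  A B C D : Poly
  A = proj₁ (rs (f 0))
  B = proj₂ (rs (f 0))
  C = proj₁ (sumᵣ (map rs (applyUpTo (λ i → f (suc i)) n)))
  D = proj₂ (sumᵣ (map rs (applyUpTo (λ i → f (suc i)) n)))

-- A common denominator coprime to `q ^ n - 1`.

module _ (r : ℕ) where
  private
    n : ℕ
    n = suc (2 ℕ.* r)
  open Integrality (q ^ n - 1#)

  private
    qPochhammer≈ : ∀ a b k → Vandermonde.pochhammer ℤ[q] (q ^ b) (q ^ a) k ≈ qPochhammer a b k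
    qPochhammer≈ a b k = ∏-cong k λ j _ → +-congˡ (-‿cong (≃-trans (*-congˡ (^-assocʳ q b j)) (≃-sym (^-homo-* q a (b ℕ.* j)))))

    -- Passes from the square of the argument to the argument itself; used once in base `q²` and
    -- twice in base `q⁴`, each time starting from a quotient equal to 1.
    half : ∀ a b → (∀ k → Integral (qPochhammer (suc a ℕ.+ suc a) b k) (qPochhammer b b k)) → ∀ k → Integral (qPochhammer (suc a) b k) (qPochhammer b b k)
    half a b h k = Integral-resp (qPochhammer≈ (suc a) b k) (qPochhammer≈ b b k)
      (Integral-pochhammer (q ^ b) (q ^ suc a)
        (λ j → Coprimeᵖ-resp (+-congˡ (≃-sym (^-assocʳ q (suc a) (suc j)))) (Coprimeᵖ-1+q^ r (suc a ℕ.* suc j)))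
        (λ j → Integral-resp (≃-trans (≃-sym (qPochhammer≈ (suc a ℕ.+ suc a) b j)) (Vandermonde.pochhammer-cong ℤ[q] (q ^ b) j (^-homo-* q (suc a) (suc a))))
          (≃-sym (qPochhammer≈ b b j)) (h j)) k)

    doubling : ∀ k → Integral (qPochhammer 2 2 k) (qPochhammer 4 4 k)
    doubling k = integral (Coprimeᵖ-∏ k λ j _ → Coprimeᵖ-1+q^ r (2 ℕ.+ 2 ℕ.* j)) 1# (begin
      ∏ k (λ j → 1# + q ^ (2 ℕ.+ 2 ℕ.* j)) * qPochhammer 2 2 k ≈⟨ ∏-* k _ _ ⟨
      ∏ k (λ j → (1# + q ^ (2 ℕ.+ 2 ℕ.* j)) * (1# - q ^ (2 ℕ.+ 2 ℕ.* j)))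
        ≈⟨ ∏-cong k (λ j _ → ≃-trans (solve 1 (λ y → (con (+ 1) :+ y) :* (con (+ 1) :- y) := con (+ 1) :- y :* y) ≃-refl (q ^ (2 ℕ.+ 2 ℕ.* j)))
             (+-congˡ (-‿cong (≃-trans (≃-sym (^-homo-* q (2 ℕ.+ 2 ℕ.* j) (2 ℕ.+ 2 ℕ.* j))) (reflexive (≡.cong (q ^_) (ar j))))))) ⟩
      qPochhammer 4 4 k ≈⟨ *-identityˡ _ ⟨
      1# * qPochhammer 4 4 k ∎)
      where
      ar : ∀ j → (2 ℕ.+ 2 ℕ.* j) ℕ.+ (2 ℕ.+ 2 ℕ.* j) ≡ 4 ℕ.+ 4 ℕ.* j
      ar = solve-∀

  -- Pairing numerators with denominators leaves one `(q;q²)_k / (q²;q²)_k`, two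
  -- `(q;q²)_k / (q⁴;q⁴)_k` and one `(q;q⁴)_k / (q⁴;q⁴)_k`. Working at `q ^ n - 1` treats all Φ_d
  -- with `d ∣ n` at once.
  terms-integral : ∀ k → Integral (∏ k (upper q)) (∏ k (lower q))
  terms-integral k = Integral-resp
    (≃-trans (solve 2 (λ b c → b :* (b :^ 2 :* c) := b :^ 3 :* c) ≃-refl (qPochhammer 1 2 k) (qPochhammer 1 4 k)) (≃-sym (∏-upper k)))
    (≃-trans (solve 2 (λ b c → b :* (c :^ 2 :* c) := b :* c :^ 3) ≃-refl (qPochhammer 2 2 k) (qPochhammer 4 4 k)) (≃-sym (∏-lower k)))
    (Integral-* b (Integral-* (Integral-* b′ (Integral-* b′ Integral-refl)) c))
    where
    b : Integral (qPochhammer 1 2 k) (qPochhammer 2 2 k)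
    b = half 0 2 (λ _ → Integral-refl) k
    b′ : Integral (qPochhammer 1 2 k) (qPochhammer 4 4 k)
    b′ = Integral-trans b (doubling k)
    c : Integral (qPochhammer 1 4 k) (qPochhammer 4 4 k)
    c = half 0 4 (half 1 4 λ _ → Integral-refl) k

  record CommonDenominator (N : ℕ) : Set where
    field
      Ω : Poly
      ρ : ℕ → Poly
      coprime  : Coprimeᵖ Ω (q ^ n - 1#)
      equation : ∀ k → k < N → Ω * ∏ k (upper q) ≈ ρ k * ∏ k (lower q)

  commonDenominator : ∀ N → CommonDenominator N
  commonDenominator N = record
    { Ω = ∏ N ω ; ρ = λ k → ρ′ k (k <? N) ; coprime = Coprimeᵖ-∏ N (λ k _ → Integral.coprime (terms-integral k))
    ; equation = λ k k<N → equation′ k k<N (k <? N) }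
    where
    ω : ℕ → Poly
    ω k = Integral.denominator (terms-integral k)
    ρ′ : ∀ k → Dec (k < N) → Poly
    ρ′ k (yes k<N) = Integral.numerator (terms-integral k) * proj₁ (∏-extract ω k<N)
    -- A default outside the range covered by `equation`.
    ρ′ k (no _)    = 0#
    equation′ : ∀ k → k < N → (d : Dec (k < N)) → ∏ N ω * ∏ k (upper q) ≈ ρ′ k d * ∏ k (lower q)
    equation′ k k<N (no ¬p) = contradiction k<N ¬p
    equation′ k _ (yes k<N) = begin
      ∏ N ω * U ≈⟨ *-congʳ (proj₁ (proj₂ (∏-extract ω k<N))) ⟩
      ω k * c * U ≈⟨ solve 3 (λ w c u → w :* c :* u := c :* (w :* u)) ≃-refl (ω k) c U ⟩
      c * (ω k * U) ≈⟨ *-congˡ (Integral.equation (terms-integral k)) ⟩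
      c * (z * L) ≈⟨ solve 3 (λ c z l → c :* (z :* l) := z :* c :* l) ≃-refl c z L ⟩
      z * c * L ∎
      where
      c z U L : Poly
      c = proj₁ (∏-extract ω k<N)
      z = Integral.numerator (terms-integral k)
      U = ∏ k (upper q)
      L = ∏ k (lower q)

regular-lower : ∀ i → Regular (lower q i)
regular-lower i = Regular-* (regular-1-q^ (1 ℕ.+ 2 ℕ.* i)) (Regular-^ 3 (regular-1-q^ (3 ℕ.+ 4 ℕ.* i)))

-- Splitting the sum into blocks.

module Terms (N : ℕ) (Ω : Poly) (ρ : ℕ → Poly) (equation : ∀ k → k < N → Ω * ∏ k (upper q) ≈ ρ k * ∏ k (lower q)) where

  τ : ℕ → Poly
  τ k = (1# - q ^ (1 ℕ.+ 6 ℕ.* k)) * q ^ (k ℕ.* k ℕ.+ k) * ρ k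

  -- The equations for `M + k` and `M` divided by each other. `∏ M (lower q)` may be zero modulo
  -- `P`, so it has to be cancelled in `ℤ[q]`, before reducing.
  ratio : ∀ M k → M ℕ.+ k < N → ρ (M ℕ.+ k) * ∏ k (λ i → lower q (M ℕ.+ i)) ≈ ρ M * ∏ k (λ i → upper q (M ℕ.+ i))
  ratio M k M+k<N = Regular-cancel (Regular-∏ M λ i _ → regular-lower i) (begin
    ∏ M (lower q) * (ρ (M ℕ.+ k) * L) ≈⟨ solve 3 (λ a b c → a :* (b :* c) := b :* (a :* c)) ≃-refl _ _ L ⟩
    ρ (M ℕ.+ k) * (∏ M (lower q) * L) ≈⟨ *-congˡ (∏-+ M k (lower q)) ⟨
    ρ (M ℕ.+ k) * ∏ (M ℕ.+ k) (lower q) ≈⟨ equation (M ℕ.+ k) M+k<N ⟨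
    Ω * ∏ (M ℕ.+ k) (upper q) ≈⟨ ≃-trans (*-congˡ (∏-+ M k (upper q))) (≃-sym (*-assoc Ω _ _)) ⟩
    Ω * ∏ M (upper q) * U ≈⟨ *-congʳ (equation M (ℕ.≤-<-trans (ℕ.m≤m+n M k) M+k<N)) ⟩
    ρ M * ∏ M (lower q) * U ≈⟨ solve 3 (λ a b c → a :* b :* c := b :* (a :* c)) ≃-refl (ρ M) _ U ⟩
    ∏ M (lower q) * (ρ M * U) ∎)
    where
    L U : Poly
    L = ∏ k (λ i → lower q (M ℕ.+ i))
    U = ∏ k (λ i → upper q (M ℕ.+ i))

  -- Modulo P the terms of a block M, …, M + d - 1 with d ∣ M are those of 0, …, d - 1, times a common factor.
  module Blocks (r : ℕ) (P : Poly) (P∣q^-1 : P ∣ᵖ q ^ suc (2 ℕ.* r) - 1#)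
    (1-q^-coprime : ∀ j → ¬ (suc (2 ℕ.* r) ∣ j) → Coprimeᵖ (1# - q ^ j) P) where

    d : ℕ
    d = suc (2 ℕ.* r)

    open Modulo r P P∣q^-1 1-q^-coprime
    private
      module W = K.Series q 1# (1# + 1#)

    pow : ∀ {e} e′ t → e ≡ e′ ℕ.+ t ℕ.* d → q ^ e K.≈ q K.^ e′
    pow {e} e′ t ≡.refl = K.trans {q ^ e} {q ^ e′} (∣ᵖ-resp (≃-trans (solve 2 (λ u v → u :* (v :- con (+ 1)) := u :* v :- u) ≃-refl (q ^ e′) (q ^ (t ℕ.* d)))
        (+-congʳ (≃-sym (^-homo-* q e′ (t ℕ.* d)))))
      (∣ᵖ-*ˡ (q ^ e′) (∣ᵖ-trans P∣q^-1 (q^-1-∣ (ℕ∣.divides t ≡.refl))))) (K.sym {q K.^ e′} (^≈ e′))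

    1-pow : ∀ {e} e′ t → e ≡ e′ ℕ.+ t ℕ.* d → 1# - q ^ e K.≈ 1# K.- q K.^ e′
    1-pow e′ t eq = K.+-congˡ (K.-‿cong (pow e′ t eq))

    ∏-reduce : ∀ k {F G} → (∀ i → F i K.≈ G i) → ∏ k F K.≈ K.∏ k G
    ∏-reduce zero    h = K.refl
    ∏-reduce (suc k) h = K.*-cong (∏-reduce k h) (h k)

    ∑-reduce : ∀ k F → ∑ k F K.≈ K.∑ k F
    ∑-reduce zero    F = K.refl
    ∑-reduce (suc k) F = K.+-cong (∑-reduce k F) K.refl

    module _ (c : ℕ) where
      M : ℕ
      M = c ℕ.* d

      upper-shift : ∀ i → upper q (M ℕ.+ i) K.≈ K.upper q i
      upper-shift i = K.*-cong (K.^-congˡ 3 (1-pow (1 ℕ.+ 2 ℕ.* i) (2 ℕ.* c) (ar c d i))) (1-pow (1 ℕ.+ 4 ℕ.* i) (4 ℕ.* c) (ar′ c d i))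
        where
        ar : ∀ c d i → 1 ℕ.+ 2 ℕ.* (c ℕ.* d ℕ.+ i) ≡ (1 ℕ.+ 2 ℕ.* i) ℕ.+ (2 ℕ.* c) ℕ.* d
        ar = solve-∀
        ar′ : ∀ c d i → 1 ℕ.+ 4 ℕ.* (c ℕ.* d ℕ.+ i) ≡ (1 ℕ.+ 4 ℕ.* i) ℕ.+ (4 ℕ.* c) ℕ.* d
        ar′ = solve-∀

      lower-shift : ∀ i → lower q (M ℕ.+ i) K.≈ K.lower q i
      lower-shift i = K.*-cong (1-pow (2 ℕ.+ 2 ℕ.* i) (2 ℕ.* c) (ar c d i)) (K.^-congˡ 3 (1-pow (4 ℕ.+ 4 ℕ.* i) (4 ℕ.* c) (ar′ c d i)))
        where
        ar : ∀ c d i → 2 ℕ.+ 2 ℕ.* (c ℕ.* d ℕ.+ i) ≡ (2 ℕ.+ 2 ℕ.* i) ℕ.+ (2 ℕ.* c) ℕ.* d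
        ar = solve-∀
        ar′ : ∀ c d i → 4 ℕ.+ 4 ℕ.* (c ℕ.* d ℕ.+ i) ≡ (4 ℕ.+ 4 ℕ.* i) ℕ.+ (4 ℕ.* c) ℕ.* d
        ar′ = solve-∀

      -- This is the hypothesis of `clear-denominators` with `ρ M` as `Ω`: all exponents of `q` are
      -- reduced modulo `d`, including the quadratic one.
      block-term : ∀ k → M ℕ.+ k < N →
        ρ M K.* ((1# K.- q K.^ (1 ℕ.+ 6 ℕ.* k)) K.* q K.^ (k ℕ.* k ℕ.+ k) K.* K.∏ k (K.upper q)) K.≈ τ (M ℕ.+ k) K.* K.∏ k (K.lower q)
      block-term k M+k<N = K.trans (≈⇒∣ᵖ- (solve 4 (λ p a b u → p :* (a :* b :* u) := a :* b :* (p :* u)) ≃-refl (ρ M) A B (K.∏ k (K.upper q))))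
        (K.trans {_} {A * B * (ρ M * ∏ k (λ i → upper q (M ℕ.+ i)))} (K.*-congˡ (K.*-congˡ (K.sym (∏-reduce k upper-shift))))
        (K.trans {_} {A * B * (ρ (M ℕ.+ k) * ∏ k (λ i → lower q (M ℕ.+ i)))} (K.*-congˡ (≈⇒∣ᵖ- (≃-sym (ratio M k M+k<N))))
        (K.trans (K.*-cong (K.*-cong (K.sym A≈) (K.sym B≈)) (K.*-congˡ (∏-reduce k lower-shift)))
          (≈⇒∣ᵖ- (≃-sym (*-assoc _ _ _))))))
        where
        A B : Poly
        A = 1# K.- q K.^ (1 ℕ.+ 6 ℕ.* k)
        B = q K.^ (k ℕ.* k ℕ.+ k)
        ar : ∀ c d k → 1 ℕ.+ 6 ℕ.* (c ℕ.* d ℕ.+ k) ≡ (1 ℕ.+ 6 ℕ.* k) ℕ.+ (6 ℕ.* c) ℕ.* d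
        ar = solve-∀
        ar′ : ∀ c d k → (c ℕ.* d ℕ.+ k) ℕ.* (c ℕ.* d ℕ.+ k) ℕ.+ (c ℕ.* d ℕ.+ k) ≡ (k ℕ.* k ℕ.+ k) ℕ.+ (c ℕ.* (c ℕ.* d) ℕ.+ 2 ℕ.* k ℕ.* c ℕ.+ c) ℕ.* d
        ar′ = solve-∀
        A≈ : 1# - q ^ (1 ℕ.+ 6 ℕ.* (M ℕ.+ k)) K.≈ A
        A≈ = 1-pow (1 ℕ.+ 6 ℕ.* k) (6 ℕ.* c) (ar c d k)
        B≈ : q ^ ((M ℕ.+ k) ℕ.* (M ℕ.+ k) ℕ.+ (M ℕ.+ k)) K.≈ B
        B≈ = pow (k ℕ.* k ℕ.+ k) (c ℕ.* (c ℕ.* d) ℕ.+ 2 ℕ.* k ℕ.* c ℕ.+ c) (ar′ c d k)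

      lower-regular : ∀ i → i < 2 ℕ.* r → K.Regular (K.lower q i)
      lower-regular i i<m = K.Regular-* (regular (2 ℕ.+ 2 ℕ.* i) (∤2+2i r i i<m)) (K.Regular-^ 3 (regular (4 ℕ.+ 4 ℕ.* i) (∤4+4i r i i<m)))

      block≈0 : M ℕ.+ d ≤ N → P ∣ᵖ ∑ d (λ k → τ (M ℕ.+ k))
      block≈0 M+d≤N = ≈0⇒∣ᵖ (K.trans {∑ d τ′} (∑-reduce d τ′) (K.Regular-∏ (2 ℕ.* r) den-regular _ (K.trans (K.*-comm Δ _)
        (K.trans (K.sym (W.clear-denominators K.refl K.refl (2 ℕ.* r) (ρ M) τ′ λ k k<d → block-term k (ℕ.<-≤-trans (ℕ.+-monoʳ-< M k<d) M+d≤N)))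
        -- The undeformed point `s = 1`, `w = 2`, `x = 1`, with `h` and `g` zero.
        (K.trans (K.*-congˡ (N≈0 1# (1# + 1#) 1# 0# 0# K.refl K.refl K.refl K.refl K.Regular-1)) (K.zeroʳ (ρ M)))))))
        where
        τ′ : ℕ → Poly
        τ′ k = τ (M ℕ.+ k)
        Δ : Poly
        Δ = K.∏ (2 ℕ.* r) (λ i → W.den 1# (suc i))
        den-regular : ∀ i → i < 2 ℕ.* r → K.Regular (W.den 1# (suc i))
        den-regular i i<m = K.Regular-resp (K.sym (W.den-at-1 {1#} K.refl K.refl i)) (K.Regular-* K.Regular-1 (lower-regular i i<m))

    blocks≈0 : ∀ c → c ℕ.* d ≤ N → P ∣ᵖ ∑ (c ℕ.* d) τ
    blocks≈0 zero    _ = ∣ᵖ-0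
    blocks≈0 (suc c) le = ≡.subst (λ k → P ∣ᵖ ∑ k τ) (≡.sym swap) (∣ᵖ-resp (≃-sym (ℤq.∑-+ (c ℕ.* d) d τ))
      (∣ᵖ-+ (blocks≈0 c (ℕ.≤-trans (ℕ.m≤n+m (c ℕ.* d) d) le)) (block≈0 c (ℕ.≤-trans (ℕ.≤-reflexive (≡.sym swap)) le))))
      where
      swap : suc c ℕ.* d ≡ c ℕ.* d ℕ.+ d
      swap = ℕ.+-comm d (c ℕ.* d)

Coprimeᵖ-lower : ∀ r {P} → (∀ j → ¬ (suc (2 ℕ.* r) ∣ j) → Coprimeᵖ (1# - q ^ j) P) → ∀ i → i < 2 ℕ.* r → Coprimeᵖ (lower q i) P
Coprimeᵖ-lower r coprime i i<m = Coprimeᵖ-* (coprime (2 ℕ.+ 2 ℕ.* i) (∤2+2i r i i<m)) (Coprimeᵖ-^ 3 (coprime (4 ℕ.+ 4 ℕ.* i) (∤4+4i r i i<m)))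

odd-divisor : ∀ {n k} → suc k ∣ suc (2 ℕ.* n) → ∃ λ r → k ≡ 2 ℕ.* r
odd-divisor {n} {k} d∣n with parity (suc k)
... | inj₂ (r , e) = r , ℕ.suc-injective e
... | inj₁ (r , e) with ℕ∣.∣⇒≤ (ℕ∣.∣m+n∣m⇒∣n {2} {2 ℕ.* n} {1} (≡.subst (2 ∣_) (ℕ.+-comm 1 (2 ℕ.* n)) (ℕ∣.∣-trans (≡.subst (2 ∣_) (≡.sym e) (ℕ∣.m∣m*n r)) d∣n)) (ℕ∣.m∣m*n n))
... | s≤s ()

-- Assembling the congruence.

module Final (a : ℕ) where
  r m n : ℕ
  r = suc (2 ℕ.* a)
  m = 2 ℕ.* r
  n = suc m

  open CommonDenominator (commonDenominator r n) renaming (coprime to Ω-coprime)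
  open Terms n Ω ρ equation

  σ : ℕ → Poly
  σ k = qint (6 ℕ.* k ℕ.+ 1) * q ^ (k ℕ.* k ℕ.+ k) * ρ k

  A : Poly
  A = ∑ n σ

  τ≈ : (1# - q) * A ≈ ∑ n τ
  τ≈ = ≃-trans (ℤq.*-distribˡ-∑ (1# - q) n σ) (ℤq.∑-cong n λ k _ → begin
    (1# - q) * (qint (6 ℕ.* k ℕ.+ 1) * q ^ (k ℕ.* k ℕ.+ k) * ρ k) ≈⟨ solve 4 (λ a b c d → a :* (b :* c :* d) := (a :* b) :* c :* d) ≃-refl (1# - q) (qint (6 ℕ.* k ℕ.+ 1)) (q ^ (k ℕ.* k ℕ.+ k)) (ρ k) ⟩
    ((1# - q) * qint (6 ℕ.* k ℕ.+ 1)) * q ^ (k ℕ.* k ℕ.+ k) * ρ k ≈⟨ *-congʳ (*-congʳ (qint-geometric (6 ℕ.* k ℕ.+ 1))) ⟩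
    (1# - q ^ (6 ℕ.* k ℕ.+ 1)) * q ^ (k ℕ.* k ℕ.+ k) * ρ k ≡⟨ ≡.cong (λ e → (1# - q ^ e) * q ^ (k ℕ.* k ℕ.+ k) * ρ k) (ℕ.+-comm (6 ℕ.* k) 1) ⟩
    τ k ∎)

  sum-cleared : Ω * proj₁ (S n) ≈ A * proj₂ (S n)
  sum-cleared = sumᵣ-clear term Ω σ n (λ i → i) λ k k<n → begin
    Ω * proj₁ (term k) ≈⟨ *-congˡ (term-numerator k) ⟩
    Ω * (qint (6 ℕ.* k ℕ.+ 1) * q ^ (k ℕ.* k ℕ.+ k) * ∏ k (upper q)) ≈⟨ solve 4 (λ o b c u → o :* (b :* c :* u) := b :* c :* (o :* u)) ≃-refl Ω (qint (6 ℕ.* k ℕ.+ 1)) (q ^ (k ℕ.* k ℕ.+ k)) (∏ k (upper q)) ⟩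
    qint (6 ℕ.* k ℕ.+ 1) * q ^ (k ℕ.* k ℕ.+ k) * (Ω * ∏ k (upper q)) ≈⟨ *-congˡ (equation k k<n) ⟩
    qint (6 ℕ.* k ℕ.+ 1) * q ^ (k ℕ.* k ℕ.+ k) * (ρ k * ∏ k (lower q)) ≈⟨ *-assoc _ _ _ ⟨
    σ k * ∏ k (lower q) ≈⟨ *-congˡ (term-denominator k) ⟨
    σ k * proj₂ (term k) ∎

  module WithΦ (P : Poly) (P∣q^-1 : P ∣ᵖ q ^ n - 1#) (1-q^-coprime : ∀ j → ¬ (n ∣ j) → Coprimeᵖ (1# - q ^ j) P) where
    open FourthPower a P P∣q^-1 1-q^-coprime using (s; w₀; x₀; w₀≈; x₀≈; P⁴∣N; coprime-s)
    private module W = ℤq.Series q s w₀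

    Δ : Poly
    Δ = ∏ m (λ i → W.den x₀ (suc i))

    Δ-coprime : Coprimeᵖ Δ P
    Δ-coprime = Coprimeᵖ-∏ m λ i i<m → Coprimeᵖ-resp (≃-sym (W.den-at-1 w₀≈ x₀≈ i)) (Coprimeᵖ-* coprime-s (Coprimeᵖ-lower r 1-q^-coprime i i<m))

    cleared : Ω * W.N x₀ n ≈ Δ * ∑ n τ
    cleared = ≃-trans (W.clear-denominators w₀≈ x₀≈ m Ω τ λ k k<n → begin
      Ω * (X k * ∏ k (upper q)) ≈⟨ solve 3 (λ o x u → o :* (x :* u) := x :* (o :* u)) ≃-refl Ω (X k) (∏ k (upper q)) ⟩
      X k * (Ω * ∏ k (upper q)) ≈⟨ *-congˡ (equation k k<n) ⟩
      X k * (ρ k * ∏ k (lower q)) ≈⟨ *-assoc (X k) (ρ k) _ ⟨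
      τ k * ∏ k (lower q) ∎) (*-comm _ _)
      where
      X : ℕ → Poly
      X k = (1# - q ^ (1 ℕ.+ 6 ℕ.* k)) * q ^ (k ℕ.* k ℕ.+ k)

    P⁴∣∑ : (P * P) * (P * P) ∣ᵖ ∑ n τ
    P⁴∣∑ = coprime-∣ᵖ (Coprimeᵖ-*ʳ (Coprimeᵖ-*ʳ Δ-coprime Δ-coprime) (Coprimeᵖ-*ʳ Δ-coprime Δ-coprime)) (∣ᵖ-resp cleared (∣ᵖ-*ˡ Ω P⁴∣N))

  Φ⁴∣∑ : (Φ n * Φ n) * (Φ n * Φ n) ∣ᵖ ∑ n τ
  Φ⁴∣∑ = WithΦ.P⁴∣∑ (Φ n) (Φ∣ᵖq^-1 (proj₁ (cyclotomic m))) λ j → Coprimeᵖ-1-q^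

  -- The divisor 1 is included: it accounts for the factor `1 - q` by which `τ` differs from `σ`,
  -- cancelled again in `modulus∣A`.
  divisor∣∑ : ∀ k → k < m → Φ∣ n k ∣ᵖ ∑ n τ
  divisor∣∑ k k<m = Φ∣-elim n k (_∣ᵖ ∑ n τ) (λ d∣n → via d∣n (odd-divisor {r} d∣n)) (∣ᵖ-multiple _ (≃-sym (*-identityˡ _)))
    where
    via : suc k ∣ n → (∃ λ r′ → k ≡ 2 ℕ.* r′) → Φ (suc k) ∣ᵖ ∑ n τ
    via (ℕ∣.divides c n≡cd) (r′ , ≡.refl) = ≡.subst (λ j → Φ (suc k) ∣ᵖ ∑ j τ) (≡.sym n≡cd)
      (Blocks.blocks≈0 r′ (Φ (suc k)) (Φ∣ᵖq^-1 (proj₁ (cyclotomic k))) (λ j → Coprimeᵖ-1-q^) c (ℕ.≤-reflexive (≡.sym n≡cd)))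

  modulus : Poly
  modulus = qint n * (Φ n * (Φ n * (Φ n * 1#)))

  q-1 : Poly
  q-1 = q - 1#

  q-1*qint : ∀ k → q-1 * qint k ≈ q ^ k - 1#
  q-1*qint k = begin
    (q - 1#) * qint k ≈⟨ solve 2 (λ q z → (q :- con (+ 1)) :* z := :- ((con (+ 1) :- q) :* z)) ≃-refl q (qint k) ⟩
    - ((1# - q) * qint k) ≈⟨ -‿cong (qint-geometric k) ⟩
    - (1# - q ^ k) ≈⟨ solve 1 (λ z → :- (con (+ 1) :- z) := z :- con (+ 1)) ≃-refl (q ^ k) ⟩
    q ^ k - 1# ∎

  -- `(q - 1) [n] Φ_n³` is `(q ^ n - 1) Φ_n³`, that is, the product of Φ_d over the proper divisors
  -- times `Φ_n⁴`. These two parts are coprime, so they can be treated separately.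
  all∣∑ : q-1 * modulus ∣ᵖ q-1 * A
  all∣∑ = ∣ᵖ-resp ∑τ≈ (∣ᵖ-*ʳ (- 1#) (∣ᵖ-respˡ product≈ (coprime-product-∣ᵖ coprime (product-∣ᵖ {n} m (λ k _ → proj₁ (cyclotomic k)) divisor∣∑) Φ⁴∣∑)))
    where
    Π : Poly
    Π = ∏ m (Φ∣ n)
    Π-coprime : Coprimeᵖ Π (Φ n)
    Π-coprime = Coprimeᵖ-∏ m λ k k<m → Coprimeᵖ-Φ∣ {n} (factorises-all m) k<m
    coprime : Coprimeᵖ Π ((Φ n * Φ n) * (Φ n * Φ n))
    coprime = Coprimeᵖ-*ʳ (Coprimeᵖ-*ʳ Π-coprime Π-coprime) (Coprimeᵖ-*ʳ Π-coprime Π-coprime)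
    regroup : ∀ x p z → z * p ≈ x → z * ((p * p) * (p * p)) ≈ x * (p * (p * (p * 1#)))
    regroup x p z e = ≃-trans (solve 2 (λ p z → z :* ((p :* p) :* (p :* p)) := (z :* p) :* (p :* (p :* (p :* con (+ 1))))) ≃-refl p z) (*-congʳ e)
    product≈ : Π * ((Φ n * Φ n) * (Φ n * Φ n)) ≈ q-1 * modulus
    product≈ = ≃-trans (regroup (q-1 * qint n) (Φ n) Π (≃-trans (≃-sym (Φ∣-extract (proj₁ (cyclotomic m)))) (≃-sym (q-1*qint n)))) (*-assoc q-1 (qint n) _)
    ∑τ≈ : ∑ n τ * - 1# ≈ q-1 * A
    ∑τ≈ = ≃-trans (*-congʳ (≃-sym τ≈)) (solve 2 (λ q a → ((con (+ 1) :- q) :* a) :* (:- con (+ 1)) := (q :- con (+ 1)) :* a) ≃-refl q A)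

  modulus∣A : modulus ∣ᵖ A
  modulus∣A = cancel all∣∑
    where
    cancel : q-1 * modulus ∣ᵖ q-1 * A → modulus ∣ᵖ A
    cancel (divides {c} c≢0 C e) = divides c≢0 C (Regular-cancel {q-1} (Regular-resp (+-congʳ (*-identityʳ q)) (regular-q^-1 0)) (begin
      q-1 * (constP c * A) ≈⟨ solve 3 (λ x c a → x :* (c :* a) := c :* (x :* a)) ≃-refl q-1 (constP c) A ⟩
      constP c * (q-1 * A) ≈⟨ e ⟩
      q-1 * modulus * C ≈⟨ *-assoc q-1 modulus C ⟩
      q-1 * (modulus * C) ∎))

  Ω-coprime-modulus : Coprimeᵖ Ω modulus
  Ω-coprime-modulus = Coprimeᵖ-*ʳ (∣ᵖ-coprime (∣ᵖ-multiple q-1 (≃-trans (≃-sym (q-1*qint n)) (*-comm q-1 _))) Ω-coprime)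
    (Coprimeᵖ-*ʳ cΦ (Coprimeᵖ-*ʳ cΦ (Coprimeᵖ-*ʳ cΦ (Coprimeᵖ-sym Coprimeᵖ-1))))
    where
    cΦ : Coprimeᵖ Ω (Φ n)
    cΦ = ∣ᵖ-coprime (Φ∣ᵖq^-1 (proj₁ (cyclotomic m))) Ω-coprime

  modulus≡ : modulus ≡ qint n ⊗ (Φ n ^ₚ 3)
  modulus≡ = ≡.trans (*≡⊗ (qint n) _) (≡.cong (qint n ⊗_) (cube (Φ n)))
    where
    cube : ∀ p → p * (p * (p * 1#)) ≡ p ^ₚ 3
    cube p = ≡.trans (*≡⊗ p _) (≡.cong (p ⊗_) (≡.trans (*≡⊗ p _) (≡.cong (p ⊗_) (≡.trans (*≡⊗ p 1#) (≡.cong (p ⊗_) 1≡oneP)))))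

  congruence : CongZero (S n) (qint n ⊗ (Φ n ^ₚ 3))
  -- The witness `A / Ω` equals the sum, and its denominator is coprime to `q ^ n - 1`, hence to
  -- `[n]` and to Φ_n.
  congruence = A , Ω , _≃_.coeff≡ (≃-trans (reflexive (≡.sym (*≡⊗ A _))) (≃-trans (≃-sym sum-cleared) (≃-trans (*-comm Ω _) (reflexive (*≡⊗ _ Ω)))))
    , ≡.subst (CoprimeP Ω) modulus≡ (Coprimeᵖ⇒CoprimeP Ω-coprime-modulus)
    , ≡.subst (λ p → DividesP p A) modulus≡ (∣ᵖ⇒DividesP modulus∣A)

theorem1p1 : (n : ℕ) → 1 ≤ n → n % 4 ≡ 3 →
    CongZero (S n) (qint n ⊗ (Φ n ^ₚ 3))
theorem1p1 n _ n%4≡3 = ≡.subst (λ n → CongZero (S n) (qint n ⊗ (Φ n ^ₚ 3))) (≡.sym n≡) (Final.congruence (n / 4))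
  where
  ar : ∀ a → 3 ℕ.+ a ℕ.* 4 ≡ suc (2 ℕ.* suc (2 ℕ.* a))
  ar = solve-∀
  n≡ : n ≡ suc (2 ℕ.* suc (2 ℕ.* (n / 4)))
  n≡ = ≡.trans (m≡m%n+[m/n]*n n 4) (≡.trans (≡.cong (ℕ._+ n / 4 ℕ.* 4) n%4≡3) (ar (n / 4)))
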